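{- Let $T$ be the set of triples of distinct elements of $S$, with its equivalence relation $\sim$, let $\mathrm{Cl}(\mathcal R)$ be the set of proper clusters of $\mathcal R$, and let $\mathfrak s_{\max}=\mathcal R$ be the maximal cluster. For an ordered triple $(a,b,c)\in T$ with radius $\mu=v(a-b)$ put $$\Phi((a,b,c)) = D(a,\mu)\cap \mathcal R .$$ Then $\Phi$ gives a well-defined map $\Phi: T/\!\sim\ \to \mathrm{Cl}(\mathcal R)$ (each equivalence class contains an ordered triple, and $\Phi$ takes the same value on equivalent ordered triples). Furthermore: (1) $\Phi: T/\!\sim\ \to \mathrm{Cl}(\mathcal R)$ is injective. (2) $\mathrm{Cl}(\mathcal R)\setminus\{\mathfrak s_{\max}\}\subset \mathrm{Im}(\Phi)$. (3) The cluster $\mathfrak s_{\max}$ lies in the image of $\Phi$ if either one of the following properties holds: (i) $\infty\in S$; (ii) there are three different elements $a,b,c\in\mathcal R$ satisfying $\mu(\mathfrak s_{\max})=v(a-b)=v(b-c)=v(a-c)$ (equivalently, $\mathfrak s_{\max}$ has more than two children).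
   Context: $\mathcal O$ is a complete discrete valuation ring with uniformizer $\pi$, fraction field $K$, residue field $k$ of characteristic $p$, and valuation $v$ with $v(\pi)=1$, extended to an algebraic closure $\overline K$. $n\ge 2$ is an integer with $p\nmid n$, and $K$ contains a primitive $n$-th root of unity. $f(x)\in\mathcal O[x]$ is monic with nonzero discriminant, its set of roots $\mathcal R$ is contained in $K$, and the curve $\mathcal C: y^n=f(x)$ has positive genus. Set $S=\mathcal R\cup\{\infty\}$ if $n\nmid\deg f$, and $S=\mathcal R$ otherwise (one has $|S|\ge 3$). Triples: $T$ is the set of triples of distinct elements of $S$. For $t=(a,b,c)\in T$, $\varphi_t(x)=\frac{(b-c)}{(b-a)}\frac{(x-a)}{(x-c)}$ is the Möbius transformation sending $(a,b,c)$ to $(0,1,\infty)$ (with the usual interpretation if one entry is $\infty$). Two triples are equivalent, $t_1\sim t_2$, if $\varphi_{t_2}\circ\varphi_{t_1}^{ -1}$ extends to an automorphism of $\mathbb P^1_{\mathcal O}$, i.e. is given by an element of $\mathrm{PGL}_2(\mathcal O)$. Convention: $v(\infty)=-\infty$, and a difference of a finite element and $\infty$ is $\infty$. An ordered triple is a triple $(a,b,c)\in T$ with $v(a-c)=v(b-c)\le v(a-b)$; its radius is $\mu=v(a-b)$. Clusters: for $z\in\overline K$, $d\in\mathbb Q$ let $D(z,d)=\{x\in\overline K: v(x-z)\ge d\}$. A cluster is a non-empty subset of $\mathcal R$ of the form $D(z,d)\cap\mathcal R$; it is proper if it has more than one element. The diameter of a proper cluster is $\mu(\mathfrak s)=\min\{v(z-t):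 z,t\in\mathfrak s\}$. A child of a cluster $\mathfrak s$ is a maximal cluster (possibly a singleton) strictly contained in $\mathfrak s$. -}

module Defs where

open import Algebra.Bundles using (AbelianGroup; CommutativeRing; Semiring)
import Algebra.Definitions.RawSemiring as RawSemiringOps
open import Algebra.Morphism.Structures using (module RingMorphisms)
import Algebra.Solver.Ring.NaturalCoefficients.Default as SemiringSolver
import Algebra.Properties.Group as GroupProperties
open import Data.Empty using (⊥-elim)
open import Data.Fin.Base using (Fin; toℕ)
open import Data.Integer.Base as ℤ using (ℤ; 0ℤ; 1ℤ)
import Data.Integer.Properties as ℤ
open import Data.List.Base using (List; []; _∷_; _∷ʳ_; map; foldr; length)
open import Data.List.Relation.Binary.Pointwise.Base using (Pointwise)
open import Data.List.Relation.Unary.All using (All)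
import Data.Maybe.Base as Maybe
open import Data.Nat.Base as ℕ using (ℕ)
open import Data.Nat.Divisibility using (_∣_; _∤_)
open import Data.Product using (_×_; _,_; ∃; ∃-syntax; proj₁; proj₂)
open import Data.Rational.Base as ℚ using (ℚ; _/_)
open import Function.Bundles using (_⇔_; Equivalence)
open import Level using (Level; _⊔_)
open import Relation.Binary.Bundles using (Setoid)
import Relation.Binary.Construct.Add.Extrema.NonStrict as AddExtrema
import Relation.Binary.Construct.Add.Point.Equality as AddPointEquality
import Relation.Binary.Construct.Add.Supremum.NonStrict as AddSupremum
open import Relation.Binary.Core using (Rel)
open import Relation.Binary.PropositionalEquality.Core as ≡ using (_≡_; _≢_)
open import Relation.Nullary.Construct.Add.Extrema using (_±; ⊥±)
open import Relation.Nullary.Construct.Add.Point using (Pointed; [_]; []-injective)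
  renaming (∙ to ∞)
open import Relation.Nullary.Construct.Add.Supremum using (_⁺; ⊤⁺)
open import Relation.Nullary.Negation.Core using (¬_)
open import Relation.Unary
  using (Pred; _∈_; _⊆_; _⊂_; _∩_; _⊢_; _≐_; Satisfiable)
open import Relation.Unary.Properties using (≐-refl; ≐-sym; ≐-trans)

-- The apartness-based `HeytingField` of the library is not used: here
-- "nonzero" and "distinct" just mean negated equality.

record Field c ℓ : Set (Level.suc (c ⊔ ℓ)) where
  field
    commutativeRing : CommutativeRing c ℓ
  open CommutativeRing commutativeRing public
  open RawSemiringOps (Semiring.rawSemiring semiring) public
    using (_^_; sum) renaming (_×_ to _·_)
  field
    1≉0     : 1# ≉ 0#
    inverse : ∀ x → x ≉ 0# → ∃[ y ] x * y ≈ 1#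

record FieldHom {c ℓ} (E F : Field c ℓ) : Set (c ⊔ ℓ) where
  private
    module E = Field E
    module F = Field F
  open RingMorphisms E.rawRing F.rawRing using (IsRingHomomorphism)
  field
    ⟦_⟧                : E.Carrier → F.Carrier
    isRingHomomorphism : IsRingHomomorphism ⟦_⟧

-- A polynomial is its list of coefficients, constant term first.

module Polynomial {c ℓ} (F : Field c ℓ) where
  open Field F

  Poly : Set c
  Poly = List Carrier

  eval : Poly → Carrier → Carrier
  eval p z = foldr (λ a r → a + z * r) 0# p

  -- X^d + c_{d-1} X^{d-1} + ⋯ + c_0 from its d lower coefficients.
  monic : List Carrier → Poly
  monic cs = cs ∷ʳ 1#

  _⊞_ : Poly → Poly → Poly
  []      ⊞ q       = q
  (a ∷ p) ⊞ []      = a ∷ p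
  (a ∷ p) ⊞ (b ∷ q) = (a + b) ∷ (p ⊞ q)

  _⊠_ : Poly → Poly → Poly
  []      ⊠ q = []
  (a ∷ p) ⊠ q = map (a *_) q ⊞ (0# ∷ (p ⊠ q))

  fromRoots : List Carrier → Poly
  fromRoots = foldr (λ r p → ((- r) ∷ 1# ∷ []) ⊠ p) (1# ∷ [])

  -- Discriminant of ∏ᵢ (X - rᵢ), that is ∏_{i<j} (rᵢ - rⱼ)².
  discriminant : List Carrier → Carrier
  discriminant []       = 1#
  discriminant (r ∷ rs) =
    foldr (λ s d → (r - s) ^ 2 * d) (discriminant rs) rs

  -- For a subring A: z is a root of a monic polynomial over A.
  IntegralOver : ∀ {a} → Pred Carrier a → Pred Carrier (c ⊔ ℓ ⊔ a)
  IntegralOver A z = ∃[ cs ] All A cs × eval (monic cs) z ≈ 0#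

  AlgebraicallyClosed : Set (c ⊔ ℓ)
  AlgebraicallyClosed = ∀ a cs → ∃[ z ] eval (monic (a ∷ cs)) z ≈ 0#

module _ {V : Set} (_+_ : V → V → V) where

  add⁺ : V ⁺ → V ⁺ → V ⁺
  add⁺ [ a ] [ b ] = [ a + b ]
  add⁺ _     _     = ⊤⁺

-- Additive valuations v : F → V ∪ {+∞}.  The ultrametric inequality
-- v (x + y) ≥ min (v x) (v y) is stated without mentioning `min`.

record Valuation {c ℓ} (F : Field c ℓ) {V : Set}
                 (_≤_ : Rel V Level.zero) (_+ᵥ_ : V → V → V)
                 : Set (c ⊔ ℓ) where
  open Field F
  open AddSupremum _≤_ using (_≤⁺_)
  field
    v      : Carrier → V ⁺
    v-cong : ∀ {x y} → x ≈ y → v x ≡ v y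
    v-∞    : ∀ x → v x ≡ ⊤⁺ ⇔ x ≈ 0#
    v-*    : ∀ x y → v (x * y) ≡ add⁺ _+ᵥ_ (v x) (v y)
    v-+    : ∀ x y γ → γ ≤⁺ v x → γ ≤⁺ v y → γ ≤⁺ v (x + y)

open AddSupremum ℤ._≤_ public using ([_]; _≤⊤⁺) renaming (_≤⁺_ to _≤ℤ⁺_)
open AddExtrema  ℤ._≤_ public using () renaming (_≤±_ to _≤ℤ±_)
open AddSupremum ℚ._≤_ public using () renaming (_≤⁺_ to _≤ℚ⁺_)

module ValuationRing {c ℓ} (K : Field c ℓ)
                     (valuation : Valuation K ℤ._≤_ ℤ._+_) where
  open Field K
  open Valuation valuation

  𝒪 𝔪 : Pred Carrier Level.zero
  𝒪 x = [ 0ℤ ] ≤ℤ⁺ v x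
  𝔪 x = [ 1ℤ ] ≤ℤ⁺ v x

  Cauchy : Pred (ℕ → Carrier) Level.zero
  Cauchy s = ∀ N → ∃[ M ] ∀ i j → M ℕ.≤ i → M ℕ.≤ j →
             [ ℤ.+ N ] ≤ℤ⁺ v (s i - s j)

  _⟶_ : (ℕ → Carrier) → Carrier → Set
  s ⟶ l = ∀ N → ∃[ M ] ∀ i → M ℕ.≤ i → [ ℤ.+ N ] ≤ℤ⁺ v (s i - l)

  Complete : Set c
  Complete = ∀ s → (∀ i → s i ∈ 𝒪) → Cauchy s → ∃[ l ] s ⟶ l

-- A discrete valuation ring is presented as the valuation ring 𝒪 of a
-- normalised discrete valuation on its fraction field K.

record CompleteDVR c ℓ : Set (Level.suc (c ⊔ ℓ)) where
  field
    K         : Field c ℓ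
    valuation : Valuation K ℤ._≤_ ℤ._+_
  open Field K public
  open Valuation valuation public
  open ValuationRing K valuation public
  field
    π        : Carrier
    vπ       : v π ≡ [ 1ℤ ]
    complete : Complete

  -- p generates the kernel of ℤ → 𝒪/𝔪; p = 0 is allowed.
  ResidueCharacteristic : ℕ → Set
  ResidueCharacteristic p = ∀ m → (m · 1#) ∈ 𝔪 ⇔ p ∣ m

  PrimitiveRoot : ℕ → Pred Carrier ℓ
  PrimitiveRoot n ζ =
    ζ ^ n ≈ 1# × (∀ m → 0 ℕ.< m → m ℕ.< n → ζ ^ m ≉ 1#)

record AlgebraicClosure {c ℓ} (R : CompleteDVR c ℓ) : Set (Level.suc (c ⊔ ℓ)) where
  private module R = CompleteDVR R
  field
    K̄         : Field c ℓ
    embedding : FieldHom R.K K̄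
    valuation : Valuation K̄ ℚ._≤_ ℚ._+_
  open Field K̄ public
  open Polynomial K̄ public
  open FieldHom embedding public renaming (⟦_⟧ to ι)
  open Valuation valuation public renaming (v to v̄)
  field
    algebraic : ∀ z → ∃[ cs ] eval (monic (map ι cs)) z ≈ 0#
    closed    : AlgebraicallyClosed
    extends   : ∀ x → v̄ (ι x) ≡ Maybe.map (_/ 1) (R.v x)

  D : Carrier → ℚ → Pred Carrier Level.zero
  D z d x = [ d ] ≤ℚ⁺ v̄ (x - z)

-- A function field of yⁿ = f(x) over the field C, i.e. a field isomorphic
-- to C(x)[Y]/(Yⁿ - f(x)): it is generated by x and y with yⁿ = f(x), and
-- 1, y, …, yⁿ⁻¹ is a basis over C(x), after clearing denominators.
-- Independence contains the transcendence of x.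

record FunctionField {c ℓ} (C : Field c ℓ) (n : ℕ)
                     (f : Polynomial.Poly C) : Set (Level.suc (c ⊔ ℓ)) where
  private
    module C = Field C
    module P = Polynomial C
  field
    F         : Field c ℓ
    constants : FieldHom C F
  open Field F public
  open Polynomial F public using (IntegralOver; eval)
  open FieldHom constants public renaming (⟦_⟧ to κ)

  infix 9 _⟨_⟩
  _⟨_⟩ : P.Poly → Carrier → Carrier
  p ⟨ z ⟩ = eval (map κ p) z

  field
    x x⁻¹ y     : Carrier
    xx⁻¹        : x * x⁻¹ ≈ 1#
    equation    : y ^ n ≈ f ⟨ x ⟩
    spanning    : ∀ z → ∃[ q ] ∃ λ (p : Fin n → P.Poly) → q ⟨ x ⟩ ≉ 0# ×
                  q ⟨ x ⟩ * z ≈ sum (λ j → p j ⟨ x ⟩ * y ^ toℕ j)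
    independent : ∀ (p : Fin n → P.Poly) →
                  sum (λ j → p j ⟨ x ⟩ * y ^ toℕ j) ≈ 0# →
                  ∀ j → All (C._≈ C.0#) (p j)

  C[x] C[x⁻¹] C[x,x⁻¹] : Pred Carrier (c ⊔ ℓ)
  C[x]     z = ∃[ p ] z ≈ p ⟨ x ⟩
  C[x⁻¹]   z = ∃[ p ] z ≈ p ⟨ x⁻¹ ⟩
  C[x,x⁻¹] z = ∃[ p ] ∃[ q ] z ≈ p ⟨ x ⟩ + q ⟨ x⁻¹ ⟩

  -- When C is algebraically closed, the smooth projective model X with
  -- function field F is covered by the affine opens x ≠ ∞ and x ≠ 0, whose
  -- coordinate rings are the integral closures of C[x] and C[x⁻¹]; their
  -- intersection has the integral closure of C[x,x⁻¹].  Thus H¹(X,𝒪_X) is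
  -- the quotient of the latter by the sum of the former two.
  Cocycle Coboundary : Pred Carrier (c ⊔ ℓ)
  Cocycle      = IntegralOver C[x,x⁻¹]
  Coboundary z = ∃[ u ] ∃[ w ]
    IntegralOver C[x] u × IntegralOver C[x⁻¹] w × z ≈ u + w

  IndependentInH¹ : ∀ m → (Fin m → Carrier) → Set (c ⊔ ℓ)
  IndependentInH¹ m h =
    (∀ i → h i ∈ Cocycle) ×
    (∀ (a : Fin m → C.Carrier) → sum (λ i → κ (a i) * h i) ∈ Coboundary →
       ∀ i → a i C.≈ C.0#)

  -- g = dim_C H¹(X,𝒪_X)
  HasGenus : ℕ → Set (c ⊔ ℓ)
  HasGenus g = ∃ (IndependentInH¹ g) × ¬ ∃ (IndependentInH¹ (ℕ.suc g))

record SuperellipticCurve c ℓ : Set (Level.suc (c ⊔ ℓ)) where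
  field
    dvr     : CompleteDVR c ℓ
    closure : AlgebraicClosure dvr
  open CompleteDVR dvr
  open Polynomial K
  private module K̄ = AlgebraicClosure closure
  field
    p n         : ℕ
    residueChar : ResidueCharacteristic p
    2≤n         : 2 ℕ.≤ n
    p∤n         : p ∤ n
    ζ           : Carrier
    ζ-primitive : PrimitiveRoot n ζ

    -- f is monic; only its lower coefficients are given.
    lower       : List Carrier
    lower∈𝒪     : All 𝒪 lower

  f : Poly
  f = monic lower

  deg-f : ℕ
  deg-f = length lower

  field
    -- The roots of f, listed with multiplicity, all lie in K.
    roots         : List Carrier
    splits        : Pointwise _≈_ f (fromRoots roots)
    disc≉0        : discriminant roots ≉ 0#
    functionField : FunctionField K̄.K̄ n (map K̄.ι f)
    genus         : ℕ
    hasGenus      : FunctionField.HasGenus functionField genus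
    0<genus       : 0 ℕ.< genus

record M₂ {c} (A : Set c) : Set c where
  constructor mat
  field
    e₁₁ e₁₂ e₂₁ e₂₂ : A

module Matrix {c ℓ} (F : Field c ℓ) where
  open Field F
  open M₂

  infix  4 _≈ₘ_
  infixl 7 _∙_
  infixr 7 _•_

  Mat : Set c
  Mat = M₂ Carrier

  record _≈ₘ_ (M N : Mat) : Set ℓ where
    constructor mat≈
    field
      ≈₁₁ : e₁₁ M ≈ e₁₁ N
      ≈₁₂ : e₁₂ M ≈ e₁₂ N
      ≈₂₁ : e₂₁ M ≈ e₂₁ N
      ≈₂₂ : e₂₂ M ≈ e₂₂ N

  _∙_ : Mat → Mat → Mat
  mat a b c d ∙ mat a′ b′ c′ d′ =
    mat (a * a′ + b * c′) (a * b′ + b * d′)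
        (c * a′ + d * c′) (c * b′ + d * d′)

  I : Mat
  I = mat 1# 0# 0# 1#

  _•_ : Carrier → Mat → Mat
  k • mat a b c d = mat (k * a) (k * b) (k * c) (k * d)

  EntriesIn : ∀ {a} → Pred Carrier a → Pred Mat a
  EntriesIn P M = P (e₁₁ M) × P (e₁₂ M) × P (e₂₁ M) × P (e₂₂ M)

  -- For a subring P: the units of the ring of matrices over P.
  GL₂ : ∀ {a} → Pred Carrier a → Pred Mat (c ⊔ ℓ ⊔ a)
  GL₂ P M = EntriesIn P M ×
            ∃[ N ] EntriesIn P N × M ∙ N ≈ₘ I × N ∙ M ≈ₘ I

  ≈ₘ-refl : ∀ {M} → M ≈ₘ M
  ≈ₘ-refl = mat≈ refl refl refl refl

  ≈ₘ-sym : ∀ {M N} → M ≈ₘ N → N ≈ₘ M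
  ≈ₘ-sym (mat≈ p q r s) = mat≈ (sym p) (sym q) (sym r) (sym s)

  ≈ₘ-trans : ∀ {M N P} → M ≈ₘ N → N ≈ₘ P → M ≈ₘ P
  ≈ₘ-trans (mat≈ p q r s) (mat≈ p′ q′ r′ s′) =
    mat≈ (trans p p′) (trans q q′) (trans r r′) (trans s s′)

  ∙-cong : ∀ {M M′ N N′} → M ≈ₘ M′ → N ≈ₘ N′ → M ∙ N ≈ₘ M′ ∙ N′
  ∙-cong (mat≈ p q r s) (mat≈ p′ q′ r′ s′) =
    mat≈ (+-cong (*-cong p p′) (*-cong q r′))
         (+-cong (*-cong p q′) (*-cong q s′))
         (+-cong (*-cong r p′) (*-cong s r′))
         (+-cong (*-cong r q′) (*-cong s s′))

  •-cong : ∀ {k l M N} → k ≈ l → M ≈ₘ N → k • M ≈ₘ l • N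
  •-cong e (mat≈ p q r s) =
    mat≈ (*-cong e p) (*-cong e q) (*-cong e r) (*-cong e s)

  private
    open SemiringSolver commutativeSemiring using (solve; _:=_; _:+_; _:*_)

    assoc-entry : ∀ a b a′ b′ c′ d′ a″ c″ →
      (a * a′ + b * c′) * a″ + (a * b′ + b * d′) * c″ ≈
      a * (a′ * a″ + b′ * c″) + b * (c′ * a″ + d′ * c″)
    assoc-entry = solve 8 (λ a b a′ b′ c′ d′ a″ c″ →
      (a :* a′ :+ b :* c′) :* a″ :+ (a :* b′ :+ b :* d′) :* c″ :=
      a :* (a′ :* a″ :+ b′ :* c″) :+ b :* (c′ :* a″ :+ d′ :* c″)) refl

    scalar-entry : ∀ a b k x y →
      a * (k * x) + b * (k * y) ≈ k * (a * x + b * y)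
    scalar-entry = solve 5 (λ a b k x y →
      a :* (k :* x) :+ b :* (k :* y) := k :* (a :* x :+ b :* y)) refl

    1x+0y : ∀ x y → 1# * x + 0# * y ≈ x
    1x+0y x y =
      trans (+-cong (*-identityˡ x) (zeroˡ y)) (+-identityʳ x)

    0x+1y : ∀ x y → 0# * x + 1# * y ≈ y
    0x+1y x y =
      trans (+-cong (zeroˡ x) (*-identityˡ y)) (+-identityˡ y)

  ∙-assoc : ∀ M N P → (M ∙ N) ∙ P ≈ₘ M ∙ (N ∙ P)
  ∙-assoc (mat a b c d) (mat a′ b′ c′ d′) (mat a″ b″ c″ d″) =
    mat≈ (assoc-entry a b a′ b′ c′ d′ a″ c″)
         (assoc-entry a b a′ b′ c′ d′ b″ d″)
         (assoc-entry c d a′ b′ c′ d′ a″ c″)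
         (assoc-entry c d a′ b′ c′ d′ b″ d″)

  ∙-identityˡ : ∀ M → I ∙ M ≈ₘ M
  ∙-identityˡ (mat a b c d) =
    mat≈ (1x+0y a c) (1x+0y b d) (0x+1y a c) (0x+1y b d)

  ∙-•-comm : ∀ M k N → M ∙ (k • N) ≈ₘ k • (M ∙ N)
  ∙-•-comm (mat a b c d) k (mat x y z w) =
    mat≈ (scalar-entry a b k x z) (scalar-entry a b k y w)
         (scalar-entry c d k x z) (scalar-entry c d k y w)

  •-assoc : ∀ k l M → (k * l) • M ≈ₘ k • (l • M)
  •-assoc k l (mat a b c d) =
    mat≈ (*-assoc k l a) (*-assoc k l b) (*-assoc k l c) (*-assoc k l d)

  •-identity : ∀ M → 1# • M ≈ₘ M
  •-identity (mat a b c d) =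
    mat≈ (*-identityˡ a) (*-identityˡ b) (*-identityˡ c) (*-identityˡ d)

  inner-cancel : ∀ {A B C D} → B ∙ C ≈ₘ I → A ∙ D ≈ₘ I →
                 (A ∙ B) ∙ (C ∙ D) ≈ₘ I
  inner-cancel {A} {B} {C} {D} BC AD =
    ≈ₘ-trans (∙-assoc A B (C ∙ D))
    (≈ₘ-trans (∙-cong ≈ₘ-refl (≈ₘ-sym (∙-assoc B C D)))
    (≈ₘ-trans (∙-cong ≈ₘ-refl (∙-cong BC ≈ₘ-refl))
    (≈ₘ-trans (∙-cong ≈ₘ-refl (∙-identityˡ D)) AD)))

module Curve {k ℓ} (𝒞 : SuperellipticCurve k ℓ) where
  open SuperellipticCurve 𝒞 public
  open CompleteDVR dvr public
  open Polynomial K public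
  open Matrix K public
  open AlgebraicClosure closure public using (ι; D)

  ℙ¹ : Set k
  ℙ¹ = Pointed Carrier

  open AddPointEquality _≈_ public using ([_]; ∙≈∙) renaming (_≈∙_ to _≈ℙ_)

  infix 4 _≉ℙ_
  _≉ℙ_ : Rel ℙ¹ (k ⊔ ℓ)
  P ≉ℙ Q = ¬ P ≈ℙ Q

  ℛ : Pred Carrier ℓ
  ℛ z = eval f z ≈ 0#

  S : Pred ℙ¹ ℓ
  S [ z ] = z ∈ ℛ
  S ∞     = Level.Lift ℓ (n ∤ deg-f)

  -- v(P - Q), with the convention that it is -∞ as soon as ∞ is involved.
  v⟨_-_⟩ : ℙ¹ → ℙ¹ → ℤ ±
  v⟨ [ x ] - [ y ] ⟩ = Maybe.map [_] (v (x - y))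
  v⟨ _     - _     ⟩ = ⊥±

  record Triple : Set (k ⊔ ℓ) where
    field
      a b c       : ℙ¹
      a∈S         : a ∈ S
      b∈S         : b ∈ S
      c∈S         : c ∈ S
      a≉b         : a ≉ℙ b
      b≉c         : b ≉ℙ c
      a≉c         : a ≉ℙ c

  -- The matrix of x ↦ (b - c)(x - a) / (b - a)(x - c), and of its limits
  -- when one point is ∞.  The last clause is never used by a triple.
  möbius : ℙ¹ → ℙ¹ → ℙ¹ → Mat
  möbius [ a ] [ b ] [ c ] = mat (b - c) (- ((b - c) * a))
                                 (b - a) (- ((b - a) * c))
  möbius ∞     [ b ] [ c ] = mat 0# (b - c) 1# (- c)
  möbius [ a ] ∞     [ c ] = mat 1# (- a)   1# (- c)
  möbius [ a ] [ b ] ∞     = mat 1# (- a)   0# (b - a)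
  möbius _     _     _     = I

  φ : Triple → Mat
  φ t = möbius a b c where open Triple t

  infix 4 _∼_

  -- φ_{t₂} ∘ φ_{t₁}⁻¹ is the class of some A ∈ GL₂(𝒪): since matrices act
  -- up to a nonzero scalar, A ∘ φ_{t₁} = φ_{t₂} reads A φ(t₁) = k φ(t₂).
  _∼_ : Rel Triple (k ⊔ ℓ)
  t₁ ∼ t₂ = ∃[ A ] A ∈ GL₂ 𝒪 × ∃[ k ] k ≉ 0# × A ∙ φ t₁ ≈ₘ k • φ t₂

  private
    0≤⊤ : ∀ {u} → u ≡ ⊤⁺ → [ 0ℤ ] ≤ℤ⁺ u
    0≤⊤ ≡.refl = _ ≤⊤⁺

    0∈𝒪 : 0# ∈ 𝒪
    0∈𝒪 = 0≤⊤ (Equivalence.from (v-∞ 0#) refl)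

    1∈𝒪 : 1# ∈ 𝒪
    1∈𝒪 with v 1# in v1 | v-* 1# 1#
    ... | ∞     | _  = _ ≤⊤⁺
    ... | [ i ] | v11 = [ ℤ.≤-reflexive (≡.sym i≡0) ]
      where
      i≡i+i : i ≡ i ℤ.+ i
      i≡i+i = []-injective
        (≡.trans (≡.sym v1) (≡.trans (v-cong (sym (*-identityˡ 1#))) v11))

      open GroupProperties (AbelianGroup.group ℤ.+-0-abelianGroup)
        using (identityʳ-unique)

      i≡0 : i ≡ 0ℤ
      i≡0 = identityʳ-unique i i (≡.sym i≡i+i)

    𝒪-* : ∀ {x y} → x ∈ 𝒪 → y ∈ 𝒪 → x * y ∈ 𝒪
    𝒪-* {x} {y} x∈𝒪 y∈𝒪 =
      ≡.subst ([ 0ℤ ] ≤ℤ⁺_) (≡.sym (v-* x y)) (add x∈𝒪 y∈𝒪)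
      where
      add : ∀ {u w} → [ 0ℤ ] ≤ℤ⁺ u → [ 0ℤ ] ≤ℤ⁺ w →
            [ 0ℤ ] ≤ℤ⁺ add⁺ ℤ._+_ u w
      add [ p ]     [ q ]     = [ ℤ.+-mono-≤ p q ]
      add [ p ]     (_ ≤⊤⁺)   = _ ≤⊤⁺
      add (_ ≤⊤⁺)   _         = _ ≤⊤⁺

    𝒪-+ : ∀ {x y} → x ∈ 𝒪 → y ∈ 𝒪 → x + y ∈ 𝒪
    𝒪-+ = v-+ _ _ _

    𝒪-I : EntriesIn 𝒪 I
    𝒪-I = 1∈𝒪 , 0∈𝒪 , 0∈𝒪 , 1∈𝒪

    𝒪-∙ : ∀ {M N} → EntriesIn 𝒪 M → EntriesIn 𝒪 N → EntriesIn 𝒪 (M ∙ N)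
    𝒪-∙ (a , b , c , d) (a′ , b′ , c′ , d′) =
      𝒪-+ (𝒪-* a a′) (𝒪-* b c′) , 𝒪-+ (𝒪-* a b′) (𝒪-* b d′) ,
      𝒪-+ (𝒪-* c a′) (𝒪-* d c′) , 𝒪-+ (𝒪-* c b′) (𝒪-* d d′)

    factorʳ≉0 : ∀ {k l} → k * l ≈ 1# → l ≉ 0#
    factorʳ≉0 {k} kl≈1 l≈0 =
      1≉0 (trans (sym kl≈1) (trans (*-congˡ l≈0) (zeroʳ k)))

    *-≉0 : ∀ {k l} → k ≉ 0# → l ≉ 0# → k * l ≉ 0#
    *-≉0 {k} {l} k≉0 l≉0 kl≈0 with inverse k k≉0
    ... | k⁻¹ , kk⁻¹ = l≉0 (trans (sym (*-identityˡ l))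
      (trans (*-congʳ (trans (sym kk⁻¹) (*-comm k k⁻¹)))
      (trans (*-assoc k⁻¹ k l) (trans (*-congˡ kl≈0) (zeroʳ k⁻¹)))))

  ∼-refl : ∀ {t} → t ∼ t
  ∼-refl {t} =
    I , (𝒪-I , I , 𝒪-I , ∙-identityˡ I , ∙-identityˡ I) ,
    1# , 1≉0 , ≈ₘ-trans (∙-identityˡ (φ t)) (≈ₘ-sym (•-identity (φ t)))

  ∼-sym : ∀ {t₁ t₂} → t₁ ∼ t₂ → t₂ ∼ t₁
  ∼-sym {t₁} {t₂} (A , (A∈𝒪 , B , B∈𝒪 , AB , BA) , k , k≉0 , eq)
    with inverse k k≉0
  ... | l , kl≈1 =
    B , (B∈𝒪 , A , A∈𝒪 , BA , AB) , l , factorʳ≉0 kl≈1 , B∙φ₂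
    where
    lk≈1 : l * k ≈ 1#
    lk≈1 = trans (*-comm l k) kl≈1

    φ₂ : φ t₂ ≈ₘ l • (A ∙ φ t₁)
    φ₂ = ≈ₘ-trans (≈ₘ-sym (•-identity (φ t₂)))
        (≈ₘ-trans (•-cong (sym lk≈1) ≈ₘ-refl)
        (≈ₘ-trans (•-assoc l k (φ t₂))
                  (•-cong refl (≈ₘ-sym eq))))

    B∙φ₂ : B ∙ φ t₂ ≈ₘ l • φ t₁
    B∙φ₂ = ≈ₘ-trans (∙-cong ≈ₘ-refl φ₂)
          (≈ₘ-trans (∙-•-comm B l (A ∙ φ t₁))
          (•-cong refl
            (≈ₘ-trans (≈ₘ-sym (∙-assoc B A (φ t₁)))
            (≈ₘ-trans (∙-cong BA ≈ₘ-refl) (∙-identityˡ (φ t₁))))))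

  ∼-trans : ∀ {t₁ t₂ t₃} → t₁ ∼ t₂ → t₂ ∼ t₃ → t₁ ∼ t₃
  ∼-trans {t₁} {t₂} {t₃}
    (A , (A∈𝒪 , B , B∈𝒪 , AB , BA) , k , k≉0 , eq)
    (A′ , (A′∈𝒪 , B′ , B′∈𝒪 , AB′ , BA′) , k′ , k′≉0 , eq′) =
    A′ ∙ A ,
    (𝒪-∙ A′∈𝒪 A∈𝒪 , B ∙ B′ , 𝒪-∙ B∈𝒪 B′∈𝒪 ,
     inner-cancel AB AB′ , inner-cancel BA′ BA) ,
    k * k′ , *-≉0 k≉0 k′≉0 ,
    ≈ₘ-trans (∙-assoc A′ A (φ t₁))
    (≈ₘ-trans (∙-cong ≈ₘ-refl eq)
    (≈ₘ-trans (∙-•-comm A′ k (φ t₂))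
    (≈ₘ-trans (•-cong refl eq′)
              (≈ₘ-sym (•-assoc k k′ (φ t₃))))))

  T/∼ : Setoid (k ⊔ ℓ) (k ⊔ ℓ)
  T/∼ = record
    { Carrier       = Triple
    ; _≈_           = _∼_
    ; isEquivalence = record
      { refl  = λ {t} → ∼-refl {t}
      ; sym   = λ {t₁} {t₂} → ∼-sym {t₁} {t₂}
      ; trans = λ {t₁} {t₂} {t₃} → ∼-trans {t₁} {t₂} {t₃}
      }
    }

  Ordered : Pred Triple Level.zero
  Ordered t = v⟨ a - c ⟩ ≡ v⟨ b - c ⟩ × v⟨ b - c ⟩ ≤ℤ± v⟨ a - b ⟩
    where open Triple t

  private
    v≢-∞ : ∀ (u : ℤ ⁺) → Maybe.map [_] u ≢ ⊥±
    v≢-∞ ∞     ()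
    v≢-∞ [ _ ] ()

    finite-difference : ∀ {x y} → ¬ x ≈ y → ∃[ μ ] v (x - y) ≡ [ μ ]
    finite-difference {x} {y} x≉y with v (x - y) in eq
    ... | [ μ ] = μ , ≡.refl
    ... | ∞     = ⊥-elim (x≉y
          (trans (sym (+-identityʳ x)) (trans (+-congˡ (sym (-‿inverseˡ y)))
          (trans (sym (+-assoc x (- y) y))
          (trans (+-congʳ (Equivalence.to (v-∞ (x - y)) eq))
                 (+-identityˡ y))))))

    finite-pair : ∀ P Q R → P ≉ℙ Q → Q ≉ℙ R → P ≉ℙ R →
                  v⟨ P - R ⟩ ≡ v⟨ Q - R ⟩ →
                  ∃[ x ] ∃[ μ ] P ≡ [ x ] × v⟨ P - Q ⟩ ≡ [ [ μ ] ]
    finite-pair [ x ] [ y ] R     p≉q _ _ _ with finite-difference (λ e → p≉q [ e ])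
    ... | μ , eq = x , μ , ≡.refl , ≡.cong (Maybe.map [_]) eq
    finite-pair ∞     ∞     R     p≉q _ _ _ = ⊥-elim (p≉q ∙≈∙)
    finite-pair ∞     [ y ] ∞     _ _ p≉r _ = ⊥-elim (p≉r ∙≈∙)
    finite-pair ∞     [ y ] [ z ] _ _ _ e =
      ⊥-elim (v≢-∞ (v (y - z)) (≡.sym e))
    finite-pair [ x ] ∞     ∞     _ q≉r _ _ = ⊥-elim (q≉r ∙≈∙)
    finite-pair [ x ] ∞     [ z ] _ _ _ e = ⊥-elim (v≢-∞ (v (x - z)) e)

  -- In an ordered triple a and v(a - b) are finite.
  ordered-finite : ∀ t → Ordered t → ∃[ x ] ∃[ μ ]
    Triple.a t ≡ [ x ] × v⟨ Triple.a t - Triple.b t ⟩ ≡ [ [ μ ] ]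
  ordered-finite t (e , _) = finite-pair a b c a≉b b≉c a≉c e
    where open Triple t

  centre : ∀ t → Ordered t → Carrier
  centre t o = proj₁ (ordered-finite t o)

  radius : ∀ t → Ordered t → ℤ
  radius t o = proj₁ (proj₂ (ordered-finite t o))

  -- Subsets of ℛ are predicates on K; all those below are contained in ℛ.
  Subset : Set (k ⊔ Level.suc ℓ)
  Subset = Pred Carrier ℓ

  IsCluster : Pred Subset (k ⊔ ℓ)
  IsCluster U =
    Satisfiable U × ∃[ z ] ∃[ d ] U ≐ ((ι ⊢ D z d) ∩ ℛ)

  IsProper : Pred Subset (k ⊔ ℓ)
  IsProper U = ∃[ x ] ∃[ y ] x ∈ U × y ∈ U × x ≉ y

  record ProperCluster : Set (k ⊔ Level.suc ℓ) where
    field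
      subset    : Subset
      isCluster : IsCluster subset
      isProper  : IsProper subset
  open ProperCluster public using (subset)

  Clusters : Setoid (k ⊔ Level.suc ℓ) (k ⊔ ℓ)
  Clusters = record
    { Carrier       = ProperCluster
    ; _≈_           = λ s t → subset s ≐ subset t
    ; isEquivalence = record
      { refl = ≐-refl ; sym = ≐-sym ; trans = ≐-trans }
    }

  Φ₀ : ∀ t → Ordered t → Subset
  Φ₀ t o = (ι ⊢ D (ι (centre t o)) (radius t o / 1)) ∩ ℛ

  IsDiameter : Subset → ℤ → Set (k ⊔ ℓ)
  IsDiameter U μ =
    (∃[ z ] ∃[ t ] z ∈ U × t ∈ U × v (z - t) ≡ [ μ ]) ×
    (∀ z t → z ∈ U → t ∈ U → [ μ ] ≤ℤ⁺ v (z - t))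

  EquidistantTriple : Set (k ⊔ ℓ)
  EquidistantTriple = ∃[ μ ] ∃[ a ] ∃[ b ] ∃[ c ]
    IsDiameter ℛ μ × a ∈ ℛ × b ∈ ℛ × c ∈ ℛ ×
    a ≉ b × b ≉ c × a ≉ c ×
    v (a - b) ≡ [ μ ] × v (b - c) ≡ [ μ ] × v (a - c) ≡ [ μ ]

  IsChildOf : Subset → Subset → Set (k ⊔ Level.suc ℓ)
  IsChildOf U V = IsCluster U × U ⊂ V ×
    (∀ W → IsCluster W → U ⊆ W → W ⊂ V → W ⊆ U)

  MoreThanTwoChildren : Subset → Set (k ⊔ Level.suc ℓ)
  MoreThanTwoChildren V = ∃[ U₁ ] ∃[ U₂ ] ∃[ U₃ ]
    IsChildOf U₁ V × IsChildOf U₂ V × IsChildOf U₃ V ×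
    ¬ U₁ ≐ U₂ × ¬ U₂ ≐ U₃ × ¬ U₁ ≐ U₃

{-# OPTIONS --safe #-}

-- Rotating a triple changes φ by the element x ↦ (x - 1)/x of PGL₂(𝒪), and
-- a rotation puts the closest pair first, by the ultrametric inequality.
-- For an ordered triple (a, b, c), φ agrees up to PGL₂(𝒪) with the affine
-- map x ↦ (x - a)/(b - a), so its class is the disc D(a, v(a - b)), which is
-- determined by its intersection with ℛ because that contains a and b.
-- Conversely a proper cluster is D(x, v(x - b)) ∩ ℛ with b in it farthest
-- from x, and any root outside it, or ∞, completes an ordered triple.
--
-- Positivity of the genus is needed only to find two roots when ∞ ∈ S.
-- Otherwise the curve is yⁿ = a + x, and H¹(𝒪) = 0: a function integral over
-- C[x,x⁻¹] is regular in y up to a power of x, hence of the form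
-- Σ pⱼ(x,x⁻¹) yʲ with j < n, where xⁱ yʲ is integral over C[x] for i ≥ 0 and
-- over C[x⁻¹] for i < 0.

module Submission where

open import Defs
open import Algebra.Bundles using (RawRing)
import Algebra.Morphism.Construct.Identity as Identity
open import Algebra.Morphism.Structures using (module RingMorphisms)
import Algebra.Properties.AbelianGroup as AbelianGroupProperties
import Algebra.Properties.CommutativeMonoid.Sum as Sum
import Algebra.Properties.Ring as RingProperties
import Algebra.Properties.Semiring.Exp as SemiringExp
import Algebra.Properties.Semiring.Mult.TCOptimised as SemiringMult
import Algebra.Properties.Semiring.Sum as SemiringSum
import Algebra.Solver.Ring as RingSolver
open import Algebra.Solver.Ring.AlmostCommutativeRing
  using (fromCommutativeRing; _-Raw-AlmostCommutative⟶_)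
open import Data.Empty using (⊥-elim)
open import Data.Fin.Base as Fin using (Fin; toℕ; fromℕ; fromℕ<; inject₁; punchIn)
open import Data.Fin.Patterns using (0F; 1F)
import Data.Fin.Properties as Fin
open import Data.Integer.Base as ℤ using (ℤ; +_; -[1+_]; _⊖_; 0ℤ; 1ℤ)
import Data.Integer.Properties as ℤ
open import Data.List.Base using (List; []; _∷_; map; foldr; length; filter)
import Data.List.Extrema as Extrema
open import Data.List.Membership.Propositional using (find; lose)
open import Data.List.Membership.Propositional.Properties using (∈-filter⁺)
import Data.List.Properties as List
open import Data.List.Relation.Binary.Pointwise as Pointwise using (Pointwise; []; _∷_)
open import Data.List.Relation.Unary.All as All using (All; []; _∷_)
open import Data.List.Relation.Unary.All.Properties using (all-filter)
open import Data.List.Relation.Unary.Any as Any using (Any; here; there)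
import Data.Maybe.Base as Maybe
open import Data.Nat.Base as ℕ using (ℕ; zero; suc)
import Data.Nat.Coprimality as Coprime
open import Data.Nat.Divisibility using (_∣_; _∤_; _∣0)
import Data.Nat.Properties as ℕ
open import Data.Product using (_×_; _,_; ∃; ∃-syntax; proj₁; proj₂)
open import Data.Rational.Base as ℚ using (ℚ; mkℚ; _/_; *≤*)
import Data.Rational.Properties as ℚ
open import Data.Sum.Base using (_⊎_; inj₁; inj₂; [_,_]′)
open import Function.Base using (_∘_)
open import Function.Bundles using (Func; _⇔_; mk⇔; Equivalence)
open import Function.Definitions using (Injective)
open import Level using (_⊔_)
open import Relation.Binary.Bundles using (Setoid; TotalOrder)
import Relation.Binary.Construct.Add.Extrema.NonStrict as AddExtrema
import Relation.Binary.Construct.Add.Point.Equality as AddPointEquality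
import Relation.Binary.Construct.Add.Supremum.NonStrict as AddSupremum
open import Relation.Binary.PropositionalEquality.Core as ≡ using (_≡_; _≢_)
import Relation.Binary.Reasoning.Setoid as SetoidReasoning
open import Relation.Nullary.Construct.Add.Extrema using (_±; ⊥±)
open import Relation.Nullary.Construct.Add.Point using ([_]; []-injective)
  renaming (∙ to ∞)
open import Relation.Nullary.Construct.Add.Supremum using (_⁺; ⊤⁺)
open import Relation.Nullary.Decidable as Dec using (Dec; yes; no)
open import Relation.Nullary.Negation.Core using (¬_; contradiction)
open import Relation.Unary
  using (Pred; _∈_; _∉_; _⊆_; _⊂_; _∩_; _⊢_; _≐_; Decidable)
open import Relation.Unary.Properties using (≐-refl)

-- The genus enters as the dimension of a Čech quotient, so genus zero must be shown by splitting
-- every cocycle explicitly. On the line with coordinate `y`, the function `x` equals `y ^ n - a`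
-- and has a pole of order `n` at infinity; hence `x⁻¹ ^ i * y ^ j` with `i > 0` and `j < n` is
-- regular there, and nothing remains in the quotient. The finite poles of a cocycle lie over zeros
-- of `x`, since at any other point the integral equation would force a nonzero value to vanish.
--
-- Clusters are cut out by discs with centres in the closure and rational radii, whereas triples
-- consist of roots and have integral radii. The bridge is that every point of an ultrametric disc
-- is a centre: a nonempty cluster is recentred at one of its roots, after which only `v` is
-- involved. Since the values of `v` are data, equality in `K` and membership in a cluster are
-- decidable, and the finite list of roots can be searched for a root outside a cluster or farthest
-- from a given one.

-- Field arithmetic and a ring solver with integer coefficients.

module FieldProperties {c ℓ} (F : Field c ℓ) where
  open Field F
  open RingProperties ring
    using (-‿distribˡ-*; -‿distribʳ-*; -‿involutive; -0#≈0#; x∙y⁻¹≈ε⇒x≈y; x≈y⇒x∙y⁻¹≈ε)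
  open AbelianGroupProperties +-abelianGroup using (⁻¹-∙-comm)
  open SemiringMult semiring
    using (×-homo-+; ×1-homo-*; 1+×) renaming (_×_ to _×′_)
  open SetoidReasoning setoid

  private
    -- Integer coefficients have decidable equality, so the solver can cancel terms although
    -- equality in `F` is not assumed decidable. With the optimised multiple, `fromℤ 1ℤ` reduces to
    -- `1#`, so `con 1ℤ` stands for the literal `1#`.
    fromℤ : ℤ → Carrier
    fromℤ (+ n)    = n ×′ 1#
    fromℤ -[1+ n ] = - (suc n ×′ 1#)

    fromℤ-neg : ∀ i → fromℤ (ℤ.- i) ≈ - fromℤ i
    fromℤ-neg (+ zero)   = sym -0#≈0#
    fromℤ-neg (+ suc n)  = refl
    fromℤ-neg (-[1+ n ]) = sym (-‿involutive _)

    cancel-1 : ∀ x y → x - y ≈ (1# + x) - (1# + y)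
    cancel-1 x y = begin
      x - y                      ≈⟨ +-identityˡ _ ⟨
      0# + (x - y)               ≈⟨ +-congʳ (-‿inverseʳ 1#) ⟨
      (1# - 1#) + (x - y)        ≈⟨ +-assoc _ _ _ ⟩
      1# + (- 1# + (x - y))      ≈⟨ +-congˡ (+-assoc _ _ _) ⟨
      1# + ((- 1# + x) - y)      ≈⟨ +-congˡ (+-congʳ (+-comm _ _)) ⟩
      1# + ((x - 1#) - y)        ≈⟨ +-congˡ (+-assoc _ _ _) ⟩
      1# + (x + (- 1# - y))      ≈⟨ +-assoc _ _ _ ⟨
      (1# + x) + (- 1# - y)      ≈⟨ +-congˡ (⁻¹-∙-comm 1# y) ⟩
      (1# + x) - (1# + y)        ∎

    fromℤ-⊖ : ∀ m n → fromℤ (m ⊖ n) ≈ m ×′ 1# - n ×′ 1#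
    fromℤ-⊖ m zero = begin
      m ×′ 1#       ≈⟨ +-identityʳ _ ⟨
      m ×′ 1# + 0#  ≈⟨ +-congˡ -0#≈0# ⟨
      m ×′ 1# - 0#  ∎
    fromℤ-⊖ zero    (suc n) = sym (+-identityˡ _)
    fromℤ-⊖ (suc m) (suc n) = begin
      fromℤ (suc m ⊖ suc n)              ≡⟨ ≡.cong fromℤ (ℤ.[1+m]⊖[1+n]≡m⊖n m n) ⟩
      fromℤ (m ⊖ n)                      ≈⟨ fromℤ-⊖ m n ⟩
      m ×′ 1# - n ×′ 1#                  ≈⟨ cancel-1 _ _ ⟩
      (1# + m ×′ 1#) - (1# + n ×′ 1#)    ≈⟨ +-cong (1+× m 1#) (-‿cong (1+× n 1#)) ⟨
      suc m ×′ 1# - suc n ×′ 1#          ∎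

    fromℤ-+ : ∀ i j → fromℤ (i ℤ.+ j) ≈ fromℤ i + fromℤ j
    fromℤ-+ (+ m)    (+ n)    = ×-homo-+ 1# m n
    fromℤ-+ (+ m)    -[1+ n ] = fromℤ-⊖ m (suc n)
    fromℤ-+ -[1+ m ] (+ n)    = trans (fromℤ-⊖ n (suc m)) (+-comm _ _)
    fromℤ-+ -[1+ m ] -[1+ n ] = begin
      - (suc (suc (m ℕ.+ n)) ×′ 1#)    ≡⟨ ≡.cong (λ k → - (suc k ×′ 1#)) (ℕ.+-suc m n) ⟨
      - ((suc m ℕ.+ suc n) ×′ 1#)      ≈⟨ -‿cong (×-homo-+ 1# (suc m) (suc n)) ⟩
      - (suc m ×′ 1# + suc n ×′ 1#)    ≈⟨ ⁻¹-∙-comm _ _ ⟨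
      - (suc m ×′ 1#) - suc n ×′ 1#    ∎

    fromℤ-pos-* : ∀ m n → fromℤ (+ m ℤ.* + n) ≈ fromℤ (+ m) * fromℤ (+ n)
    fromℤ-pos-* m n = trans
      (reflexive (≡.cong fromℤ (≡.sym (ℤ.pos-* m n)))) (×1-homo-* m n)

    fromℤ-* : ∀ i j → fromℤ (i ℤ.* j) ≈ fromℤ i * fromℤ j
    fromℤ-* (+ m)    (+ n)    = fromℤ-pos-* m n
    fromℤ-* (+ m)    -[1+ n ] = begin
      fromℤ (+ m ℤ.* -[1+ n ])             ≡⟨ ≡.cong fromℤ (ℤ.neg-distribʳ-* (+ m) (+ suc n)) ⟨
      fromℤ (ℤ.- (+ m ℤ.* + suc n))        ≈⟨ fromℤ-neg (+ m ℤ.* + suc n) ⟩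
      - fromℤ (+ m ℤ.* + suc n)            ≈⟨ -‿cong (fromℤ-pos-* m (suc n)) ⟩
      - (fromℤ (+ m) * fromℤ (+ suc n))    ≈⟨ -‿distribʳ-* _ _ ⟩
      fromℤ (+ m) * - fromℤ (+ suc n)      ∎
    fromℤ-* -[1+ m ] (+ n)    = begin
      fromℤ (-[1+ m ] ℤ.* + n)             ≡⟨ ≡.cong fromℤ (ℤ.neg-distribˡ-* (+ suc m) (+ n)) ⟨
      fromℤ (ℤ.- (+ suc m ℤ.* + n))        ≈⟨ fromℤ-neg (+ suc m ℤ.* + n) ⟩
      - fromℤ (+ suc m ℤ.* + n)            ≈⟨ -‿cong (fromℤ-pos-* (suc m) n) ⟩
      - (fromℤ (+ suc m) * fromℤ (+ n))    ≈⟨ -‿distribˡ-* _ _ ⟩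
      - fromℤ (+ suc m) * fromℤ (+ n)      ∎
    fromℤ-* -[1+ m ] -[1+ n ] = begin
      fromℤ (+ suc m ℤ.* + suc n)              ≈⟨ fromℤ-pos-* (suc m) (suc n) ⟩
      fromℤ (+ suc m) * fromℤ (+ suc n)        ≈⟨ -‿involutive _ ⟨
      - - (fromℤ (+ suc m) * fromℤ (+ suc n))  ≈⟨ -‿cong (-‿distribʳ-* _ _) ⟩
      - (fromℤ (+ suc m) * - fromℤ (+ suc n))  ≈⟨ -‿distribˡ-* _ _ ⟩
      - fromℤ (+ suc m) * - fromℤ (+ suc n)    ∎

    ℤ-rawRing : RawRing _ _
    ℤ-rawRing = record
      { _≈_ = _≡_ ; _+_ = ℤ._+_ ; _*_ = ℤ._*_ ; -_ = ℤ.-_ ; 0# = 0ℤ ; 1# = 1ℤ }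

    ℤ⟶F : ℤ-rawRing -Raw-AlmostCommutative⟶ fromCommutativeRing commutativeRing
    ℤ⟶F = record
      { ⟦_⟧ = fromℤ ; +-homo = fromℤ-+ ; *-homo = fromℤ-* ; -‿homo = fromℤ-neg
      ; 0-homo = refl ; 1-homo = refl }

  open RingSolver ℤ-rawRing (fromCommutativeRing commutativeRing) ℤ⟶F
    (λ i j → Maybe.map (λ e → reflexive (≡.cong fromℤ e))
               (Dec.dec⇒maybe (i ℤ.≟ j)))
    using (solve; _:=_; _:+_; _:*_; _:-_; :-_; con) public

  x-y≈0⇒x≈y : ∀ {x y} → x - y ≈ 0# → x ≈ y
  x-y≈0⇒x≈y = x∙y⁻¹≈ε⇒x≈y _ _

  x≈y⇒x-y≈0 : ∀ {x y} → x ≈ y → x - y ≈ 0#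
  x≈y⇒x-y≈0 = x≈y⇒x∙y⁻¹≈ε

  *-cancelˡ-≉0 : ∀ {z x y} → z ≉ 0# → z * x ≈ z * y → x ≈ y
  *-cancelˡ-≉0 {z} {x} {y} z≉0 zx≈zy with inverse z z≉0
  ... | w , zw≈1 = begin
    x            ≈⟨ *-identityˡ x ⟨
    1# * x       ≈⟨ *-congʳ zw≈1 ⟨
    z * w * x    ≈⟨ *-congʳ (*-comm z w) ⟩
    w * z * x    ≈⟨ *-assoc w z x ⟩
    w * (z * x)  ≈⟨ *-congˡ zx≈zy ⟩
    w * (z * y)  ≈⟨ *-assoc w z y ⟨
    w * z * y    ≈⟨ *-congʳ (*-comm z w) ⟨
    z * w * y    ≈⟨ *-congʳ zw≈1 ⟩
    1# * y       ≈⟨ *-identityˡ y ⟩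
    y            ∎

  xy≈0∧x≉0⇒y≈0 : ∀ {x y} → x * y ≈ 0# → x ≉ 0# → y ≈ 0#
  xy≈0∧x≉0⇒y≈0 {x} xy≈0 x≉0 =
    *-cancelˡ-≉0 x≉0 (trans xy≈0 (sym (zeroʳ x)))

  *-≉0 : ∀ {x y} → x ≉ 0# → y ≉ 0# → x * y ≉ 0#
  *-≉0 x≉0 y≉0 xy≈0 = y≉0 (xy≈0∧x≉0⇒y≈0 xy≈0 x≉0)

  ^-≉0 : ∀ {x} → x ≉ 0# → ∀ n → x ^ n ≉ 0#
  ^-≉0 x≉0 zero    = 1≉0
  ^-≉0 x≉0 (suc n) = *-≉0 x≉0 (^-≉0 x≉0 n)

  factorˡ≉0 : ∀ {x y} → x * y ≈ 1# → x ≉ 0#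
  factorˡ≉0 {x} {y} xy≈1 x≈0 =
    1≉0 (trans (sym xy≈1) (trans (*-congʳ x≈0) (zeroˡ y)))

record IsSubring {c ℓ} (F : Field c ℓ) {a} (A : Pred (Field.Carrier F) a) :
                 Set (c ⊔ ℓ ⊔ a) where
  open Field F
  field
    resp : ∀ {x y} → x ≈ y → x ∈ A → y ∈ A
    0∈   : 0# ∈ A
    1∈   : 1# ∈ A
    +∈   : ∀ {x y} → x ∈ A → y ∈ A → x + y ∈ A
    *∈   : ∀ {x y} → x ∈ A → y ∈ A → x * y ∈ A
    -∈   : ∀ {x} → x ∈ A → - x ∈ A

  ^∈ : ∀ {x} → x ∈ A → ∀ n → x ^ n ∈ A
  ^∈ x∈ zero    = 1∈
  ^∈ x∈ (suc n) = *∈ x∈ (^∈ x∈ n)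

  sum∈ : ∀ {n} {x : Fin n → Carrier} → (∀ i → x i ∈ A) → sum x ∈ A
  sum∈ {zero}  x∈ = 0∈
  sum∈ {suc n} x∈ = +∈ (x∈ Fin.zero) (sum∈ (λ i → x∈ (Fin.suc i)))

-- Makes evaluation of a polynomial in its own coefficient field a case of `_at_`; the leftover
-- `map` of the identity is removed with `List.map-id`.
idHom : ∀ {c ℓ} (F : Field c ℓ) → FieldHom F F
idHom F = record
  { ⟦_⟧ = λ x → x ; isRingHomomorphism = Identity.isRingHomomorphism F.rawRing F.refl }
  where module F = Field F

-- Evaluation of polynomials along a field homomorphism.

module Evaluation {c ℓ} {E F : Field c ℓ} (h : FieldHom E F) where
  private module E where
    open Field E public
    open Polynomial E public
  open Field F
  open FieldProperties F
  open Polynomial F using (eval)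
  open FieldHom h
  open RingMorphisms.IsRingHomomorphism isRingHomomorphism public
    using (⟦⟧-cong; +-homo; *-homo; -‿homo; 0#-homo; 1#-homo)
  open SetoidReasoning setoid

  infix 9 _at_
  _at_ : E.Poly → Carrier → Carrier
  p at z = eval (map ⟦_⟧ p) z

  at-cong : ∀ p {z w} → z ≈ w → p at z ≈ p at w
  at-cong []      e = refl
  at-cong (a ∷ p) e = +-congˡ (*-cong e (at-cong p e))

  at-Pointwise : ∀ {p q} → Pointwise E._≈_ p q → ∀ z → p at z ≈ q at z
  at-Pointwise []       z = refl
  at-Pointwise (e ∷ es) z = +-cong (⟦⟧-cong e) (*-congˡ (at-Pointwise es z))

  at-0 : ∀ {p} → All (E._≈ E.0#) p → ∀ z → p at z ≈ 0#
  at-0 []       z = refl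
  at-0 (e ∷ es) z = trans (+-cong (trans (⟦⟧-cong e) 0#-homo)
    (trans (*-congˡ (at-0 es z)) (zeroʳ z))) (+-identityˡ 0#)

  const-at : ∀ a z → (a ∷ []) at z ≈ ⟦ a ⟧
  const-at a z = trans (+-congˡ (zeroʳ z)) (+-identityʳ ⟦ a ⟧)

  X-at : ∀ z → (E.0# ∷ E.1# ∷ []) at z ≈ z
  X-at z = begin
    ⟦ E.0# ⟧ + z * (⟦ E.1# ⟧ + z * 0#)  ≈⟨ +-cong 0#-homo (*-congˡ (+-congʳ 1#-homo)) ⟩
    0# + z * (1# + z * 0#)
      ≈⟨ solve 1 (λ z → con 0ℤ :+ z :* (con 1ℤ :+ z :* con 0ℤ) := z) refl z ⟩
    z                                   ∎

  at-⊞ : ∀ p q z → (p E.⊞ q) at z ≈ p at z + q at z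
  at-⊞ []      q       z = sym (+-identityˡ _)
  at-⊞ (a ∷ p) []      z = sym (+-identityʳ _)
  at-⊞ (a ∷ p) (b ∷ q) z = begin
    ⟦ a E.+ b ⟧ + z * ((p E.⊞ q) at z)
      ≈⟨ +-cong (+-homo a b) (*-congˡ (at-⊞ p q z)) ⟩
    ⟦ a ⟧ + ⟦ b ⟧ + z * (p at z + q at z)
      ≈⟨ solve 5 (λ a b z p q → a :+ b :+ z :* (p :+ q) :=
           (a :+ z :* p) :+ (b :+ z :* q)) refl ⟦ a ⟧ ⟦ b ⟧ z (p at z) (q at z) ⟩
    (⟦ a ⟧ + z * (p at z)) + (⟦ b ⟧ + z * (q at z))  ∎

  at-scale : ∀ a q z → map (a E.*_) q at z ≈ ⟦ a ⟧ * (q at z)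
  at-scale a []      z = sym (zeroʳ ⟦ a ⟧)
  at-scale a (b ∷ q) z = begin
    ⟦ a E.* b ⟧ + z * (map (a E.*_) q at z)
      ≈⟨ +-cong (*-homo a b) (*-congˡ (at-scale a q z)) ⟩
    ⟦ a ⟧ * ⟦ b ⟧ + z * (⟦ a ⟧ * (q at z))
      ≈⟨ solve 4 (λ a b z q → a :* b :+ z :* (a :* q) := a :* (b :+ z :* q))
           refl ⟦ a ⟧ ⟦ b ⟧ z (q at z) ⟩
    ⟦ a ⟧ * (⟦ b ⟧ + z * (q at z))  ∎

  at-⊠ : ∀ p q z → (p E.⊠ q) at z ≈ p at z * q at z
  at-⊠ []      q z = sym (zeroˡ _)
  at-⊠ (a ∷ p) q z = begin
    (map (a E.*_) q E.⊞ (E.0# ∷ (p E.⊠ q))) at z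
      ≈⟨ at-⊞ (map (a E.*_) q) _ z ⟩
    map (a E.*_) q at z + (⟦ E.0# ⟧ + z * ((p E.⊠ q) at z))
      ≈⟨ +-cong (at-scale a q z) (+-cong 0#-homo (*-congˡ (at-⊠ p q z))) ⟩
    ⟦ a ⟧ * (q at z) + (0# + z * (p at z * q at z))
      ≈⟨ solve 4 (λ a z p q → a :* q :+ (con 0ℤ :+ z :* (p :* q)) := (a :+ z :* p) :* q)
           refl ⟦ a ⟧ z (p at z) (q at z) ⟩
    (⟦ a ⟧ + z * (p at z)) * (q at z)  ∎

  -- For `constants` these predicates at `x` and `x⁻¹` are definitionally the `C[x]` and `C[x⁻¹]` of
  -- a function field, so the subring laws below apply to them directly.
  E[_] : Carrier → Pred Carrier (c ⊔ ℓ)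
  E[ z ] w = ∃[ p ] w ≈ p at z

  E[]-isSubring : ∀ z → IsSubring F E[ z ]
  E[]-isSubring z = record
    { resp = λ { e (p , w≈) → p , trans (sym e) w≈ }
    ; 0∈   = [] , refl
    ; 1∈   = E.1# ∷ [] , sym (trans (const-at E.1# z) 1#-homo)
    ; +∈   = λ { (p , v≈) (q , w≈) →
               p E.⊞ q , trans (+-cong v≈ w≈) (sym (at-⊞ p q z)) }
    ; *∈   = λ { (p , v≈) (q , w≈) →
               p E.⊠ q , trans (*-cong v≈ w≈) (sym (at-⊠ p q z)) }
    ; -∈   = λ { {x} (p , w≈) → map (E.- E.1# E.*_) p ,
               (begin
                 - x                        ≈⟨ -‿cong w≈ ⟩
                 - (p at z)                 ≈⟨ solve 1 (λ w → :- w := :- con 1ℤ :* w) refl (p at z) ⟩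
                 - 1# * (p at z)            ≈⟨ *-congʳ (trans (-‿homo E.1#) (-‿cong 1#-homo)) ⟨
                 ⟦ E.- E.1# ⟧ * (p at z)    ≈⟨ at-scale (E.- E.1#) p z ⟨
                 map (E.- E.1# E.*_) p at z ∎) }
    }

  ⟦⟧∈E[] : ∀ a z → ⟦ a ⟧ ∈ E[ z ]
  ⟦⟧∈E[] a z = a ∷ [] , sym (const-at a z)

  z∈E[z] : ∀ z → z ∈ E[ z ]
  z∈E[z] z = E.0# ∷ E.1# ∷ [] , sym (X-at z)

-- Integrality through finite modules.

module Integrality {c ℓ} {F : Field c ℓ} {a} {A : Pred (Field.Carrier F) a}
                   (A-isSubring : IsSubring F A) where
  open Field F
  open FieldProperties F
  open Polynomial F
  open IsSubring A-isSubring
  open Sum +-commutativeMonoid using (sum-cong-≋; sum-remove; ∑-distrib-+; sum-replicate-zero)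
  open SemiringSum semiring using (*-distribˡ-sum; *-distribʳ-sum)
  open SetoidReasoning setoid

  sum-+ : ∀ {n} (x y e : Fin n → Carrier) →
          sum (λ j → (x j + y j) * e j) ≈ sum (λ j → x j * e j) + sum (λ j → y j * e j)
  sum-+ x y e = trans (sum-cong-≋ (λ j → distribʳ (e j) (x j) (y j)))
    (∑-distrib-+ (λ j → x j * e j) (λ j → y j * e j))

  sum-scale : ∀ {n} b (x e : Fin n → Carrier) →
              sum (λ j → b * x j * e j) ≈ b * sum (λ j → x j * e j)
  sum-scale b x e = trans (sum-cong-≋ (λ j → *-assoc b (x j) (e j)))
    (sym (*-distribˡ-sum b (λ j → x j * e j)))

  module _ (u : Carrier) where

    -- Values at u of polynomials over A of degree < d, respectively monic
    -- of degree d.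
    Below Monic : ℕ → Pred Carrier (c ⊔ ℓ ⊔ a)
    Below zero    z = Level.Lift (c ⊔ ℓ ⊔ a) (z ≈ 0#)
    Below (suc d) z = ∃[ b ] ∃[ w ] b ∈ A × Below d w × z ≈ b + u * w
    Monic zero    z = Level.Lift (c ⊔ ℓ ⊔ a) (z ≈ 1#)
    Monic (suc d) z = ∃[ b ] ∃[ w ] b ∈ A × Monic d w × z ≈ b + u * w

    Below-resp : ∀ d {z w} → z ≈ w → Below d z → Below d w
    Below-resp zero    e (Level.lift z≈0) = Level.lift (trans (sym e) z≈0)
    Below-resp (suc d) e (b , w , b∈ , w∈ , z≈) = b , w , b∈ , w∈ , trans (sym e) z≈

    Monic-resp : ∀ d {z w} → z ≈ w → Monic d z → Monic d w
    Monic-resp zero    e (Level.lift z≈1) = Level.lift (trans (sym e) z≈1)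
    Monic-resp (suc d) e (b , w , b∈ , w∈ , z≈) = b , w , b∈ , w∈ , trans (sym e) z≈

    Below-shift : ∀ d {z} → Below d z → Below (suc d) (u * z)
    Below-shift d {z} z∈ = 0# , z , 0∈ , z∈ , sym (+-identityˡ (u * z))

    Monic-shift : ∀ d {z} → Monic d z → Monic (suc d) (u * z)
    Monic-shift d {z} z∈ = 0# , z , 0∈ , z∈ , sym (+-identityˡ (u * z))

    Below-0 : ∀ d → Below d 0#
    Below-0 zero    = Level.lift refl
    Below-0 (suc d) = Below-resp (suc d) (zeroʳ u) (Below-shift d (Below-0 d))

    Below-suc : ∀ d {z} → Below d z → Below (suc d) z
    Below-suc zero    (Level.lift z≈0) = Below-resp 1 (sym z≈0) (Below-0 1)
    Below-suc (suc d) (b , w , b∈ , w∈ , z≈) = b , w , b∈ , Below-suc d w∈ , z≈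

    Below-pad : ∀ e d {z} → Below d z → Below (e ℕ.+ d) z
    Below-pad zero    d z∈ = z∈
    Below-pad (suc e) d z∈ = Below-suc (e ℕ.+ d) (Below-pad e d z∈)

    Below-+ : ∀ d {z w} → Below d z → Below d w → Below d (z + w)
    Below-+ zero    (Level.lift z≈0) (Level.lift w≈0) =
      Level.lift (trans (+-cong z≈0 w≈0) (+-identityˡ 0#))
    Below-+ (suc d) (b , z′ , b∈ , z′∈ , z≈) (b′ , w′ , b′∈ , w′∈ , w≈) =
      b + b′ , z′ + w′ , +∈ b∈ b′∈ , Below-+ d z′∈ w′∈ ,
      trans (+-cong z≈ w≈) (solve 5 (λ b b′ u z w →
        (b :+ u :* z) :+ (b′ :+ u :* w) := (b :+ b′) :+ u :* (z :+ w)) refl b b′ u z′ w′)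

    Monic-+ : ∀ d {z w} → Monic d z → Below d w → Monic d (z + w)
    Monic-+ zero    (Level.lift z≈1) (Level.lift w≈0) =
      Level.lift (trans (+-cong z≈1 w≈0) (+-identityʳ 1#))
    Monic-+ (suc d) (b , z′ , b∈ , z′∈ , z≈) (b′ , w′ , b′∈ , w′∈ , w≈) =
      b + b′ , z′ + w′ , +∈ b∈ b′∈ , Monic-+ d z′∈ w′∈ ,
      trans (+-cong z≈ w≈) (solve 5 (λ b b′ u z w →
        (b :+ u :* z) :+ (b′ :+ u :* w) := (b :+ b′) :+ u :* (z :+ w)) refl b b′ u z′ w′)

    Below-scale : ∀ d {b z} → b ∈ A → Below d z → Below d (b * z)
    Below-scale zero    {b} b∈ (Level.lift z≈0) =
      Level.lift (trans (*-congˡ z≈0) (zeroʳ b))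
    Below-scale (suc d) {b} b∈ (b′ , w , b′∈ , w∈ , z≈) =
      b * b′ , b * w , *∈ b∈ b′∈ , Below-scale d b∈ w∈ ,
      trans (*-congˡ z≈) (solve 4 (λ b b′ u w →
        b :* (b′ :+ u :* w) := b :* b′ :+ u :* (b :* w)) refl b b′ u w)

    Below-neg : ∀ d {z} → Below d z → Below d (- z)
    Below-neg d {z} z∈ = Below-resp d
      (solve 1 (λ z → :- con 1ℤ :* z := :- z) refl z) (Below-scale d (-∈ 1∈) z∈)

    Monic⇒Below : ∀ d {z} → Monic d z → Below (suc d) z
    Monic⇒Below zero    (Level.lift z≈1) =
      1# , 0# , 1∈ , Level.lift refl ,
      trans z≈1 (sym (trans (+-congˡ (zeroʳ u)) (+-identityʳ 1#)))
    Monic⇒Below (suc d) (b , w , b∈ , w∈ , z≈) = b , w , b∈ , Monic⇒Below d w∈ , z≈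

    private
      expand : ∀ {b z z′} w → z ≈ b + u * z′ → b * w + u * (z′ * w) ≈ z * w
      expand {b} {z} {z′} w z≈ = sym (trans (*-congʳ z≈)
        (solve 4 (λ b u z w → (b :+ u :* z) :* w := b :* w :+ u :* (z :* w)) refl b u z′ w))

    Below-* : ∀ d e {z w} → Below d z → Below e w → Below (d ℕ.+ e) (z * w)
    Below-* zero    e {z} {w} (Level.lift z≈0) w∈ =
      Below-resp e (sym (trans (*-congʳ z≈0) (zeroˡ w))) (Below-0 e)
    Below-* (suc d) e {z} {w} (b , z′ , b∈ , z′∈ , z≈) w∈ =
      Below-resp (suc d ℕ.+ e) (expand w z≈) (Below-+ (suc d ℕ.+ e)
        (Below-pad (suc d) e (Below-scale e b∈ w∈))
        (Below-shift (d ℕ.+ e) (Below-* d e z′∈ w∈)))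

    Monic-*-Below : ∀ d e {z w} → Monic d z → Below e w → Below (d ℕ.+ e) (z * w)
    Monic-*-Below zero    e {z} {w} (Level.lift z≈1) w∈ =
      Below-resp e (sym (trans (*-congʳ z≈1) (*-identityˡ w))) w∈
    Monic-*-Below (suc d) e {z} {w} (b , z′ , b∈ , z′∈ , z≈) w∈ =
      Below-resp (suc d ℕ.+ e) (expand w z≈) (Below-+ (suc d ℕ.+ e)
        (Below-pad (suc d) e (Below-scale e b∈ w∈))
        (Below-shift (d ℕ.+ e) (Monic-*-Below d e z′∈ w∈)))

    Monic-* : ∀ d e {z w} → Monic d z → Monic e w → Monic (d ℕ.+ e) (z * w)
    Monic-* zero    e {z} {w} (Level.lift z≈1) w∈ =
      Monic-resp e (sym (trans (*-congʳ z≈1) (*-identityˡ w))) w∈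
    Monic-* (suc d) e {z} {w} (b , z′ , b∈ , z′∈ , z≈) w∈ =
      Monic-resp (suc d ℕ.+ e) (trans (+-comm _ _) (expand w z≈)) (Monic-+ (suc d ℕ.+ e)
        (Monic-shift (d ℕ.+ e) (Monic-* d e z′∈ w∈))
        -- `b * w` has degree at most `e`, so it is `Below (suc e)`; padding by `d` reaches
        -- `suc (d + e)`, which still leaves the leading term of the other summand untouched.
        (≡.subst (λ k → Below k (b * w)) (ℕ.+-suc d e)
          (Below-pad d (suc e) (Below-scale (suc e) b∈ (Monic⇒Below e w∈)))))

    Monic⇒eval : ∀ d {z} → Monic d z → ∃[ cs ] All A cs × z ≈ eval (monic cs) u
    Monic⇒eval zero    (Level.lift z≈1) = [] , [] ,
      trans z≈1 (sym (trans (+-congˡ (zeroʳ u)) (+-identityʳ 1#)))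
    Monic⇒eval (suc d) (b , w , b∈ , w∈ , z≈) with Monic⇒eval d w∈
    ... | cs , cs∈ , w≈ = b ∷ cs , b∈ ∷ cs∈ , trans z≈ (+-congˡ (*-congˡ w≈))

    -- A replacement for Cayley-Hamilton without determinants: eliminating
    -- unknowns by cross multiplication keeps the diagonal entries monic in
    -- u, of a degree exceeding that of the other entries.
    eliminate : ∀ m d (N : Fin (suc m) → Fin (suc m) → Carrier) (e : Fin (suc m) → Carrier) →
                (∀ i → Monic d (N i i)) → (∀ i j → i ≢ j → Below d (N i j)) →
                (∀ i → sum (λ j → N i j * e j) ≈ 0#) → e 0F ≈ 1# →
                ∃[ d′ ] Monic d′ 0#
    eliminate zero d N e diag off Ne≈0 e₀≈1 = d , Monic-resp d N₀₀≈0 (diag 0F)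
      where
      N₀₀≈0 : N 0F 0F ≈ 0#
      N₀₀≈0 = begin
        N 0F 0F              ≈⟨ *-identityʳ _ ⟨
        N 0F 0F * 1#         ≈⟨ *-congˡ e₀≈1 ⟨
        N 0F 0F * e 0F       ≈⟨ +-identityʳ _ ⟨
        N 0F 0F * e 0F + 0#  ≈⟨ Ne≈0 0F ⟩
        0#                   ∎
    eliminate (suc m) d N e diag off Ne≈0 e₀≈1 =
      eliminate m (d ℕ.+ d) N′ (e ∘ σ) diag′ off′ N′e≈0 e₀≈1
      where
      -- Unknown `1` is eliminated rather than `0`: the normalised unknown `e 0F ≈ 1#` must survive
      -- to the last equation, where it gives `N 0F 0F ≈ 0#`.
      σ : Fin (suc m) → Fin (suc (suc m))
      σ = punchIn 1F

      σ≢1 : ∀ i → σ i ≢ 1F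
      σ≢1 i = Fin.punchInᵢ≢i 1F i

      -- `N 1F 1F` times row `σ i` minus `N (σ i) 1F` times row `1`, which cancels the eliminated
      -- column. No division occurs, so the pivot may vanish.
      N′ : Fin (suc m) → Fin (suc m) → Carrier
      N′ i j = N 1F 1F * N (σ i) (σ j) + - N (σ i) 1F * N 1F (σ j)

      cross : ∀ i j → Below (d ℕ.+ d) (- N (σ i) 1F * N 1F (σ j))
      cross i j = Below-* d d (Below-neg d (off (σ i) 1F (σ≢1 i)))
        (off 1F (σ j) (λ e → σ≢1 j (≡.sym e)))

      diag′ : ∀ i → Monic (d ℕ.+ d) (N′ i i)
      diag′ i = Monic-+ (d ℕ.+ d) (Monic-* d d (diag 1F) (diag (σ i))) (cross i i)

      off′ : ∀ i j → i ≢ j → Below (d ℕ.+ d) (N′ i j)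
      off′ i j i≢j = Below-+ (d ℕ.+ d)
        (Monic-*-Below d d (diag 1F) (off (σ i) (σ j) (λ e → i≢j (Fin.punchIn-injective 1F i j e))))
        (cross i j)

      rest : Fin (suc (suc m)) → Carrier
      rest i = sum (λ j → N i (σ j) * e (σ j))

      split : ∀ i → N i 1F * e 1F + rest i ≈ 0#
      split i = trans (sym (sum-remove {i = 1F} (λ j → N i j * e j))) (Ne≈0 i)

      N′e≈0 : ∀ i → sum (λ j → N′ i j * e (σ j)) ≈ 0#
      N′e≈0 i = begin
        sum (λ j → N′ i j * e (σ j))
          ≈⟨ sum-+ (λ j → p * N (σ i) (σ j)) (λ j → - q * N 1F (σ j)) (e ∘ σ) ⟩
        sum (λ j → p * N (σ i) (σ j) * e (σ j)) + sum (λ j → - q * N 1F (σ j) * e (σ j))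
          ≈⟨ +-cong (sum-scale p (N (σ i) ∘ σ) (e ∘ σ)) (sum-scale (- q) (N 1F ∘ σ) (e ∘ σ)) ⟩
        p * rest (σ i) + - q * rest 1F
          ≈⟨ solve 5 (λ p q r s e → p :* r :+ :- q :* s :=
               p :* (q :* e :+ r) :+ (:- q) :* (p :* e :+ s)) refl
               p q (rest (σ i)) (rest 1F) (e 1F) ⟩
        p * (q * e 1F + rest (σ i)) + - q * (p * e 1F + rest 1F)
          ≈⟨ +-cong (*-congˡ (split (σ i))) (*-congˡ (split 1F)) ⟩
        p * 0# + - q * 0#
          ≈⟨ solve 2 (λ p q → p :* con 0ℤ :+ :- q :* con 0ℤ := con 0ℤ) refl p q ⟩
        0# ∎
        where
        p = N 1F 1F
        q = N (σ i) 1F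

  Span : ∀ {m} → (Fin m → Carrier) → Pred Carrier (c ⊔ ℓ ⊔ a)
  Span {m} e z = ∃ λ (b : Fin m → Carrier) → (∀ j → b j ∈ A) × z ≈ sum (λ j → b j * e j)

  δ : ∀ {m} → Carrier → Fin m → Fin m → Carrier
  δ b i j with i Fin.≟ j
  ... | yes _ = b
  ... | no  _ = 0#

  δ-diag : ∀ {m} b (i : Fin m) → δ b i i ≡ b
  δ-diag b i with i Fin.≟ i
  ... | yes _   = ≡.refl
  ... | no  i≢i = contradiction ≡.refl i≢i

  δ-off : ∀ {m} b {i j : Fin m} → i ≢ j → δ b i j ≡ 0#
  δ-off b {i} {j} i≢j with i Fin.≟ j
  ... | yes i≡j = contradiction i≡j i≢j
  ... | no  _   = ≡.refl

  sum-δ : ∀ {m} b (i : Fin m) (e : Fin m → Carrier) → sum (λ j → δ b i j * e j) ≈ b * e i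
  sum-δ {suc m} b i e = begin
    sum (λ j → δ b i j * e j)      ≈⟨ sum-remove {i = i} (λ j → δ b i j * e j) ⟩
    δ b i i * e i + sum (λ j → δ b i (punchIn i j) * e (punchIn i j))
      ≈⟨ +-cong (*-congʳ (reflexive (δ-diag b i))) (sum-cong-≋ (λ j → trans
           (*-congʳ (reflexive (δ-off b (λ e → Fin.punchInᵢ≢i i j (≡.sym e))))) (zeroˡ _))) ⟩
    b * e i + sum {m} (λ _ → 0#)   ≈⟨ +-congˡ (sum-replicate-zero m) ⟩
    b * e i + 0#                   ≈⟨ +-identityʳ _ ⟩
    b * e i                        ∎

  module _ {m} (e : Fin m → Carrier) where

    Span-resp : ∀ {z w} → z ≈ w → z ∈ Span e → w ∈ Span e
    Span-resp z≈w (b , b∈ , z≈) = b , b∈ , trans (sym z≈w) z≈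

    Span-basis : ∀ {b} → b ∈ A → ∀ i → b * e i ∈ Span e
    Span-basis {b} b∈ i = δ b i , δ∈ , sym (sum-δ b i e)
      where
      δ∈ : ∀ j → δ b i j ∈ A
      δ∈ j with i Fin.≟ j
      ... | yes _ = b∈
      ... | no  _ = 0∈

    Span-0 : 0# ∈ Span e
    Span-0 = (λ _ → 0#) , (λ _ → 0∈) ,
      sym (trans (sum-cong-≋ (λ j → zeroˡ (e j))) (sum-replicate-zero m))

    Span-+ : ∀ {z w} → z ∈ Span e → w ∈ Span e → z + w ∈ Span e
    Span-+ (b , b∈ , z≈) (b′ , b′∈ , w≈) =
      (λ j → b j + b′ j) , (λ j → +∈ (b∈ j) (b′∈ j)) ,
      trans (+-cong z≈ w≈) (sym (sum-+ b b′ e))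

    Span-scale : ∀ {b z} → b ∈ A → z ∈ Span e → b * z ∈ Span e
    Span-scale {b} b∈ (b′ , b′∈ , z≈) =
      (λ j → b * b′ j) , (λ j → *∈ b∈ (b′∈ j)) ,
      trans (*-congˡ z≈) (sym (sum-scale b b′ e))

    Span-sum : ∀ {k} {z : Fin k → Carrier} → (∀ i → z i ∈ Span e) → sum z ∈ Span e
    Span-sum {zero}  z∈ = Span-0
    Span-sum {suc k} z∈ = Span-+ (z∈ 0F) (Span-sum (z∈ ∘ Fin.suc))

  -- The span is closed under multiplication, so `u * e i` is an `A`-combination of the `e j` with
  -- some matrix `r`. Then `N = u - r` kills the vector `e`; its diagonal is monic of degree 1 in
  -- `u` and its other entries are constants, as `eliminate` requires.
  Span⇒Integral : ∀ {m} (e : Fin (suc m) → Carrier) → e 0F ≈ 1# →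
                  (∀ i j → e i * e j ∈ Span e) → ∀ {u} → u ∈ Span e → IntegralOver A u
  Span⇒Integral {m} e e₀≈1 e*e∈ {u} (b , b∈ , u≈) =
    integral (eliminate u m 1 N e diag off Ne≈0 e₀≈1)
    where
    ue∈ : ∀ i → u * e i ∈ Span e
    ue∈ i = Span-resp e (begin
        sum (λ j → b j * (e j * e i))  ≈⟨ sum-cong-≋ (λ j → *-assoc (b j) (e j) (e i)) ⟨
        sum (λ j → b j * e j * e i)    ≈⟨ *-distribʳ-sum (e i) (λ j → b j * e j) ⟨
        sum (λ j → b j * e j) * e i    ≈⟨ *-congʳ u≈ ⟨
        u * e i                        ∎)
      (Span-sum e (λ j → Span-scale e (b∈ j) (e*e∈ j i)))

    N : Fin (suc m) → Fin (suc m) → Carrier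
    N i j = - 1# * proj₁ (ue∈ i) j + δ u i j

    diag : ∀ i → Monic u 1 (N i i)
    diag i = _ , 1# , *∈ (-∈ 1∈) (proj₁ (proj₂ (ue∈ i)) i) , Level.lift refl ,
      +-congˡ (trans (reflexive (δ-diag u i)) (sym (*-identityʳ u)))

    off : ∀ i j → i ≢ j → Below u 1 (N i j)
    off i j i≢j = _ , 0# , *∈ (-∈ 1∈) (proj₁ (proj₂ (ue∈ i)) j) , Level.lift refl ,
      +-congˡ (trans (reflexive (δ-off u i≢j)) (sym (zeroʳ u)))

    Ne≈0 : ∀ i → sum (λ j → N i j * e j) ≈ 0#
    Ne≈0 i = begin
      sum (λ j → (- 1# * r j + δ u i j) * e j)
        ≈⟨ sum-+ (λ j → - 1# * r j) (δ u i) e ⟩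
      sum (λ j → - 1# * r j * e j) + sum (λ j → δ u i j * e j)
        ≈⟨ +-cong (sum-scale (- 1#) r e) (sum-δ u i e) ⟩
      - 1# * sum (λ j → r j * e j) + u * e i
        ≈⟨ +-congʳ (*-congˡ (proj₂ (proj₂ (ue∈ i)))) ⟨
      - 1# * (u * e i) + u * e i
        ≈⟨ solve 1 (λ x → (:- con 1ℤ) :* x :+ x := con 0ℤ) refl (u * e i) ⟩
      0# ∎
      where r = proj₁ (ue∈ i)

    integral : ∃[ d ] Monic u d 0# → IntegralOver A u
    integral (d , 0∈M) = monic-root (Monic⇒eval u d 0∈M)
      where
      monic-root : ∃[ cs ] All A cs × 0# ≈ eval (monic cs) u → IntegralOver A u
      monic-root (cs , cs∈ , 0≈) = cs , cs∈ , sym 0≈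

-- Expansion of polynomials in Y over the powers below Yᵐ⁺¹.

module PowerBasis {c ℓ} (C : Field c ℓ) (m : ℕ) (a : Field.Carrier C) where
  private module C where
    open Field C public
    open Polynomial C public

  -- If Yᵐ⁺¹ = a + X then p(Y) = Σⱼ (component p j)(X) Yʲ.
  component : C.Poly → Fin (suc m) → C.Poly
  component []      _           = []
  -- Multiplication by `Y` raises every index by one; the top component reaches `Yᵐ⁺¹` and returns
  -- to index 0 with the factor `a + X`.
  component (b ∷ p) 0F          =
    (b ∷ []) C.⊞ ((a ∷ C.1# ∷ []) C.⊠ component p (fromℕ m))
  component (b ∷ p) (Fin.suc j) = component p (inject₁ j)

  module _ {E : Field c ℓ} (h : FieldHom C E) where
    open Field E
    open FieldHom h
    open FieldProperties E
    open Evaluation h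
    open Sum +-commutativeMonoid using (sum-init-last; sum-cong-≋; sum-replicate-zero)
    open SemiringSum semiring using (*-distribˡ-sum)
    open SetoidReasoning setoid

    module _ {X Y : Carrier} (Yⁿ≈a+X : Y ^ suc m ≈ ⟦ a ⟧ + X) where

      private
        linear-at : (a ∷ C.1# ∷ []) at X ≈ ⟦ a ⟧ + X
        linear-at = +-congˡ (trans (*-congˡ (trans (const-at C.1# X) 1#-homo)) (*-identityʳ X))

      -- Stated for an arbitrary target field because it is used twice: in the function field at
      -- `(x , y)`, and in `C` itself at a point `(ξ α , α)`. Comparing the two expansions lets
      -- linear independence of the powers of `y` control values at points.
      at-component : ∀ p → p at Y ≈ sum (λ j → component p j at X * Y ^ toℕ j)
      at-component []      = sym (trans (sum-cong-≋ {suc m} (λ j → zeroˡ (Y ^ toℕ j)))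
                                        (sum-replicate-zero (suc m)))
      at-component (b ∷ p) = begin
        ⟦ b ⟧ + Y * (p at Y)
          ≈⟨ +-congˡ (*-congˡ (at-component p)) ⟩
        ⟦ b ⟧ + Y * sum (λ j → q j * Y ^ toℕ j)
          ≈⟨ +-congˡ (*-distribˡ-sum Y (λ j → q j * Y ^ toℕ j)) ⟩
        ⟦ b ⟧ + sum (λ j → Y * (q j * Y ^ toℕ j))
          ≈⟨ +-congˡ (sum-init-last (λ j → Y * (q j * Y ^ toℕ j))) ⟩
        ⟦ b ⟧ + (sum (λ j → Y * (q (inject₁ j) * Y ^ toℕ (inject₁ j))) + Y * (q (fromℕ m) * Y ^ toℕ (fromℕ m)))
          ≈⟨ +-congˡ (+-cong (sum-cong-≋ inner) outer) ⟩
        ⟦ b ⟧ + (rest + (⟦ a ⟧ + X) * q (fromℕ m))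
          ≈⟨ solve 3 (λ b r s → b :+ (r :+ s) := (b :+ s) :* con 1ℤ :+ r) refl ⟦ b ⟧ rest _ ⟩
        (⟦ b ⟧ + (⟦ a ⟧ + X) * q (fromℕ m)) * 1# + rest
          ≈⟨ +-congʳ (*-congʳ (sym (trans (at-⊞ (b ∷ []) ((a ∷ C.1# ∷ []) C.⊠ component p (fromℕ m)) X) (+-cong (const-at b X)
               (trans (at-⊠ (a ∷ C.1# ∷ []) (component p (fromℕ m)) X) (*-congʳ linear-at)))))) ⟩
        component (b ∷ p) 0F at X * 1# + rest
          ∎
        where
        q : Fin (suc m) → Carrier
        q j = component p j at X

        rest : Carrier
        rest = sum (λ j → q (inject₁ j) * Y ^ suc (toℕ j))

        inner : ∀ j → Y * (q (inject₁ j) * Y ^ toℕ (inject₁ j)) ≈ q (inject₁ j) * Y ^ suc (toℕ j)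
        inner j rewrite Fin.toℕ-inject₁ j =
          solve 3 (λ y q z → y :* (q :* z) := q :* (y :* z)) refl Y (q (inject₁ j)) (Y ^ toℕ j)

        outer : Y * (q (fromℕ m) * Y ^ toℕ (fromℕ m)) ≈ (⟦ a ⟧ + X) * q (fromℕ m)
        outer rewrite Fin.toℕ-fromℕ m = trans
          (solve 3 (λ y q z → y :* (q :* z) := (y :* z) :* q) refl Y (q (fromℕ m)) (Y ^ m))
          (*-congʳ Yⁿ≈a+X)

IsLinear : ∀ {c ℓ} {C : Field c ℓ} {n f} → FunctionField C n f → Field.Carrier C → Set ℓ
IsLinear {n = n} FF a = y ^ n ≈ κ a + x
  where open FunctionField FF

-- Vanishing of H¹ for the curve yⁿ = a + x.

module RationalCurve {c ℓ} {C : Field c ℓ} (closed : Polynomial.AlgebraicallyClosed C)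
                     (_≟0 : ∀ z → Dec (Field._≈_ C z (Field.0# C)))
                     {m : ℕ} {f : Polynomial.Poly C} (FF : FunctionField C (suc m) f)
                     (a : Field.Carrier C) (yⁿ≈a+x : IsLinear FF a) where
  open FunctionField FF
  private
    module C where
      open Field C public
      open Polynomial C public
      open FieldProperties C public
    module V = Evaluation (idHom C)
  open FieldProperties F
  open Evaluation constants
  open PowerBasis C m a
  open Polynomial F using (monic)
  open IsSubring (E[]-isSubring y) renaming (resp to C[y]-resp)
  open SetoidReasoning setoid
  open SemiringExp semiring using (^-homo-*)
  open Sum +-commutativeMonoid using (sum-cong-≋)
  open SemiringSum semiring using (*-distribˡ-sum)

  C[y] : Pred Carrier (c ⊔ ℓ)
  C[y] = E[ y ]

  -- z is a polynomial in y, with value b at y = α; there x has value ξ α.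
  infix 4 _⇝⟨_⟩_
  _⇝⟨_⟩_ : Carrier → C.Carrier → C.Carrier → Set (c ⊔ ℓ)
  z ⇝⟨ α ⟩ b = ∃[ p ] z ≈ p at y × p V.at α C.≈ b

  ξ : C.Carrier → C.Carrier
  ξ α = α C.^ suc m C.- a

  module _ {α : C.Carrier} where

    C[y]⇒⇝ : ∀ {z} → z ∈ C[y] → ∃[ b ] z ⇝⟨ α ⟩ b
    C[y]⇒⇝ (p , z≈) = p V.at α , p , z≈ , C.refl

    ⇝⇒C[y] : ∀ {z b} → z ⇝⟨ α ⟩ b → z ∈ C[y]
    ⇝⇒C[y] (p , z≈ , _) = p , z≈

    ⇝-resp : ∀ {z w b} → z ≈ w → z ⇝⟨ α ⟩ b → w ⇝⟨ α ⟩ b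
    ⇝-resp z≈w (p , z≈ , b≈) = p , trans (sym z≈w) z≈ , b≈

    ⇝-respʳ : ∀ {z b d} → b C.≈ d → z ⇝⟨ α ⟩ b → z ⇝⟨ α ⟩ d
    ⇝-respʳ b≈d (p , z≈ , b≈) = p , z≈ , C.trans b≈ b≈d

    ⇝-const : ∀ b → κ b ⇝⟨ α ⟩ b
    ⇝-const b = b ∷ [] , sym (const-at b y) , V.const-at b α

    ⇝-y : y ⇝⟨ α ⟩ α
    ⇝-y = C.0# ∷ C.1# ∷ [] , sym (X-at y) , V.X-at α

    ⇝-+ : ∀ {z w b d} → z ⇝⟨ α ⟩ b → w ⇝⟨ α ⟩ d → z + w ⇝⟨ α ⟩ b C.+ d
    ⇝-+ (p , z≈ , b≈) (q , w≈ , d≈) = p C.⊞ q ,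
      trans (+-cong z≈ w≈) (sym (at-⊞ p q y)) , C.trans (V.at-⊞ p q α) (C.+-cong b≈ d≈)

    ⇝-* : ∀ {z w b d} → z ⇝⟨ α ⟩ b → w ⇝⟨ α ⟩ d → z * w ⇝⟨ α ⟩ b C.* d
    ⇝-* (p , z≈ , b≈) (q , w≈ , d≈) = p C.⊠ q ,
      trans (*-cong z≈ w≈) (sym (at-⊠ p q y)) , C.trans (V.at-⊠ p q α) (C.*-cong b≈ d≈)

    ⇝-^ : ∀ {z b} → z ⇝⟨ α ⟩ b → ∀ k → z ^ k ⇝⟨ α ⟩ b C.^ k
    ⇝-^ z⇝ zero    = ⇝-resp 1#-homo (⇝-const C.1#)
    ⇝-^ z⇝ (suc k) = ⇝-* z⇝ (⇝-^ z⇝ k)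

    ⇝-x : x ⇝⟨ α ⟩ ξ α
    ⇝-x = ⇝-resp (begin
        y ^ suc m + κ (C.- a)  ≈⟨ +-cong yⁿ≈a+x (-‿homo a) ⟩
        κ a + x - κ a          ≈⟨ solve 2 (λ a x → a :+ x :- a := x) refl (κ a) x ⟩
        x                      ∎)
      (⇝-+ (⇝-^ ⇝-y (suc m)) (⇝-const (C.- a)))

    ⇝-y-κ : ∀ β → y - κ β ⇝⟨ α ⟩ α C.- β
    ⇝-y-κ β = ⇝-resp (+-congˡ (-‿homo β)) (⇝-+ ⇝-y (⇝-const (C.- β)))

    -- y is transcendental over C, so values at α are well defined.
    ⇝-0 : ∀ {z b} → z ≈ 0# → z ⇝⟨ α ⟩ b → b C.≈ C.0#
    ⇝-0 {z} {b} z≈0 (p , z≈ , b≈) = C.trans (C.sym b≈) (C.trans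
      (at-component (idHom C) α^n≈ p)
      (C.trans (Sum.sum-cong-≋ C.+-commutativeMonoid (λ j →
         C.trans (C.*-congʳ (V.at-0 (components≈0 j) (ξ α))) (C.zeroˡ (α C.^ toℕ j))))
       (Sum.sum-replicate-zero C.+-commutativeMonoid (suc m))))
      where
      components≈0 : ∀ j → All (C._≈ C.0#) (component p j)
      components≈0 = independent (component p)
        (trans (sym (at-component constants yⁿ≈a+x p)) (trans (sym z≈) z≈0))
      α^n≈ : α C.^ suc m C.≈ a C.+ ξ α
      α^n≈ = C.solve 2 (λ u a → u C.:= a C.:+ (u C.:- a)) C.refl (α C.^ suc m) a

    -- Horner's scheme: the value of the tail at `α` becomes the constant coefficient of the new
    -- quotient.
    divide : ∀ p → ∃[ q ] p at y ≈ (y - κ α) * (q at y) + κ (p V.at α)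
    divide [] = [] , sym (trans (+-cong (zeroʳ _) 0#-homo) (+-identityˡ 0#))
    divide (b ∷ p) with divide p
    ... | q , p≈ = p V.at α ∷ q , (begin
      κ b + y * (p at y)
        ≈⟨ +-congˡ (*-congˡ p≈) ⟩
      κ b + y * ((y - κ α) * (q at y) + κ (p V.at α))
        ≈⟨ solve 5 (λ b y α q v → b :+ y :* ((y :- α) :* q :+ v) :=
             (y :- α) :* (v :+ y :* q) :+ (b :+ α :* v)) refl
             (κ b) y (κ α) (q at y) (κ (p V.at α)) ⟩
      (y - κ α) * ((p V.at α ∷ q) at y) + (κ b + κ α * κ (p V.at α))
        ≈⟨ +-congˡ (trans (+-homo _ _) (+-congˡ (*-homo _ _))) ⟨
      (y - κ α) * ((p V.at α ∷ q) at y) + κ ((b ∷ p) V.at α) ∎)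

    root⇒factor : ∀ {z b} → z ⇝⟨ α ⟩ b → b C.≈ C.0# → ∃[ w ] w ∈ C[y] × z ≈ (y - κ α) * w
    root⇒factor {z} (p , z≈ , b≈) b≈0 with divide p
    ... | q , p≈ = q at y , (q , refl) , (begin
      z                                       ≈⟨ trans z≈ p≈ ⟩
      (y - κ α) * (q at y) + κ (p V.at α)
        ≈⟨ +-congˡ (trans (⟦⟧-cong (C.trans b≈ b≈0)) 0#-homo) ⟩
      (y - κ α) * (q at y) + 0#               ≈⟨ +-identityʳ _ ⟩
      (y - κ α) * (q at y)                    ∎)

    -- The same division, recording that the quotient is again monic and of degree one less, so that
    -- `split` can continue with it.
    divide-monic : ∀ b cs → ∃[ ds ] length ds ≡ length cs ×
      C.monic (b ∷ cs) at y ≈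
        (y - κ α) * (C.monic ds at y) + κ (C.monic (b ∷ cs) V.at α)
    divide-monic b [] = [] , ≡.refl , (begin
      κ b + y * (κ C.1# + y * 0#)
        ≈⟨ solve 4 (λ b y u α → b :+ y :* (u :+ y :* con 0ℤ) :=
             (y :- α) :* (u :+ y :* con 0ℤ) :+ (b :+ α :* u)) refl (κ b) y (κ C.1#) (κ α) ⟩
      (y - κ α) * (κ C.1# + y * 0#) + (κ b + κ α * κ C.1#)
        ≈⟨ +-congˡ (trans (+-homo _ _) (+-congˡ (trans (*-homo _ _) (*-congˡ
             (⟦⟧-cong (V.const-at C.1# α)))))) ⟨
      (y - κ α) * (κ C.1# + y * 0#) + κ (C.monic (b ∷ []) V.at α) ∎)
    divide-monic b (b′ ∷ cs) with divide-monic b′ cs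
    ... | ds , len , p≈ = v ∷ ds , ≡.cong suc len , (begin
      κ b + y * (C.monic (b′ ∷ cs) at y)
        ≈⟨ +-congˡ (*-congˡ p≈) ⟩
      κ b + y * ((y - κ α) * (C.monic ds at y) + κ v)
        ≈⟨ solve 5 (λ b y α q v → b :+ y :* ((y :- α) :* q :+ v) :=
             (y :- α) :* (v :+ y :* q) :+ (b :+ α :* v)) refl
             (κ b) y (κ α) (C.monic ds at y) (κ v) ⟩
      (y - κ α) * (C.monic (v ∷ ds) at y) + (κ b + κ α * κ v)
        ≈⟨ +-congˡ (trans (+-homo _ _) (+-congˡ (*-homo _ _))) ⟨
      (y - κ α) * (C.monic (v ∷ ds) at y) + κ (C.monic (b ∷ b′ ∷ cs) V.at α) ∎)
      where v = C.monic (b′ ∷ cs) V.at α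


  Π : List C.Carrier → Carrier
  Π = foldr (λ α r → (y - κ α) * r) 1#

  at-∈C[y] : ∀ {z} → z ∈ C[y] → ∀ p → p at z ∈ C[y]
  at-∈C[y] z∈ []      = 0∈
  at-∈C[y] z∈ (b ∷ p) = +∈ (⟦⟧∈E[] b y) (*∈ z∈ (at-∈C[y] z∈ p))

  x∈C[y] : x ∈ C[y]
  x∈C[y] = ⇝⇒C[y] (⇝-x {C.0#})

  -- At the point `α + 1` this function has the value 1.
  y-κ_≉0 : ∀ α → y - κ α ≉ 0#
  y-κ α ≉0 y-κα≈0 = C.1≉0 (C.trans
    (C.solve 1 (λ α → C.con 1ℤ C.:= (α C.:+ C.con 1ℤ) C.:- α) C.refl α)
    (⇝-0 y-κα≈0 (⇝-y-κ {α C.+ C.1#} α)))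

  -- A root from `closed` splits off one linear factor. The recursion runs on the degree `k`,
  -- because the quotient `ds` is not a sublist of `cs`.
  split : ∀ k cs → length cs ≡ k → ∃[ αs ] C.monic cs at y ≈ Π αs
  split zero    []       len = [] , trans (const-at C.1# y) 1#-homo
  split (suc k) (b ∷ cs) len with closed b cs
  ... | α , root with divide-monic {α} b cs
  ...   | ds , len′ , p≈ with split k ds (≡.trans len′ (ℕ.suc-injective len))
  ...     | αs , ds≈ = α ∷ αs , (begin
    C.monic (b ∷ cs) at y
      ≈⟨ p≈ ⟩
    (y - κ α) * (C.monic ds at y) + κ (C.monic (b ∷ cs) V.at α)
      ≈⟨ +-cong (*-congˡ ds≈) (trans (⟦⟧-cong root′) 0#-homo) ⟩
    (y - κ α) * Π αs + 0#
      ≈⟨ +-identityʳ _ ⟩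
    (y - κ α) * Π αs ∎)
    where
    root′ : C.monic (b ∷ cs) V.at α C.≈ C.0#
    root′ = ≡.subst (λ p → C.eval p α C.≈ C.0#) (≡.sym (List.map-id (C.monic (b ∷ cs)))) root

  -- A coefficient list may end in zeros, so the leading coefficient is sought from the far end with
  -- `_≟0`; dividing by it leaves a monic polynomial.
  leading : ∀ p z → p at z ≉ 0# → ∃[ b ] ∃[ cs ] b C.≉ C.0# × p at z ≈ κ b * (C.monic cs at z)
  leading p z p≉0 with normalise p
    where
    normalise : ∀ p → (p at z ≈ 0#) ⊎
      (∃[ b ] ∃[ cs ] b C.≉ C.0# × p at z ≈ κ b * (C.monic cs at z))
    normalise []      = inj₁ refl
    normalise (b ∷ p) with normalise p
    ... | inj₂ (d , cs , d≉0 , p≈) with C.inverse d d≉0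
    ...   | d′ , dd′≈1 = inj₂ (d , d′ C.* b ∷ cs , d≉0 , (begin
      κ b + z * (p at z)
        ≈⟨ +-cong (⟦⟧-cong (C.sym (C.trans (C.sym (C.*-assoc d d′ b))
             (C.trans (C.*-congʳ dd′≈1) (C.*-identityˡ b))))) (*-congˡ p≈) ⟩
      κ (d C.* (d′ C.* b)) + z * (κ d * (C.monic cs at z))
        ≈⟨ +-congʳ (*-homo d (d′ C.* b)) ⟩
      κ d * κ (d′ C.* b) + z * (κ d * (C.monic cs at z))
        ≈⟨ solve 4 (λ d b z q → d :* b :+ z :* (d :* q) := d :* (b :+ z :* q)) refl
             (κ d) (κ (d′ C.* b)) z (C.monic cs at z) ⟩
      κ d * (κ (d′ C.* b) + z * (C.monic cs at z)) ∎))
    normalise (b ∷ p) | inj₁ p≈0 with b ≟0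
    ...   | yes b≈0 = inj₁ (trans (+-cong (trans (⟦⟧-cong b≈0) 0#-homo) (*-congˡ p≈0))
                                  (trans (+-congˡ (zeroʳ z)) (+-identityˡ 0#)))
    ...   | no  b≉0 = inj₂ (b , [] , b≉0 , (begin
      κ b + z * (p at z)           ≈⟨ +-congˡ (*-congˡ p≈0) ⟩
      κ b + z * 0#
        ≈⟨ solve 2 (λ b z → b :+ z :* con 0ℤ := b :* (con 1ℤ :+ z :* con 0ℤ)) refl (κ b) z ⟩
      κ b * (1# + z * 0#)          ≈⟨ *-congˡ (+-congʳ 1#-homo) ⟨
      κ b * (κ C.1# + z * 0#)      ∎))
  ... | inj₁ p≈0 = contradiction p≈0 p≉0
  ... | inj₂ res = res

  clear-denominator : ∀ {w} → w ∈ C[x,x⁻¹] → ∃[ N ] x ^ N * w ∈ C[y]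
  clear-denominator (p , q , w≈) with clear q
    where
    clear : ∀ q → ∃[ N ] x ^ N * (q at x⁻¹) ∈ C[y]
    clear []      = 0 , C[y]-resp (sym (zeroʳ 1#)) 0∈
    clear (b ∷ q) with clear q
    ... | N , q∈ = suc N , C[y]-resp (begin
      x ^ suc N * κ b + x ^ N * (q at x⁻¹)
        ≈⟨ +-congˡ (*-identityˡ _) ⟨
      x ^ suc N * κ b + 1# * (x ^ N * (q at x⁻¹))
        ≈⟨ +-congˡ (*-congʳ xx⁻¹) ⟨
      x ^ suc N * κ b + x * x⁻¹ * (x ^ N * (q at x⁻¹))
        ≈⟨ solve 5 (λ x x′ X b q → (x :* X) :* b :+ (x :* x′) :* (X :* q) :=
             (x :* X) :* (b :+ x′ :* q)) refl x x⁻¹ (x ^ N) (κ b) (q at x⁻¹) ⟩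
      x ^ suc N * ((b ∷ q) at x⁻¹) ∎)
      (+∈ (*∈ (^∈ x∈C[y] (suc N)) (⟦⟧∈E[] b y)) q∈)
  ... | N , q∈ = N , C[y]-resp (trans (sym (distribˡ _ _ _)) (*-congˡ (sym w≈)))
    (+∈ (*∈ (^∈ x∈C[y] N) (at-∈C[y] x∈C[y] p)) q∈)

  -- One Horner step of `homogenise`. `X` and `Y` are the powers of `x` that clear the tail and the
  -- new coefficient `d`, `R` is the value of the tail at `z = P / t`, `T` and `Q` are the powers of
  -- `t` and `P` matching its degree, and `G` is the cofactor of `t` found so far.
  homogenise-step : ∀ X Y t T d z R P Q G → t * z ≈ P → X * (T * R) ≈ X * Q + t * G →
    Y * X * (t * T * (d + z * R)) ≈ Y * X * (P * Q) + t * (T * (X * (Y * d)) + Y * (P * G))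
  homogenise-step X Y t T d z R P Q G tz≈P eq = begin
      Y * X * (t * T * (d + z * R))
        ≈⟨ *-congˡ (distribˡ (t * T) d (z * R)) ⟩
      Y * X * (t * T * d + t * T * (z * R))
        ≈⟨ distribˡ (Y * X) _ _ ⟩
      Y * X * (t * T * d) + Y * X * (t * T * (z * R))
        ≈⟨ +-cong
             (solve 5 (λ Y X t T d → Y :* X :* (t :* T :* d) := t :* (T :* (X :* (Y :* d)))) refl Y X t T d)
             (trans (*-assoc Y X _) (*-congˡ (solve 5 (λ X t T z R →
               X :* (t :* T :* (z :* R)) := (t :* z) :* (X :* (T :* R))) refl X t T z R))) ⟩
      t * D + Y * ((t * z) * (X * (T * R)))
        ≈⟨ +-congˡ (*-congˡ (*-cong tz≈P eq)) ⟩
      t * D + Y * (P * (X * Q + t * G))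
        ≈⟨ +-congˡ (solve 5 (λ Y P Z t G → Y :* (P :* (Z :+ t :* G)) := Y :* (P :* Z) :+ t :* (Y :* (P :* G)))
             refl Y P (X * Q) t G) ⟩
      t * D + (Y * (P * (X * Q)) + t * (Y * (P * G)))
        ≈⟨ solve 4 (λ t D U V → t :* D :+ (U :+ t :* V) := U :+ t :* (D :+ V)) refl
             t D (Y * (P * (X * Q))) (Y * (P * G)) ⟩
      Y * (P * (X * Q)) + t * (D + Y * (P * G))
        ≈⟨ +-congʳ (solve 4 (λ Y P X Q → Y :* (P :* (X :* Q)) := Y :* X :* (P :* Q)) refl Y P X Q) ⟩
      Y * X * (P * Q) + t * (D + Y * (P * G)) ∎
    where D = T * (X * (Y * d))

  -- Substituting `z = P / t` in a monic polynomial of degree `k` and multiplying by `t ^ k` leaves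
  -- `P ^ k` plus terms divisible by `t`. The power of `x` moves the coefficients from `C[x,x⁻¹]`
  -- into `C[y]`.
  homogenise : ∀ {t z P} → t ∈ C[y] → P ∈ C[y] → t * z ≈ P → ∀ cs → All C[x,x⁻¹] cs →
    ∃[ N ] ∃[ G ] G ∈ C[y] ×
      x ^ N * (t ^ length cs * eval (monic cs) z) ≈ x ^ N * P ^ length cs + t * G
  homogenise {t} {z} {P} t∈ P∈ tz≈P [] [] = 0 , 0# , 0∈ , base
    where
    base : 1# * (1# * (1# + z * 0#)) ≈ 1# * 1# + t * 0#
    base = solve 2 (λ z t → con 1ℤ :* (con 1ℤ :* (con 1ℤ :+ z :* con 0ℤ)) := con 1ℤ :* con 1ℤ :+ t :* con 0ℤ) refl z t
  homogenise {t} {z} {P} t∈ P∈ tz≈P (d ∷ cs) (d∈ ∷ cs∈) =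
    go (clear-denominator d∈) (homogenise t∈ P∈ tz≈P cs cs∈)
    where
    T = t ^ length cs
    Q = P ^ length cs
    R = eval (monic cs) z

    go : ∃[ M ] x ^ M * d ∈ C[y] →
         ∃[ N ] ∃[ G ] G ∈ C[y] × x ^ N * (T * R) ≈ x ^ N * Q + t * G →
         ∃[ N ] ∃[ G ] G ∈ C[y] × x ^ N * (t * T * (d + z * R)) ≈ x ^ N * (P * Q) + t * G
    go (M , d∈′) (N , G , G∈ , eq) = M ℕ.+ N , G′ , G′∈ , (begin
      x ^ (M ℕ.+ N) * (t * T * (d + z * R))         ≈⟨ *-congʳ (^-homo-* x M N) ⟩
      x ^ M * x ^ N * (t * T * (d + z * R))
        ≈⟨ homogenise-step (x ^ N) (x ^ M) t T d z R P Q G tz≈P eq ⟩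
      x ^ M * x ^ N * (P * Q) + t * G′              ≈⟨ +-congʳ (*-congʳ (^-homo-* x M N)) ⟨
      x ^ (M ℕ.+ N) * (P * Q) + t * G′              ∎)
      where
      G′ : Carrier
      G′ = T * (x ^ N * (x ^ M * d)) + x ^ M * (P * G)

      G′∈ : G′ ∈ C[y]
      G′∈ = +∈ (*∈ (^∈ t∈ (length cs)) (*∈ (^∈ x∈C[y] N) d∈′)) (*∈ (^∈ x∈C[y] M) (*∈ P∈ G∈))

  -- An element of F with a pole at y = α, where x does not vanish, is not
  -- integral over C[x,x⁻¹].
  no-pole : ∀ {α z t P b} → z ∈ Cocycle → t ⇝⟨ α ⟩ C.0# → P ⇝⟨ α ⟩ b → t * z ≈ P →
            ξ α C.≉ C.0# → b C.≈ C.0#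
  no-pole {α} {z} {t} {P} {b} (cs , cs∈ , z≈) t⇝ P⇝ tz≈P ξ≉0 with b ≟0
  ... | yes b≈0 = b≈0
  ... | no  b≉0 = contradiction value≈0 (C.*-≉0 (C.^-≉0 ξ≉0 N) (C.^-≉0 b≉0 (length cs)))
    where
    homogeneous = homogenise (⇝⇒C[y] t⇝) (⇝⇒C[y] P⇝) tz≈P cs cs∈
    N = proj₁ homogeneous
    G = proj₁ (proj₂ homogeneous)
    g = C[y]⇒⇝ {α} (proj₁ (proj₂ (proj₂ homogeneous)))

    sum≈0 : x ^ N * P ^ length cs + t * G ≈ 0#
    sum≈0 = begin
      x ^ N * P ^ length cs + t * G                ≈⟨ proj₂ (proj₂ (proj₂ homogeneous)) ⟨
      x ^ N * (t ^ length cs * eval (monic cs) z)  ≈⟨ *-congˡ (*-congˡ z≈) ⟩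
      x ^ N * (t ^ length cs * 0#)                 ≈⟨ *-congˡ (zeroʳ (t ^ length cs)) ⟩
      x ^ N * 0#                                   ≈⟨ zeroʳ (x ^ N) ⟩
      0#                                           ∎

    -- At `y = α` the term `t * G` dies, and what remains is a product of powers of the nonzero
    -- `ξ α` and `b`.
    value≈0 : ξ α C.^ N C.* b C.^ length cs C.≈ C.0#
    value≈0 = ⇝-0 sum≈0 (⇝-respʳ
      (C.trans (C.+-congˡ (C.zeroˡ (proj₁ g))) (C.+-identityʳ (ξ α C.^ N C.* b C.^ length cs)))
      (⇝-+ (⇝-* (⇝-^ ⇝-x N) (⇝-^ P⇝ (length cs))) (⇝-* t⇝ (proj₂ g))))

  Π∈C[y] : ∀ αs → Π αs ∈ C[y]
  Π∈C[y] []       = 1∈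
  Π∈C[y] (α ∷ αs) = *∈ (+∈ (z∈E[z] y) (-∈ (⟦⟧∈E[] α y))) (Π∈C[y] αs)

  -- Removes the factors `y - κ α` of a denominator one by one. If `x` vanishes at `α`, then
  -- `x = (y - κ α) * x′`, and multiplying by `x′` trades the factor for one more power of `x`.
  -- Otherwise `no-pole` makes the numerator vanish at `α`, so the factor divides it.
  cancel-factors : ∀ {z} → z ∈ Cocycle → ∀ αs e → Π αs * (x ^ e * z) ∈ C[y] →
                   ∃[ e′ ] x ^ e′ * z ∈ C[y]
  cancel-factors {z} z∈ [] e P∈ = e , C[y]-resp (*-identityˡ (x ^ e * z)) P∈
  cancel-factors {z} z∈ (α ∷ αs) e P∈ = cases (ξ α ≟0)
    where
    l p X P : Carrier
    l = y - κ α
    p = Π αs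
    X = x ^ e
    P = l * p * (X * z)

    value : ∃[ b ] P ⇝⟨ α ⟩ b
    value = C[y]⇒⇝ P∈

    x-vanishes : ∃[ x′ ] x′ ∈ C[y] × x ≈ l * x′ → ∃[ e′ ] x ^ e′ * z ∈ C[y]
    x-vanishes (x′ , x′∈ , x≈) =
      cancel-factors z∈ αs (suc e) (C[y]-resp (*-cancelˡ-≉0 (y-κ α ≉0) (begin
        l * (x′ * P)          ≈⟨ *-assoc l x′ P ⟨
        l * x′ * P            ≈⟨ *-congʳ x≈ ⟨
        x * P
          ≈⟨ solve 5 (λ x l p X z → x :* (l :* p :* (X :* z)) := l :* (p :* (x :* X :* z))) refl x l p X z ⟩
        l * (p * (x * X * z)) ∎)) (*∈ x′∈ P∈))

    P-vanishes : ∃[ w ] w ∈ C[y] × P ≈ l * w → ∃[ e′ ] x ^ e′ * z ∈ C[y]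
    P-vanishes (w , w∈ , P≈) = cancel-factors z∈ αs e (C[y]-resp (*-cancelˡ-≉0 (y-κ α ≉0)
      (trans (sym P≈) (*-assoc l p (X * z)))) w∈)

    px∈ : ∃[ g ] p * X ⇝⟨ α ⟩ g
    px∈ = C[y]⇒⇝ (*∈ (Π∈C[y] αs) (^∈ x∈C[y] e))

    t⇝0 : l * p * X ⇝⟨ α ⟩ C.0#
    t⇝0 = ⇝-resp (sym (*-assoc l p X))
      (⇝-respʳ (C.trans (C.*-congʳ (C.-‿inverseʳ α)) (C.zeroˡ (proj₁ px∈)))
        (⇝-* (⇝-y-κ α) (proj₂ px∈)))

    cases : Dec (ξ α C.≈ C.0#) → ∃[ e′ ] x ^ e′ * z ∈ C[y]
    cases (yes ξ≈0) = x-vanishes (root⇒factor ⇝-x ξ≈0)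
    cases (no  ξ≉0) = P-vanishes (root⇒factor (proj₂ value)
      (no-pole z∈ t⇝0 (proj₂ value) (*-assoc (l * p) X z) ξ≉0))

  -- By `spanning`, `z` has a denominator `q ⟨ x ⟩`. As `x` lies in `C[y]`, this is a polynomial in
  -- `y`, which splits over the algebraically closed `C` into the factors that `cancel-factors`
  -- removes.
  Cocycle⇒C[y,x⁻¹] : ∀ {z} → z ∈ Cocycle → ∃[ e ] x ^ e * z ∈ C[y]
  Cocycle⇒C[y,x⁻¹] {z} z∈ = cancel-factors z∈ αs 0 (C[y]-resp rescale
      (*∈ (⟦⟧∈E[] b⁻¹ y) (C[y]-resp (sym qz≈)
        (sum∈ (λ j → *∈ (at-∈C[y] x∈C[y] (p j)) (^∈ (z∈E[z] y) (toℕ j)))))))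
    where
    q = proj₁ (spanning z)
    p = proj₁ (proj₂ (spanning z))
    q≉0 = proj₁ (proj₂ (proj₂ (spanning z)))
    qz≈ = proj₂ (proj₂ (proj₂ (spanning z)))

    Q = proj₁ (at-∈C[y] x∈C[y] q)
    q≈Q : q at x ≈ Q at y
    q≈Q = proj₂ (at-∈C[y] x∈C[y] q)

    lead : ∃[ b ] ∃[ cs ] b C.≉ C.0# × Q at y ≈ κ b * (C.monic cs at y)
    lead = leading Q y (λ Q≈0 → q≉0 (trans q≈Q Q≈0))
    b = proj₁ lead
    cs = proj₁ (proj₂ lead)
    b⁻¹ = proj₁ (C.inverse b (proj₁ (proj₂ (proj₂ lead))))
    bb⁻¹≈1 = proj₂ (C.inverse b (proj₁ (proj₂ (proj₂ lead))))

    factors : ∃[ αs ] C.monic cs at y ≈ Π αs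
    factors = split (length cs) cs ≡.refl
    αs = proj₁ factors

    rescale : κ b⁻¹ * (q at x * z) ≈ Π αs * (1# * z)
    rescale = begin
      κ b⁻¹ * (q at x * z)
        ≈⟨ *-congˡ (*-congʳ (trans q≈Q (trans (proj₂ (proj₂ (proj₂ lead))) (*-congˡ (proj₂ factors))))) ⟩
      κ b⁻¹ * (κ b * Π αs * z)
        ≈⟨ solve 4 (λ b⁻¹ b p z → b⁻¹ :* (b :* p :* z) := (b :* b⁻¹) :* (p :* (con 1ℤ :* z))) refl
             (κ b⁻¹) (κ b) (Π αs) z ⟩
      κ b * κ b⁻¹ * (Π αs * (1# * z))
        ≈⟨ *-congʳ (trans (sym (*-homo b b⁻¹)) (trans (⟦⟧-cong bb⁻¹≈1) 1#-homo)) ⟩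
      1# * (Π αs * (1# * z))
        ≈⟨ *-identityˡ (Π αs * (1# * z)) ⟩
      Π αs * (1# * z) ∎

  -- The constant term goes to `g`, so every term of the other part keeps a factor `x⁻¹`;
  -- `regular-at-infinity` spends it on the pole of `y ^ j`.
  laurent : ∀ e p → ∃[ g ] ∃[ h ] x⁻¹ ^ e * (p at x) ≈ g at x + x⁻¹ * (h at x⁻¹)
  laurent zero    p = p , [] , trans (*-identityˡ _)
    (sym (trans (+-congˡ (zeroʳ x⁻¹)) (+-identityʳ _)))
  laurent (suc e) p with laurent e p
  ... | [] , h , eq = [] , C.0# ∷ h , (begin
    x⁻¹ * x⁻¹ ^ e * (p at x)                   ≈⟨ trans (*-assoc _ _ _) (*-congˡ eq) ⟩
    x⁻¹ * (0# + x⁻¹ * (h at x⁻¹))              ≈⟨ *-congˡ (+-congʳ 0#-homo) ⟨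
    x⁻¹ * (κ C.0# + x⁻¹ * (h at x⁻¹))          ≈⟨ +-identityˡ _ ⟨
    0# + x⁻¹ * (κ C.0# + x⁻¹ * (h at x⁻¹))     ∎)
  ... | b ∷ g , h , eq = g , b ∷ h , (begin
    x⁻¹ * x⁻¹ ^ e * (p at x)
      ≈⟨ trans (*-assoc _ _ _) (*-congˡ eq) ⟩
    x⁻¹ * (κ b + x * (g at x) + x⁻¹ * (h at x⁻¹))
      ≈⟨ solve 5 (λ x′ b x g h → x′ :* (b :+ x :* g :+ x′ :* h) :=
           (x :* x′) :* g :+ x′ :* (b :+ x′ :* h)) refl x⁻¹ (κ b) x (g at x) (h at x⁻¹) ⟩
    x * x⁻¹ * (g at x) + x⁻¹ * (κ b + x⁻¹ * (h at x⁻¹))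
      ≈⟨ +-congʳ (trans (*-congʳ xx⁻¹) (*-identityˡ _)) ⟩
    g at x + x⁻¹ * (κ b + x⁻¹ * (h at x⁻¹))    ∎)

  -- A product of two basis powers has exponent below `2 * suc m`, so one use of the curve equation
  -- suffices.
  data Wraps (s : ℕ) : Set (c ⊔ ℓ) where
    below : s ℕ.< suc m → Wraps s
    above : ∀ k → k ℕ.< suc m → y ^ s ≈ (κ a + x) * y ^ k → Wraps s

  wraps : ∀ (i j : Fin (suc m)) → Wraps (toℕ i ℕ.+ toℕ j)
  wraps i j with toℕ i ℕ.+ toℕ j ℕ.<? suc m
  ... | yes s<n = below s<n
  ... | no  s≮n = above k k<n (begin
    y ^ s                  ≡⟨ ≡.cong (y ^_) (ℕ.m+[n∸m]≡n n≤s) ⟨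
    y ^ (suc m ℕ.+ k)      ≈⟨ ^-homo-* y (suc m) k ⟩
    y ^ suc m * y ^ k      ≈⟨ *-congʳ yⁿ≈a+x ⟩
    (κ a + x) * y ^ k      ∎)
    where
    s = toℕ i ℕ.+ toℕ j
    k = s ℕ.∸ suc m
    n≤s : suc m ℕ.≤ s
    n≤s = ℕ.≮⇒≥ s≮n
    k<n : k ℕ.< suc m
    k<n = ℕ.+-cancelˡ-< (suc m) k (suc m) (≡.subst (ℕ._< suc m ℕ.+ suc m)
      (≡.sym (ℕ.m+[n∸m]≡n n≤s)) (ℕ.+-mono-< (Fin.toℕ<n i) (Fin.toℕ<n j)))

  -- Since `y ^ suc m ≈ κ a + x`, the `C[x]`-span of the powers `y ^ j` with `j ≤ m` is closed under
  -- multiplication.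
  regular-at-finite : ∀ (g : Fin (suc m) → C.Poly) →
                      IntegralOver C[x] (sum (λ j → g j at x * y ^ toℕ j))
  regular-at-finite g = Span⇒Integral e refl e*e∈
      ((λ j → g j at x) , (λ j → g j , refl) , refl)
    where
    open Integrality (E[]-isSubring x)
    module A = IsSubring (E[]-isSubring x)

    e : Fin (suc m) → Carrier
    e j = y ^ toℕ j

    power∈ : ∀ {b} → b ∈ C[x] → ∀ {k} → k ℕ.< suc m → b * y ^ k ∈ Span e
    power∈ {b} b∈ k<n = ≡.subst (λ k → b * y ^ k ∈ Span e) (Fin.toℕ-fromℕ< k<n)
      (Span-basis e b∈ (fromℕ< k<n))

    e*e∈ : ∀ i j → e i * e j ∈ Span e
    e*e∈ i j with wraps i j
    ... | below s<n     = Span-resp e (trans (*-identityˡ _) (^-homo-* y (toℕ i) (toℕ j)))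
                            (power∈ A.1∈ s<n)
    ... | above k k<n yˢ≈ = Span-resp e (trans (sym yˢ≈) (^-homo-* y (toℕ i) (toℕ j)))
                            (power∈ (A.+∈ (⟦⟧∈E[] a x) (z∈E[z] x)) k<n)

  -- The `C[x⁻¹]`-span of `1, x⁻¹ y, …, x⁻¹ yᵐ` is a ring: when a product wraps around,
  -- `x⁻¹ * y ^ suc m = a x⁻¹ + 1` brings its coefficient back into `C[x⁻¹]`.
  regular-at-infinity : ∀ (h : Fin (suc m) → C.Poly) →
                        IntegralOver C[x⁻¹] (sum (λ j → x⁻¹ * (h j at x⁻¹) * y ^ toℕ j))
  regular-at-infinity h = Span⇒Integral e refl e*e∈
      (b , b∈ , +-cong refl (sum-cong-≋ (λ j →
        solve 3 (λ x′ h y → x′ :* h :* y := h :* (x′ :* y)) refl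
          x⁻¹ (h (Fin.suc j) at x⁻¹) (y ^ suc (toℕ j)))))
    where
    open Integrality (E[]-isSubring x⁻¹)
    module A = IsSubring (E[]-isSubring x⁻¹)

    e : Fin (suc m) → Carrier
    e 0F          = 1#
    e (Fin.suc j) = x⁻¹ * y ^ suc (toℕ j)

    b : Fin (suc m) → Carrier
    b 0F          = x⁻¹ * (h 0F at x⁻¹)
    b (Fin.suc j) = h (Fin.suc j) at x⁻¹

    b∈ : ∀ j → b j ∈ C[x⁻¹]
    b∈ 0F          = A.*∈ (z∈E[z] x⁻¹) (h 0F , refl)
    b∈ (Fin.suc j) = h (Fin.suc j) , refl

    power∈ : ∀ {b} → b ∈ C[x⁻¹] → ∀ {k} → k ℕ.< suc m → b * (x⁻¹ * y ^ k) ∈ Span e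
    -- For exponent zero, `x⁻¹` is not a basis element but a multiple of `e 0F`, so it joins the
    -- coefficient.
    power∈ {b} b∈ {zero}  k<n = Span-resp e (*-assoc b x⁻¹ 1#)
      (Span-basis e (A.*∈ b∈ (z∈E[z] x⁻¹)) 0F)
    power∈ {b} b∈ {suc k} (ℕ.s≤s k<m) = ≡.subst (λ k → b * (x⁻¹ * y ^ suc k) ∈ Span e)
      (Fin.toℕ-fromℕ< k<m) (Span-basis e b∈ (Fin.suc (fromℕ< k<m)))

    e*e∈ : ∀ i j → e i * e j ∈ Span e
    e*e∈ 0F          j  = Span-basis e A.1∈ j
    e*e∈ (Fin.suc i) 0F = Span-resp e (*-comm _ _) (Span-basis e A.1∈ (Fin.suc i))
    e*e∈ (Fin.suc i) (Fin.suc j) with wraps (Fin.suc i) (Fin.suc j)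
    ... | below s<n     = Span-resp e
      (trans (*-congˡ (*-congˡ (^-homo-* y (suc (toℕ i)) (suc (toℕ j)))))
        (solve 3 (λ x′ u v → x′ :* (x′ :* (u :* v)) := (x′ :* u) :* (x′ :* v)) refl
           x⁻¹ (y ^ suc (toℕ i)) (y ^ suc (toℕ j))))
      (power∈ (z∈E[z] x⁻¹) s<n)
    ... | above k k<n yˢ≈ = Span-resp e (begin
        (x⁻¹ * κ a + 1#) * (x⁻¹ * y ^ k)
          ≈⟨ *-congʳ (+-congˡ xx⁻¹) ⟨
        (x⁻¹ * κ a + x * x⁻¹) * (x⁻¹ * y ^ k)
          ≈⟨ solve 4 (λ x′ a x y → (x′ :* a :+ x :* x′) :* (x′ :* y) :=
               x′ :* (x′ :* ((a :+ x) :* y))) refl x⁻¹ (κ a) x (y ^ k) ⟩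
        x⁻¹ * (x⁻¹ * ((κ a + x) * y ^ k))
          ≈⟨ *-congˡ (*-congˡ (trans (sym yˢ≈) (^-homo-* y (suc (toℕ i)) (suc (toℕ j))))) ⟩
        x⁻¹ * (x⁻¹ * (y ^ suc (toℕ i) * y ^ suc (toℕ j)))
          ≈⟨ solve 3 (λ x′ u v → x′ :* (x′ :* (u :* v)) := (x′ :* u) :* (x′ :* v)) refl
           x⁻¹ (y ^ suc (toℕ i)) (y ^ suc (toℕ j)) ⟩
        e (Fin.suc i) * e (Fin.suc j) ∎)
      (power∈ (A.+∈ (A.*∈ (z∈E[z] x⁻¹) (⟦⟧∈E[] a x⁻¹)) A.1∈) k<n)

  x⁻ᵉ*xᵉ≈1 : ∀ e → x⁻¹ ^ e * x ^ e ≈ 1#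
  x⁻ᵉ*xᵉ≈1 zero    = *-identityˡ 1#
  x⁻ᵉ*xᵉ≈1 (suc e) = begin
    x⁻¹ * x⁻¹ ^ e * (x * x ^ e)
      ≈⟨ solve 4 (λ x′ u x v → x′ :* u :* (x :* v) := x :* x′ :* (u :* v)) refl x⁻¹ (x⁻¹ ^ e) x (x ^ e) ⟩
    x * x⁻¹ * (x⁻¹ ^ e * x ^ e)  ≈⟨ *-cong xx⁻¹ (x⁻ᵉ*xᵉ≈1 e) ⟩
    1# * 1#                      ≈⟨ *-identityˡ 1# ⟩
    1#                           ∎

  Cocycle⇒Coboundary : ∀ {z} → z ∈ Cocycle → z ∈ Coboundary
  Cocycle⇒Coboundary {z} z∈ =
    sum (λ j → g j at x * y ^ toℕ j) , sum (λ j → x⁻¹ * (h j at x⁻¹) * y ^ toℕ j) ,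
    regular-at-finite g , regular-at-infinity h , (begin
      z                            ≈⟨ *-identityˡ z ⟨
      1# * z                       ≈⟨ *-congʳ (x⁻ᵉ*xᵉ≈1 e) ⟨
      x⁻¹ ^ e * x ^ e * z          ≈⟨ *-assoc (x⁻¹ ^ e) (x ^ e) z ⟩
      x⁻¹ ^ e * (x ^ e * z)        ≈⟨ *-congˡ (proj₂ (proj₂ cleared)) ⟩
      x⁻¹ ^ e * (p at y)           ≈⟨ *-congˡ (at-component constants yⁿ≈a+x p) ⟩
      x⁻¹ ^ e * sum (λ j → q j at x * y ^ toℕ j)
        ≈⟨ *-distribˡ-sum (x⁻¹ ^ e) (λ j → q j at x * y ^ toℕ j) ⟩
      sum (λ j → x⁻¹ ^ e * (q j at x * y ^ toℕ j))
        ≈⟨ sum-cong-≋ (λ j → trans (sym (*-assoc (x⁻¹ ^ e) (q j at x) (y ^ toℕ j)))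
                                   (*-congʳ (proj₂ (proj₂ (laurent e (q j)))))) ⟩
      sum (λ j → (g j at x + x⁻¹ * (h j at x⁻¹)) * y ^ toℕ j)
        ≈⟨ sum-+ (λ j → g j at x) (λ j → x⁻¹ * (h j at x⁻¹)) (λ j → y ^ toℕ j) ⟩
      sum (λ j → g j at x * y ^ toℕ j) + sum (λ j → x⁻¹ * (h j at x⁻¹) * y ^ toℕ j) ∎)
    where
    open Integrality (E[]-isSubring x) using (sum-+)

    cleared : ∃[ e ] x ^ e * z ∈ C[y]
    cleared = Cocycle⇒C[y,x⁻¹] z∈
    e = proj₁ cleared
    p = proj₁ (proj₂ cleared)

    q g h : Fin (suc m) → C.Poly
    q   = component p
    g j = proj₁ (laurent e (q j))
    h j = proj₁ (proj₂ (laurent e (q j)))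

  -- With coefficients `(1, 0, …, 0)` the single coboundary `h 0F` is already a relation in a family
  -- supposed independent.
  genus≯0 : ∀ {g} → HasGenus g → ¬ 0 ℕ.< g
  genus≯0 {suc g} ((h , h∈ , independent-h) , _) _ = C.1≉0 (independent-h b
    (Coboundary-resp b∙h≈ (Cocycle⇒Coboundary (h∈ 0F))) 0F)
    where
    b : Fin (suc g) → C.Carrier
    b 0F          = C.1#
    b (Fin.suc _) = C.0#

    Coboundary-resp : ∀ {z w} → z ≈ w → z ∈ Coboundary → w ∈ Coboundary
    Coboundary-resp z≈w (u , v , u∈ , v∈ , z≈) = u , v , u∈ , v∈ , trans (sym z≈w) z≈

    b∙h≈ : h 0F ≈ sum (λ i → κ (b i) * h i)
    b∙h≈ = sym (trans
      (+-cong (trans (*-congʳ 1#-homo) (*-identityˡ (h 0F)))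
        (trans (sum-cong-≋ {g} (λ i → trans (*-congʳ 0#-homo) (zeroˡ (h (Fin.suc i)))))
               (Sum.sum-replicate-zero +-commutativeMonoid g)))
      (+-identityʳ (h 0F)))

-- Integers extended by infinities.

module ℤ⁺ where
  open AddSupremum ℤ._≤_ hiding ([_]; _≤⊤⁺)

  ≤-refl : ∀ {u} → u ≤ℤ⁺ u
  ≤-refl = ≤⁺-reflexive-≡ ℤ.≤-reflexive ≡.refl

  ≤-reflexive : ∀ {u w} → u ≡ w → u ≤ℤ⁺ w
  ≤-reflexive ≡.refl = ≤-refl

  ≤-trans : ∀ {u w z} → u ≤ℤ⁺ w → w ≤ℤ⁺ z → u ≤ℤ⁺ z
  ≤-trans = ≤⁺-trans ℤ.≤-trans

  ≤-antisym : ∀ {u w} → u ≤ℤ⁺ w → w ≤ℤ⁺ u → u ≡ w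
  ≤-antisym = ≤⁺-antisym-≡ ℤ.≤-antisym

  ≤-total : ∀ u w → u ≤ℤ⁺ w ⊎ w ≤ℤ⁺ u
  ≤-total = ≤⁺-total ℤ.≤-total

  _≤?_ : ∀ u w → Dec (u ≤ℤ⁺ w)
  _≤?_ = ≤⁺-dec ℤ._≤?_

  +-monoˡ-≤ : ∀ {u w} z → u ≤ℤ⁺ w → add⁺ ℤ._+_ u z ≤ℤ⁺ add⁺ ℤ._+_ w z
  +-monoˡ-≤ ∞     [ p ]    = ∞ ≤⊤⁺
  +-monoˡ-≤ [ k ] [ p ]    = [ ℤ.+-monoˡ-≤ k p ]
  +-monoˡ-≤ ∞     (_ ≤⊤⁺)  = _ ≤⊤⁺
  +-monoˡ-≤ [ k ] (_ ≤⊤⁺)  = _ ≤⊤⁺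

module ℤ± where
  private module E = AddExtrema ℤ._≤_
  open E hiding ([_]; ≤±-minimum)

  ⊥≤ : ∀ u → ⊥± ≤ℤ± u
  ⊥≤ = E.≤±-minimum

  ≤-refl : ∀ {u} → u ≤ℤ± u
  ≤-refl = ≤±-reflexive-≡ ℤ.≤-reflexive ≡.refl

  ≤-trans : ∀ {u w z} → u ≤ℤ± w → w ≤ℤ± z → u ≤ℤ± z
  ≤-trans = ≤±-trans ℤ.≤-trans

  ≤-antisym : ∀ {u w} → u ≤ℤ± w → w ≤ℤ± u → u ≡ w
  ≤-antisym = ≤±-antisym-≡ ℤ.≤-antisym

  ≤-total : ∀ u w → u ≤ℤ± w ⊎ w ≤ℤ± u
  ≤-total = ≤±-total ℤ.≤-total

  lift : ℤ ⁺ → ℤ ±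
  lift = Maybe.map [_]

  lift-injective : ∀ {u w} → lift u ≡ lift w → u ≡ w
  lift-injective {∞}     {∞}     _      = ≡.refl
  lift-injective {[ _ ]} {[ _ ]} ≡.refl = ≡.refl

  lift-≤ : ∀ {u w} → u ≤ℤ⁺ w → lift u ≤ℤ± lift w
  lift-≤ [ p ]   = E.[ p ]
  lift-≤ (k ≤⊤⁺) = E.≤±-maximum (lift k)

  drop-lift : ∀ {u w} → lift u ≤ℤ± lift w → u ≤ℤ⁺ w
  drop-lift {u}     {∞}     _ = u ≤⊤⁺
  drop-lift {∞}     {[ _ ]} ()
  drop-lift {[ _ ]} {[ _ ]} p = [ [≤]-injective p ]

  lift≢⊥ : ∀ u → lift u ≢ ⊥±
  lift≢⊥ ∞     ()
  lift≢⊥ [ _ ] ()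

-- The valuation of K and its valuation ring.

module DVRProperties {c ℓ} (R : CompleteDVR c ℓ) where
  open CompleteDVR R
  open FieldProperties K

  v-finite : ∀ {x} → x ≉ 0# → ∃[ i ] v x ≡ [ i ]
  v-finite {x} x≉0 with v x in eq
  ... | [ i ] = i , ≡.refl
  ... | ∞     = contradiction (Equivalence.to (v-∞ x) eq) x≉0

  finite⇒≉0 : ∀ {x i} → v x ≡ [ i ] → x ≉ 0#
  finite⇒≉0 {x} vx x≈0 with () ← ≡.trans (≡.sym vx) (Equivalence.from (v-∞ x) x≈0)

  -- The value `v x` is data, and it is `⊤⁺` exactly when `x` vanishes.
  _≟0 : ∀ x → Dec (x ≈ 0#)
  x ≟0 with v x in eq
  ... | ∞     = yes (Equivalence.to (v-∞ x) eq)
  ... | [ i ] = no (finite⇒≉0 eq)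

  _≟_ : ∀ x y → Dec (x ≈ y)
  x ≟ y = Dec.map′ x-y≈0⇒x≈y x≈y⇒x-y≈0 ((x - y) ≟0)

  v-1 : v 1# ≡ [ 0ℤ ]
  v-1 with v-finite 1≉0
  ... | i , v1 = ≡.trans v1 (≡.cong [_] (identityʳ-unique i i ([]-injective (≡.trans
    (≡.sym (≡.trans (v-* 1# 1#) (≡.cong₂ (add⁺ ℤ._+_) v1 v1)))
    (≡.trans (v-cong (*-identityˡ 1#)) v1)))))
    where open AbelianGroupProperties ℤ.+-0-abelianGroup using (identityʳ-unique)

  -- The square of `- 1#` is `1#`, so twice its value is zero, and ℤ has no torsion.
  v-neg-1 : v (- 1#) ≡ [ 0ℤ ]
  v-neg-1 with v-finite {x = - 1#} (λ e → 1≉0 (trans (solve 0 (con 1ℤ := :- (:- con 1ℤ)) refl)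
                 (trans (-‿cong e) (solve 0 (:- con 0ℤ := con 0ℤ) refl))))
  ... | i , v-1′ = ≡.trans v-1′ (≡.cong [_] (i+i≡0⇒i≡0 i ([]-injective (≡.trans
    (≡.sym (≡.trans (v-* (- 1#) (- 1#)) (≡.cong₂ (add⁺ ℤ._+_) v-1′ v-1′)))
    (≡.trans (v-cong (solve 0 (:- con 1ℤ :* :- con 1ℤ := con 1ℤ) refl)) v-1)))))
    where
    i+i≡0⇒i≡0 : ∀ i → i ℤ.+ i ≡ 0ℤ → i ≡ 0ℤ
    i+i≡0⇒i≡0 (+ zero) _ = ≡.refl

  add⁺-identityˡ : ∀ u → add⁺ ℤ._+_ [ 0ℤ ] u ≡ u
  add⁺-identityˡ ∞     = ≡.refl
  add⁺-identityˡ [ i ] = ≡.cong [_] (ℤ.+-identityˡ i)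

  v-neg : ∀ x → v (- x) ≡ v x
  v-neg x = ≡.trans (v-cong (solve 1 (λ x → :- x := :- con 1ℤ :* x) refl x))
    (≡.trans (v-* (- 1#) x) (≡.trans (≡.cong (λ u → add⁺ ℤ._+_ u (v x)) v-neg-1)
      (add⁺-identityˡ (v x))))

  v-swap : ∀ x y → v (x - y) ≡ v (y - x)
  v-swap x y = ≡.trans (v-cong (solve 2 (λ x y → x :- y := :- (y :- x)) refl x y)) (v-neg (y - x))

  ultrametric : ∀ x y z {γ} → γ ≤ℤ⁺ v (x - y) → γ ≤ℤ⁺ v (y - z) → γ ≤ℤ⁺ v (x - z)
  ultrametric x y z {γ} p q = ≡.subst (γ ≤ℤ⁺_)
    (v-cong (solve 3 (λ x y z → (x :- y) :+ (y :- z) := x :- z) refl x y z))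
    (v-+ (x - y) (y - z) γ p q)

  𝒪-isSubring : IsSubring K 𝒪
  𝒪-isSubring = record
    { resp = λ x≈y x∈ → ≡.subst ([ 0ℤ ] ≤ℤ⁺_) (v-cong x≈y) x∈
    ; 0∈   = ≡.subst ([ 0ℤ ] ≤ℤ⁺_) (≡.sym (Equivalence.from (v-∞ 0#) refl)) (_ ≤⊤⁺)
    ; 1∈   = ℤ⁺.≤-reflexive (≡.sym v-1)
    ; +∈   = v-+ _ _ _
    ; *∈   = λ {x} {y} x∈ y∈ → ℤ⁺.≤-trans y∈ (≡.subst₂ _≤ℤ⁺_ (add⁺-identityˡ (v y))
               (≡.sym (v-* x y)) (ℤ⁺.+-monoˡ-≤ (v y) x∈))
    ; -∈   = λ {x} x∈ → ≡.subst ([ 0ℤ ] ≤ℤ⁺_) (≡.sym (v-neg x)) x∈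
    }

  quotient∈𝒪 : ∀ {d e x} → d * e ≈ 1# → v d ≤ℤ⁺ v x → x * e ∈ 𝒪
  quotient∈𝒪 {d} {e} {x} de≈1 d≤x = ≡.subst₂ _≤ℤ⁺_
    (≡.trans (≡.sym (v-* d e)) (≡.trans (v-cong de≈1) v-1)) (≡.sym (v-* x e))
    (ℤ⁺.+-monoˡ-≤ (v e) d≤x)

  -- The values of `x` and `y` are nonnegative and add up to zero.
  unit⇒v≡0 : ∀ {x y} → x ∈ 𝒪 → y ∈ 𝒪 → x * y ≈ 1# → v x ≡ [ 0ℤ ]
  unit⇒v≡0 {x} {y} x∈ y∈ xy≈1 = ℤ⁺.≤-antisym
    (≡.subst₂ _≤ℤ⁺_ (add⁺-identityˡ (v x))
      (≡.trans (≡.sym (v-* y x)) (≡.trans (v-cong (trans (*-comm y x) xy≈1)) v-1))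
      (ℤ⁺.+-monoˡ-≤ (v x) y∈))
    x∈

  v-unit-* : ∀ {x} z → v x ≡ [ 0ℤ ] → v (x * z) ≡ v z
  v-unit-* {x} z vx = ≡.trans (v-* x z)
    (≡.trans (≡.cong (λ u → add⁺ ℤ._+_ u (v z)) vx) (add⁺-identityˡ (v z)))

-- Möbius matrices up to PGL₂(𝒪).

module Moebius {κ ℓ} (𝒞 : SuperellipticCurve κ ℓ) where
  open Curve 𝒞
  open DVRProperties dvr
  open FieldProperties K
  open IsSubring 𝒪-isSubring
  open SetoidReasoning setoid

  -- Equality in PGL₂(K) up to left multiplication by PGL₂(𝒪).
  infix 4 _≃_
  _≃_ : Mat → Mat → Set (κ ⊔ ℓ)
  M ≃ N = ∃[ A ] A ∈ GL₂ 𝒪 × ∃[ k ] k ≉ 0# × A ∙ M ≈ₘ k • N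

  private
    𝒪-∙ : ∀ {M N} → EntriesIn 𝒪 M → EntriesIn 𝒪 N → EntriesIn 𝒪 (M ∙ N)
    𝒪-∙ (a , b , c , d) (a′ , b′ , c′ , d′) =
      +∈ (*∈ a a′) (*∈ b c′) , +∈ (*∈ a b′) (*∈ b d′) ,
      +∈ (*∈ c a′) (*∈ d c′) , +∈ (*∈ c b′) (*∈ d d′)

  ≃-trans : ∀ {M N P} → M ≃ N → N ≃ P → M ≃ P
  ≃-trans {M} {N} {P} (A , (A∈ , A⁻ , A⁻∈ , AA⁻ , A⁻A) , k , k≉0 , AM)
                      (B , (B∈ , B⁻ , B⁻∈ , BB⁻ , B⁻B) , l , l≉0 , BN) =
    B ∙ A , (𝒪-∙ B∈ A∈ , A⁻ ∙ B⁻ , 𝒪-∙ A⁻∈ B⁻∈ , inner-cancel AA⁻ BB⁻ , inner-cancel B⁻B A⁻A) ,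
    k * l , *-≉0 k≉0 l≉0 ,
    ≈ₘ-trans (∙-assoc B A M) (≈ₘ-trans (∙-cong ≈ₘ-refl AM) (≈ₘ-trans (∙-•-comm B k N)
      (≈ₘ-trans (•-cong refl BN) (≈ₘ-sym (•-assoc k l P)))))

  ≃-sym : ∀ {M N} → M ≃ N → N ≃ M
  ≃-sym {M} {N} (A , (A∈ , A⁻ , A⁻∈ , AA⁻ , A⁻A) , k , k≉0 , AM) with inverse k k≉0
  ... | l , kl≈1 = A⁻ , (A⁻∈ , A , A∈ , A⁻A , AA⁻) , l , factorˡ≉0 lk≈1 ,
    ≈ₘ-trans (∙-cong ≈ₘ-refl N≈lAM) (≈ₘ-trans (∙-•-comm A⁻ l (A ∙ M)) (•-cong refl
      (≈ₘ-trans (≈ₘ-sym (∙-assoc A⁻ A M)) (≈ₘ-trans (∙-cong A⁻A ≈ₘ-refl) (∙-identityˡ M)))))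
    where
    lk≈1 : l * k ≈ 1#
    lk≈1 = trans (*-comm l k) kl≈1

    N≈lAM : N ≈ₘ l • (A ∙ M)
    N≈lAM = ≈ₘ-sym (≈ₘ-trans (•-cong refl AM) (≈ₘ-trans (≈ₘ-sym (•-assoc l k N))
      (≈ₘ-trans (•-cong lk≈1 ≈ₘ-refl) (•-identity N))))

  ≃-refl : ∀ {M} → M ≃ M
  ≃-refl {M} = I , (I∈ , I , I∈ , ∙-identityˡ I , ∙-identityˡ I) , 1# , 1≉0 ,
    ≈ₘ-trans (∙-identityˡ M) (≈ₘ-sym (•-identity M))
    where
    I∈ : EntriesIn 𝒪 I
    I∈ = 1∈ , 0∈ , 0∈ , 1∈

  -- x ↦ (x - 1)/x permutes 0, 1, ∞ cyclically.
  private
    ρ ρ⁻¹ : Mat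
    ρ   = mat 1# (- 1#) 1# 0#
    ρ⁻¹ = mat 0# 1# (- 1#) 1#

    ρ∈GL₂ : ρ ∈ GL₂ 𝒪
    ρ∈GL₂ = (1∈ , -∈ 1∈ , 1∈ , 0∈) , ρ⁻¹ , (0∈ , 1∈ , -∈ 1∈ , 1∈) ,
      mat≈ (solve 0 (con 1ℤ :* con 0ℤ :+ (:- con 1ℤ) :* (:- con 1ℤ) := con 1ℤ) refl)
           (solve 0 (con 1ℤ :* con 1ℤ :+ (:- con 1ℤ) :* con 1ℤ := con 0ℤ) refl)
           (solve 0 (con 1ℤ :* con 0ℤ :+ con 0ℤ :* (:- con 1ℤ) := con 0ℤ) refl)
           (solve 0 (con 1ℤ :* con 1ℤ :+ con 0ℤ :* con 1ℤ := con 1ℤ) refl) ,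
      mat≈ (solve 0 (con 0ℤ :* con 1ℤ :+ con 1ℤ :* con 1ℤ := con 1ℤ) refl)
           (solve 0 (con 0ℤ :* (:- con 1ℤ) :+ con 1ℤ :* con 0ℤ := con 0ℤ) refl)
           (solve 0 ((:- con 1ℤ) :* con 1ℤ :+ con 1ℤ :* con 1ℤ := con 0ℤ) refl)
           (solve 0 ((:- con 1ℤ) :* (:- con 1ℤ) :+ con 1ℤ :* con 0ℤ := con 1ℤ) refl)

    -1≉0 : - 1# ≉ 0#
    -1≉0 = finite⇒≉0 v-neg-1

  -- `ρ` sends `1, ∞, 0` to `0, 1, ∞`, so after it `Q, R, P` are the preimages of `0, 1, ∞`. The
  -- scalar, `- 1#` or `1#` according to the position of `∞`, only reflects how the matrices are
  -- normalised.
  möbius-rotate : ∀ P Q R → P ≉ℙ Q → Q ≉ℙ R → P ≉ℙ R → möbius P Q R ≃ möbius Q R P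
  möbius-rotate [ a ] [ b ] [ c ] _ _ _ = ρ , ρ∈GL₂ , - 1# , -1≉0 , mat≈
    (solve 3 (λ a b c → con 1ℤ :* (b :- c) :+ (:- con 1ℤ) :* (b :- a) :=
       (:- con 1ℤ) :* (c :- a)) refl a b c)
    (solve 3 (λ a b c → con 1ℤ :* (:- ((b :- c) :* a)) :+ (:- con 1ℤ) :* (:- ((b :- a) :* c)) :=
       (:- con 1ℤ) :* (:- ((c :- a) :* b))) refl a b c)
    (solve 3 (λ a b c → con 1ℤ :* (b :- c) :+ con 0ℤ :* (b :- a) :=
       (:- con 1ℤ) :* (c :- b)) refl a b c)
    (solve 3 (λ a b c → con 1ℤ :* (:- ((b :- c) :* a)) :+ con 0ℤ :* (:- ((b :- a) :* c)) :=
       (:- con 1ℤ) :* (:- ((c :- b) :* a))) refl a b c)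
  möbius-rotate ∞ [ b ] [ c ] _ _ _ = ρ , ρ∈GL₂ , - 1# , -1≉0 , mat≈
    (solve 0 (con 1ℤ :* con 0ℤ :+ (:- con 1ℤ) :* con 1ℤ := (:- con 1ℤ) :* con 1ℤ) refl)
    (solve 2 (λ b c → con 1ℤ :* (b :- c) :+ (:- con 1ℤ) :* (:- c) := (:- con 1ℤ) :* (:- b)) refl b c)
    (solve 0 (con 1ℤ :* con 0ℤ :+ con 0ℤ :* con 1ℤ := (:- con 1ℤ) :* con 0ℤ) refl)
    (solve 2 (λ b c → con 1ℤ :* (b :- c) :+ con 0ℤ :* (:- c) := (:- con 1ℤ) :* (c :- b)) refl b c)
  möbius-rotate [ a ] ∞ [ c ] _ _ _ = ρ , ρ∈GL₂ , 1# , 1≉0 , mat≈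
    (solve 0 (con 1ℤ :* con 1ℤ :+ (:- con 1ℤ) :* con 1ℤ := con 1ℤ :* con 0ℤ) refl)
    (solve 2 (λ a c → con 1ℤ :* (:- a) :+ (:- con 1ℤ) :* (:- c) := con 1ℤ :* (c :- a)) refl a c)
    (solve 0 (con 1ℤ :* con 1ℤ :+ con 0ℤ :* con 1ℤ := con 1ℤ :* con 1ℤ) refl)
    (solve 2 (λ a c → con 1ℤ :* (:- a) :+ con 0ℤ :* (:- c) := con 1ℤ :* (:- a)) refl a c)
  möbius-rotate [ a ] [ b ] ∞ _ _ _ = ρ , ρ∈GL₂ , 1# , 1≉0 , mat≈
    (solve 0 (con 1ℤ :* con 1ℤ :+ (:- con 1ℤ) :* con 0ℤ := con 1ℤ :* con 1ℤ) refl)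
    (solve 2 (λ a b → con 1ℤ :* (:- a) :+ (:- con 1ℤ) :* (b :- a) := con 1ℤ :* (:- b)) refl a b)
    (solve 0 (con 1ℤ :* con 1ℤ :+ con 0ℤ :* con 0ℤ := con 1ℤ :* con 1ℤ) refl)
    (solve 2 (λ a b → con 1ℤ :* (:- a) :+ con 0ℤ :* (b :- a) := con 1ℤ :* (:- a)) refl a b)
  möbius-rotate ∞     ∞     _ P≉Q _ _ = contradiction ∙≈∙ P≉Q
  möbius-rotate _     ∞     ∞ _ Q≉R _ = contradiction ∙≈∙ Q≉R
  möbius-rotate ∞     _     ∞ _ _ P≉R = contradiction ∙≈∙ P≉R

  ≉ℙ-sym : ∀ {P Q} → P ≉ℙ Q → Q ≉ℙ P
  ≉ℙ-sym P≉Q Q≈P = P≉Q (AddPointEquality.≈∙-sym _≈_ sym Q≈P)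

  rotate : Triple → Triple
  rotate t = record
    { a = b ; b = c ; c = a ; a∈S = b∈S ; b∈S = c∈S ; c∈S = a∈S
    ; a≉b = b≉c ; b≉c = ≉ℙ-sym a≉c ; a≉c = ≉ℙ-sym a≉b }
    where open Triple t

  rotate-∼ : ∀ t → t ∼ rotate t
  rotate-∼ t = möbius-rotate a b c a≉b b≉c a≉c
    where open Triple t

  v⟨⟩-swap : ∀ P Q → v⟨ P - Q ⟩ ≡ v⟨ Q - P ⟩
  v⟨⟩-swap ∞     ∞     = ≡.refl
  v⟨⟩-swap ∞     [ _ ] = ≡.refl
  v⟨⟩-swap [ _ ] ∞     = ≡.refl
  v⟨⟩-swap [ x ] [ y ] = ≡.cong ℤ±.lift (v-swap x y)

  -- If one of the points is `∞`, some hypothesis already reads `γ ≤ ⊥±`, and `⊥±` lies below every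
  -- value.
  v⟨⟩-ultrametric : ∀ P Q R {γ} → γ ≤ℤ± v⟨ P - Q ⟩ → γ ≤ℤ± v⟨ Q - R ⟩ → γ ≤ℤ± v⟨ P - R ⟩
  v⟨⟩-ultrametric [ x ] [ y ] [ z ] {⊥±}    _ _ = ℤ±.⊥≤ _
  v⟨⟩-ultrametric [ x ] [ y ] [ z ] {∞}     p q =
    ℤ±.lift-≤ (ultrametric x y z {∞} (ℤ±.drop-lift p) (ℤ±.drop-lift q))
  v⟨⟩-ultrametric [ x ] [ y ] [ z ] {[ [ i ] ]} p q =
    ℤ±.lift-≤ (ultrametric x y z {[ i ]} (ℤ±.drop-lift p) (ℤ±.drop-lift q))
  v⟨⟩-ultrametric ∞     Q     R     p _ = ℤ±.≤-trans p (ℤ±.⊥≤ _)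
  v⟨⟩-ultrametric [ _ ] ∞     R     p _ = ℤ±.≤-trans p (ℤ±.⊥≤ _)
  v⟨⟩-ultrametric [ _ ] [ _ ] ∞     _ q = q

  -- Ultrametric triangles are isosceles: next to the largest value `v⟨ a - b ⟩`, each of the other
  -- two bounds the other from below.
  closest⇒ordered : ∀ t → let open Triple t in
    v⟨ b - c ⟩ ≤ℤ± v⟨ a - b ⟩ → v⟨ a - c ⟩ ≤ℤ± v⟨ a - b ⟩ → Ordered t
  closest⇒ordered t bc≤ab ac≤ab = ℤ±.≤-antisym
      (v⟨⟩-ultrametric b a c (≡.subst (v⟨ a - c ⟩ ≤ℤ±_) (v⟨⟩-swap a b) ac≤ab) ℤ±.≤-refl)
      (v⟨⟩-ultrametric a b c bc≤ab ℤ±.≤-refl)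
    , bc≤ab
    where open Triple t

  ordered-representative : ∀ t → ∃[ t′ ] t′ ∼ t × Ordered t′
  ordered-representative t = helper
    (ℤ±.≤-total v⟨ a - b ⟩ v⟨ b - c ⟩) (ℤ±.≤-total v⟨ a - b ⟩ v⟨ a - c ⟩)
    (ℤ±.≤-total v⟨ b - c ⟩ v⟨ a - c ⟩)
    where
    open Triple t

    Representative : Set (κ ⊔ ℓ)
    Representative = ∃[ t′ ] t′ ∼ t × Ordered t′

    bc-closest : v⟨ a - b ⟩ ≤ℤ± v⟨ b - c ⟩ → v⟨ a - c ⟩ ≤ℤ± v⟨ b - c ⟩ → Representative
    bc-closest ab≤bc ac≤bc = t₁ , ∼-sym {t} {t₁} (rotate-∼ t) ,
      closest⇒ordered t₁ (≡.subst (_≤ℤ± v⟨ b - c ⟩) (v⟨⟩-swap a c) ac≤bc)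
                         (≡.subst (_≤ℤ± v⟨ b - c ⟩) (v⟨⟩-swap a b) ab≤bc)
      where t₁ = rotate t

    ac-closest : v⟨ a - b ⟩ ≤ℤ± v⟨ a - c ⟩ → v⟨ b - c ⟩ ≤ℤ± v⟨ a - c ⟩ → Representative
    ac-closest ab≤ac bc≤ac =
      t₂ , ∼-sym {t} {t₂} (∼-trans {t} {t₁} {t₂} (rotate-∼ t) (rotate-∼ t₁)) ,
      closest⇒ordered t₂ (≡.subst (v⟨ a - b ⟩ ≤ℤ±_) (v⟨⟩-swap a c) ab≤ac)
                         (≡.subst₂ _≤ℤ±_ (v⟨⟩-swap b c) (v⟨⟩-swap a c) bc≤ac)
      where
      t₁ = rotate t
      t₂ = rotate t₁

    helper : v⟨ a - b ⟩ ≤ℤ± v⟨ b - c ⟩ ⊎ v⟨ b - c ⟩ ≤ℤ± v⟨ a - b ⟩ →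
             v⟨ a - b ⟩ ≤ℤ± v⟨ a - c ⟩ ⊎ v⟨ a - c ⟩ ≤ℤ± v⟨ a - b ⟩ →
             v⟨ b - c ⟩ ≤ℤ± v⟨ a - c ⟩ ⊎ v⟨ a - c ⟩ ≤ℤ± v⟨ b - c ⟩ → Representative
    helper (inj₂ bc≤ab) (inj₂ ac≤ab) _            = t , ∼-refl {t} , closest⇒ordered t bc≤ab ac≤ab
    helper (inj₂ bc≤ab) (inj₁ ab≤ac) _            = ac-closest ab≤ac (ℤ±.≤-trans bc≤ab ab≤ac)
    helper (inj₁ ab≤bc) _            (inj₁ bc≤ac) = ac-closest (ℤ±.≤-trans ab≤bc bc≤ac) bc≤ac
    helper (inj₁ ab≤bc) _            (inj₂ ac≤bc) = bc-closest ab≤bc ac≤bc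

  -- This is `möbius [ x ] [ y ] ∞`. As `∞` need not lie in `S`, it is in general not the `φ` of a
  -- triple, which is why `_≃_` is a relation between matrices.
  affine : Carrier → Carrier → Mat
  affine x y = mat 1# (- x) 0# (y - x)

  -- In the affine coordinate `w`, the Möbius map is `u w / (ε w + 1)`, whose pole is the coordinate
  -- of `z`. The ordering makes `u = (y - z) / (x - z)` a unit and `ε = (y - x) / (x - z)` integral,
  -- so the lower triangular `A` and its inverse have entries in `𝒪`.
  möbius≃affine : ∀ {x y z} → v (x - z) ≡ v (y - z) → v (y - z) ≤ℤ⁺ v (x - y) → x ≉ z → y ≉ z →
                  möbius [ x ] [ y ] [ z ] ≃ affine x y
  möbius≃affine {x} {y} {z} xz≡yz yz≤xy x≉z y≉z
    with inverse (x - z) (x≉z ∘ x-y≈0⇒x≈y) | inverse (y - z) (y≉z ∘ x-y≈0⇒x≈y)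
  ... | p , p≈ | q , q≈ = ≃-sym (A ,
    ((u∈ , 0∈ , ε∈ , 1∈) , A⁻ , (u⁻∈ , 0∈ , -∈ (*∈ ε∈ u⁻∈) , 1∈) ,
      mat≈ (trans (solve 3 (λ u u⁻ e → u :* u⁻ :+ con 0ℤ :* (:- (e :* u⁻)) := u :* u⁻) refl u u⁻ ε) uu⁻≈1)
           (solve 1 (λ u → u :* con 0ℤ :+ con 0ℤ :* con 1ℤ := con 0ℤ) refl u)
           (solve 2 (λ e u⁻ → e :* u⁻ :+ con 1ℤ :* (:- (e :* u⁻)) := con 0ℤ) refl ε u⁻)
           (solve 1 (λ e → e :* con 0ℤ :+ con 1ℤ :* con 1ℤ := con 1ℤ) refl ε) ,
      mat≈ (trans (solve 3 (λ u u⁻ e → u⁻ :* u :+ con 0ℤ :* e := u :* u⁻) refl u u⁻ ε) uu⁻≈1)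
           (solve 1 (λ u⁻ → u⁻ :* con 0ℤ :+ con 0ℤ :* con 1ℤ := con 0ℤ) refl u⁻)
           (trans (solve 3 (λ u u⁻ e → (:- (e :* u⁻)) :* u :+ con 1ℤ :* e := e :* (con 1ℤ :- u :* u⁻)) refl u u⁻ ε)
             (trans (*-congˡ (x≈y⇒x-y≈0 (sym uu⁻≈1))) (zeroʳ ε)))
           (solve 2 (λ e u⁻ → (:- (e :* u⁻)) :* con 0ℤ :+ con 1ℤ :* con 1ℤ := con 1ℤ) refl ε u⁻)) ,
    p , factorˡ≉0 (trans (*-comm p _) p≈) ,
    mat≈ (solve 3 (λ y z p → (y :- z) :* p :* con 1ℤ :+ con 0ℤ :* con 0ℤ := p :* (y :- z)) refl y z p)
         (solve 4 (λ x y z p → (y :- z) :* p :* (:- x) :+ con 0ℤ :* (y :- x) :=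
            p :* (:- ((y :- z) :* x))) refl x y z p)
         (solve 3 (λ x y p → (y :- x) :* p :* con 1ℤ :+ con 1ℤ :* con 0ℤ := p :* (y :- x)) refl x y p)
         (begin
           (y - x) * p * - x + 1# * (y - x)
             ≈⟨ +-congˡ (*-congʳ p≈) ⟨
           (y - x) * p * - x + (x - z) * p * (y - x)
             ≈⟨ solve 4 (λ x y z p → (y :- x) :* p :* (:- x) :+ (x :- z) :* p :* (y :- x) :=
                  p :* (:- ((y :- x) :* z))) refl x y z p ⟩
           p * - ((y - x) * z) ∎))
    where
    u u⁻ ε : Carrier
    u  = (y - z) * p
    u⁻ = (x - z) * q
    ε  = (y - x) * p

    A A⁻ : Mat
    A  = mat u 0# ε 1#
    A⁻ = mat u⁻ 0# (- (ε * u⁻)) 1#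

    u∈ : u ∈ 𝒪
    u∈ = quotient∈𝒪 p≈ (ℤ⁺.≤-reflexive xz≡yz)

    u⁻∈ : u⁻ ∈ 𝒪
    u⁻∈ = quotient∈𝒪 q≈ (ℤ⁺.≤-reflexive (≡.sym xz≡yz))

    ε∈ : ε ∈ 𝒪
    ε∈ = quotient∈𝒪 p≈ (≡.subst₂ _≤ℤ⁺_ (≡.sym xz≡yz) (v-swap x y) yz≤xy)

    uu⁻≈1 : u * u⁻ ≈ 1#
    uu⁻≈1 = trans (solve 4 (λ a b p q → (b :* p) :* (a :* q) := (a :* p) :* (b :* q)) refl (x - z) (y - z) p q)
      (trans (*-cong p≈ q≈) (*-identityˡ 1#))

  -- The affine maps take the disc around xᵢ of radius v(xᵢ - yᵢ) to 𝒪.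
  infix 4 _≈disc_
  _≈disc_ : Carrier × Carrier → Carrier × Carrier → Set
  (x₁ , y₁) ≈disc (x₂ , y₂) = v (x₁ - y₁) ≡ v (x₂ - y₂) × v (x₁ - y₁) ≤ℤ⁺ v (x₁ - x₂)

  -- A matrix taking one affine map to another fixes `∞`, so `r` vanishes and the diagonal entries
  -- `p` and `s` are units. The last column then gives `s * d₁ ≈ p * d₂`, hence equal radii, and
  -- `q * d₁ ≈ p * (x₁ - x₂)` with `q` integral, hence close centres.
  affine≃⇒≈disc : ∀ {x₁ y₁ x₂ y₂} → affine x₁ y₁ ≃ affine x₂ y₂ → (x₁ , y₁) ≈disc (x₂ , y₂)
  affine≃⇒≈disc {x₁} {y₁} {x₂} {y₂}
    (mat p q r s , ((p∈ , q∈ , r∈ , s∈) , mat p′ q′ r′ s′ , (p′∈ , q′∈ , r′∈ , s′∈) ,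
      mat≈ _ _ _ rq′+ss′≈1 , mat≈ p′p+q′r≈1 _ _ _) , k , k≉0 , mat≈ p≈k q≈ r≈0 s≈) =
    radii , ≡.subst (v (x₁ - y₁) ≤ℤ⁺_) (v-unit-* (x₁ - x₂) vp)
      (≡.subst₂ _≤ℤ⁺_ (v-swap y₁ x₁) (≡.trans (≡.sym (v-* q d₁)) (v-cong qd₁≈))
        (≡.subst (_≤ℤ⁺ add⁺ ℤ._+_ (v q) (v d₁)) (add⁺-identityˡ (v d₁)) (ℤ⁺.+-monoˡ-≤ (v d₁) q∈)))
    where
    d₁ = y₁ - x₁
    d₂ = y₂ - x₂

    r=0 : r ≈ 0#
    r=0 = trans (solve 2 (λ r s → r := r :* con 1ℤ :+ s :* con 0ℤ) refl r s) (trans r≈0 (zeroʳ k))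

    p=k : p ≈ k
    p=k = trans (solve 2 (λ p q → p := p :* con 1ℤ :+ q :* con 0ℤ) refl p q) (trans p≈k (*-identityʳ k))

    vp : v p ≡ [ 0ℤ ]
    vp = unit⇒v≡0 p∈ p′∈ (begin
      p * p′            ≈⟨ solve 3 (λ p p′ q′ → p :* p′ := p′ :* p :+ q′ :* con 0ℤ) refl p p′ q′ ⟩
      p′ * p + q′ * 0#  ≈⟨ +-congˡ (*-congˡ r=0) ⟨
      p′ * p + q′ * r   ≈⟨ p′p+q′r≈1 ⟩
      1#                ∎)

    vs : v s ≡ [ 0ℤ ]
    vs = unit⇒v≡0 s∈ s′∈ (begin
      s * s′            ≈⟨ solve 3 (λ s s′ q′ → s :* s′ := con 0ℤ :* q′ :+ s :* s′) refl s s′ q′ ⟩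
      0# * q′ + s * s′  ≈⟨ +-congʳ (*-congʳ r=0) ⟨
      r * q′ + s * s′   ≈⟨ rq′+ss′≈1 ⟩
      1#                ∎)

    sd₁≈ : s * d₁ ≈ p * d₂
    sd₁≈ = begin
      s * d₁                  ≈⟨ solve 3 (λ s d x → s :* d := con 0ℤ :* (:- x) :+ s :* d) refl s d₁ x₁ ⟩
      0# * (- x₁) + s * d₁    ≈⟨ +-congʳ (*-congʳ r=0) ⟨
      r * (- x₁) + s * d₁     ≈⟨ s≈ ⟩
      k * d₂                  ≈⟨ *-congʳ p=k ⟨
      p * d₂                  ∎

    qd₁≈ : q * d₁ ≈ p * (x₁ - x₂)
    qd₁≈ = begin
      q * d₁                           ≈⟨ solve 3 (λ p x w → w := p :* x :+ (p :* (:- x) :+ w)) refl p x₁ (q * d₁) ⟩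
      p * x₁ + (p * (- x₁) + q * d₁)   ≈⟨ +-congˡ (trans q≈ (*-congʳ (sym p=k))) ⟩
      p * x₁ + p * (- x₂)              ≈⟨ distribˡ p x₁ (- x₂) ⟨
      p * (x₁ - x₂)                    ∎

    radii : v (x₁ - y₁) ≡ v (x₂ - y₂)
    radii = ≡.trans (v-swap x₁ y₁) (≡.trans (≡.sym (v-unit-* d₁ vs)) (≡.trans (v-cong sd₁≈)
      (≡.trans (v-unit-* d₂ vp) (v-swap y₂ x₂))))

  -- The matrix is the change of coordinate from `(X - x₁) / d₁` to `(X - x₂) / d₂`, scaled by
  -- `d₂ / d₁`. The disc condition says exactly that the quotients of `d₁`, `d₂` by each other and
  -- of `w` by both are integral.
  ≈disc⇒affine≃ : ∀ {x₁ y₁ x₂ y₂} → x₁ ≉ y₁ → x₂ ≉ y₂ →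
                  (x₁ , y₁) ≈disc (x₂ , y₂) → affine x₁ y₁ ≃ affine x₂ y₂
  ≈disc⇒affine≃ {x₁} {y₁} {x₂} {y₂} x₁≉y₁ x₂≉y₂ (radii , ≤₁₂)
    with inverse (y₁ - x₁) (x₁≉y₁ ∘ sym ∘ x-y≈0⇒x≈y) | inverse (y₂ - x₂) (x₂≉y₂ ∘ sym ∘ x-y≈0⇒x≈y)
  ... | p , p≈ | q , q≈ = mat 1# (w * p) 0# (d₂ * p) ,
    ((1∈ , wp∈ , 0∈ , quotient∈𝒪 p≈ (ℤ⁺.≤-reflexive d₁≡d₂)) ,
      mat 1# (- (w * q)) 0# (d₁ * q) , (1∈ , -∈ wq∈ , 0∈ , quotient∈𝒪 q≈ (ℤ⁺.≤-reflexive (≡.sym d₁≡d₂))) ,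
      mat≈ (solve 1 (λ a → con 1ℤ :* con 1ℤ :+ a :* con 0ℤ := con 1ℤ) refl _)
           (begin
             1# * - (w * q) + w * p * (d₁ * q)
               ≈⟨ solve 4 (λ w p q d → con 1ℤ :* (:- (w :* q)) :+ w :* p :* (d :* q) :=
                    w :* q :* (d :* p :- con 1ℤ)) refl w p q d₁ ⟩
             w * q * (d₁ * p - 1#)  ≈⟨ *-congˡ (x≈y⇒x-y≈0 p≈) ⟩
             w * q * 0#             ≈⟨ zeroʳ _ ⟩
             0#                     ∎)
           (solve 1 (λ a → con 0ℤ :* con 1ℤ :+ a :* con 0ℤ := con 0ℤ) refl _)
           (trans (solve 5 (λ w p q d₁ d₂ → con 0ℤ :* (:- (w :* q)) :+ d₂ :* p :* (d₁ :* q) :=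
             (d₁ :* p) :* (d₂ :* q)) refl w p q d₁ d₂) dp*dq≈1) ,
      mat≈ (solve 1 (λ a → con 1ℤ :* con 1ℤ :+ a :* con 0ℤ := con 1ℤ) refl _)
           (begin
             1# * (w * p) + - (w * q) * (d₂ * p)
               ≈⟨ solve 4 (λ w p q d → con 1ℤ :* (w :* p) :+ (:- (w :* q)) :* (d :* p) :=
                    w :* p :* (con 1ℤ :- d :* q)) refl w p q d₂ ⟩
             w * p * (1# - d₂ * q)  ≈⟨ *-congˡ (x≈y⇒x-y≈0 (sym q≈)) ⟩
             w * p * 0#             ≈⟨ zeroʳ _ ⟩
             0#                     ∎)
           (solve 1 (λ a → con 0ℤ :* con 1ℤ :+ a :* con 0ℤ := con 0ℤ) refl _)
           (trans (solve 5 (λ w p q d₁ d₂ → con 0ℤ :* (w :* p) :+ d₁ :* q :* (d₂ :* p) :=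
             (d₁ :* p) :* (d₂ :* q)) refl w p q d₁ d₂) dp*dq≈1)) ,
    1# , 1≉0 ,
    mat≈ (solve 1 (λ a → con 1ℤ :* con 1ℤ :+ a :* con 0ℤ := con 1ℤ :* con 1ℤ) refl _)
         (begin
           1# * - x₁ + w * p * d₁   ≈⟨ solve 4 (λ x w p d → con 1ℤ :* (:- x) :+ w :* p :* d :=
                                         (:- x) :+ w :* (d :* p)) refl x₁ w p d₁ ⟩
           - x₁ + w * (d₁ * p)      ≈⟨ +-congˡ (*-congˡ p≈) ⟩
           - x₁ + w * 1#            ≈⟨ solve 2 (λ x₁ x₂ → (:- x₁) :+ (x₁ :- x₂) :* con 1ℤ :=
                                         con 1ℤ :* (:- x₂)) refl x₁ x₂ ⟩
           1# * - x₂                ∎)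
         (solve 1 (λ a → con 0ℤ :* con 1ℤ :+ a :* con 0ℤ := con 1ℤ :* con 0ℤ) refl _)
         (begin
           0# * - x₁ + d₂ * p * d₁  ≈⟨ solve 4 (λ x d₂ p d₁ → con 0ℤ :* (:- x) :+ d₂ :* p :* d₁ :=
                                         (d₁ :* p) :* d₂) refl x₁ d₂ p d₁ ⟩
           d₁ * p * d₂              ≈⟨ *-congʳ p≈ ⟩
           1# * d₂                  ∎)
    where
    d₁ = y₁ - x₁
    d₂ = y₂ - x₂
    w  = x₁ - x₂

    d₁≡d₂ : v d₁ ≡ v d₂
    d₁≡d₂ = ≡.trans (v-swap y₁ x₁) (≡.trans radii (v-swap x₂ y₂))

    d₁≤w : v d₁ ≤ℤ⁺ v w
    d₁≤w = ≡.subst (_≤ℤ⁺ v w) (v-swap x₁ y₁) ≤₁₂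

    wp∈ : w * p ∈ 𝒪
    wp∈ = quotient∈𝒪 p≈ d₁≤w

    wq∈ : w * q ∈ 𝒪
    wq∈ = quotient∈𝒪 q≈ (≡.subst (_≤ℤ⁺ v w) d₁≡d₂ d₁≤w)

    dp*dq≈1 : (d₁ * p) * (d₂ * q) ≈ 1#
    dp*dq≈1 = trans (*-cong p≈ q≈) (*-identityˡ 1#)

  -- With `R = ∞` the Möbius matrix is already affine. If `P` or `Q` were `∞`, the equality of
  -- `v⟨ P - R ⟩` and `v⟨ Q - R ⟩` would identify `⊥±` with the value of a difference of finite
  -- points.
  ordered-normal-form : ∀ P Q R → P ≉ℙ Q → Q ≉ℙ R → P ≉ℙ R →
    v⟨ P - R ⟩ ≡ v⟨ Q - R ⟩ → v⟨ Q - R ⟩ ≤ℤ± v⟨ P - Q ⟩ →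
    ∃[ x ] ∃[ y ] P ≡ [ x ] × Q ≡ [ y ] × x ≉ y × möbius P Q R ≃ affine x y
  ordered-normal-form [ x ] [ y ] [ z ] P≉Q Q≉R P≉R PR≡QR QR≤PQ =
    x , y , ≡.refl , ≡.refl , P≉Q ∘ [_] , möbius≃affine (ℤ±.lift-injective PR≡QR)
      (ℤ±.drop-lift QR≤PQ) (P≉R ∘ [_]) (Q≉R ∘ [_])
  ordered-normal-form [ x ] [ y ] ∞ P≉Q _ _ _ _ =
    x , y , ≡.refl , ≡.refl , P≉Q ∘ [_] , ≃-refl
  ordered-normal-form ∞     ∞     _     P≉Q _   _   _  _ = contradiction ∙≈∙ P≉Q
  ordered-normal-form ∞     [ _ ] ∞     _   _   P≉R _  _ = contradiction ∙≈∙ P≉R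
  ordered-normal-form ∞     [ y ] [ z ] _   _   _   ⊥≡ _ = contradiction (≡.sym ⊥≡) (ℤ±.lift≢⊥ (v (y - z)))
  ordered-normal-form [ _ ] ∞     ∞     _   Q≉R _   _  _ = contradiction ∙≈∙ Q≉R
  ordered-normal-form [ x ] ∞     [ z ] _   _   _   ≡⊥ _ = contradiction ≡⊥ (ℤ±.lift≢⊥ (v (x - z)))

-- Rational radii compared with integer values.

module ℚ⁺ where
  private module Q = AddSupremum ℚ._≤_
  open Q using (≤⁺-dec; ≤⁺-trans)

  private
    -- `i / 1` is normalised through a gcd and does not reduce for a variable `i`; the explicit
    -- fraction exposes its numerator to the order on ℚ.
    i/1≡ : ∀ i → i / 1 ≡ mkℚ i 0 (Coprime.sym (Coprime.1-coprimeTo ℤ.∣ i ∣))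
    i/1≡ i = ℚ.↥p/↧p≡p (mkℚ i 0 (Coprime.sym (Coprime.1-coprimeTo ℤ.∣ i ∣)))

  /1-mono : ∀ {i j} → i ℤ.≤ j → i / 1 ℚ.≤ j / 1
  /1-mono {i} {j} i≤j = ≡.subst₂ ℚ._≤_ (≡.sym (i/1≡ i)) (≡.sym (i/1≡ j))
    (*≤* (ℤ.*-monoʳ-≤-nonNeg (+ 1) i≤j))

  /1-cancel : ∀ {i j} → i / 1 ℚ.≤ j / 1 → i ℤ.≤ j
  /1-cancel {i} {j} p = ℤ.*-cancelʳ-≤-pos i j (+ 1)
    (ℚ.drop-*≤* (≡.subst₂ ℚ._≤_ (i/1≡ i) (i/1≡ j) p))

  infix 4 _≤/1_
  _≤/1_ : ℚ → ℤ ⁺ → Set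
  d ≤/1 u = [ d ] ≤ℚ⁺ Maybe.map (_/ 1) u

  _≤/1?_ : ∀ d u → Dec (d ≤/1 u)
  d ≤/1? u = ≤⁺-dec ℚ._≤?_ [ d ] (Maybe.map (_/ 1) u)

  ≤/1-trans : ∀ {d u w} → d ≤/1 u → u ≤ℤ⁺ w → d ≤/1 w
  ≤/1-trans _       (_ ≤⊤⁺) = _ Q.≤⊤⁺
  ≤/1-trans Q.[ p ] [ q ]   = Q.[ ℚ.≤-trans p (/1-mono q) ]

  ≤-≤/1-trans : ∀ {d e} u → d ℚ.≤ e → e ≤/1 u → d ≤/1 u
  ≤-≤/1-trans u p q = ≤⁺-trans ℚ.≤-trans Q.[ p ] q

  []≤⇒/1≤ : ∀ {i u} → [ i ] ≤ℤ⁺ u → i / 1 ≤/1 u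
  []≤⇒/1≤ (_ ≤⊤⁺) = _ Q.≤⊤⁺
  []≤⇒/1≤ [ p ]   = Q.[ /1-mono p ]

  /1≤⇒[]≤ : ∀ {i} u → i / 1 ≤/1 u → [ i ] ≤ℤ⁺ u
  /1≤⇒[]≤ ∞     _       = _ ≤⊤⁺
  /1≤⇒[]≤ [ j ] Q.[ p ] = [ /1-cancel p ]

-- The finite set of roots.

module Roots {κ ℓ} (𝒞 : SuperellipticCurve κ ℓ) where
  open Curve 𝒞
  open DVRProperties dvr
  open FieldProperties K
  open SetoidReasoning setoid
  private
    module V = Evaluation (idHom K)
    module K̄ = AlgebraicClosure closure

  fromRoots≈ : ∀ r rs z → fromRoots (r ∷ rs) V.at z ≈ (z - r) * (fromRoots rs V.at z)
  fromRoots≈ r rs z = trans (V.at-⊠ ((- r) ∷ 1# ∷ []) (fromRoots rs) z)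
    (*-congʳ (solve 2 (λ r z → :- r :+ z :* (con 1ℤ :+ z :* con 0ℤ) := z :- r) refl r z))

  fromRoots-zero⇒ : ∀ rs {z} → fromRoots rs V.at z ≈ 0# → Any (z ≈_) rs
  fromRoots-zero⇒ []       {z} e = contradiction (trans (sym (V.const-at 1# z)) e) 1≉0
  fromRoots-zero⇒ (r ∷ rs) {z} e with z ≟ r
  ... | yes z≈r = here z≈r
  ... | no  z≉r = there (fromRoots-zero⇒ rs
    (xy≈0∧x≉0⇒y≈0 (trans (sym (fromRoots≈ r rs z)) e) (z≉r ∘ x-y≈0⇒x≈y)))

  fromRoots-zero⇐ : ∀ {rs z} → Any (z ≈_) rs → fromRoots rs V.at z ≈ 0#
  fromRoots-zero⇐ {r ∷ rs} {z} (here z≈r) =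
    trans (fromRoots≈ r rs z) (trans (*-congʳ (x≈y⇒x-y≈0 z≈r)) (zeroˡ (fromRoots rs V.at z)))
  fromRoots-zero⇐ {r ∷ rs} {z} (there z∈) =
    trans (fromRoots≈ r rs z) (trans (*-congˡ (fromRoots-zero⇐ z∈)) (zeroʳ (z - r)))

  f≈fromRoots : ∀ z → eval f z ≈ fromRoots roots V.at z
  f≈fromRoots z = trans (reflexive (≡.cong (λ p → eval p z) (≡.sym (List.map-id f))))
    (V.at-Pointwise splits z)

  ℛ⇒roots : ∀ {z} → z ∈ ℛ → Any (z ≈_) roots
  ℛ⇒roots {z} z∈ = fromRoots-zero⇒ roots (trans (sym (f≈fromRoots z)) z∈)

  roots⇒ℛ : ∀ {z} → Any (z ≈_) roots → z ∈ ℛ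
  roots⇒ℛ {z} z∈ = trans (f≈fromRoots z) (fromRoots-zero⇐ z∈)

  ℛ-resp : ∀ {z w} → z ≈ w → z ∈ ℛ → w ∈ ℛ
  ℛ-resp z≈w z∈ = roots⇒ℛ (Any.map (trans (sym z≈w)) (ℛ⇒roots z∈))

  ℛ? : Decidable ℛ
  ℛ? z = eval f z ≟0

  _Respects≈ : Pred Carrier ℓ → Set _
  U Respects≈ = ∀ {z w} → z ≈ w → z ∈ U → w ∈ U

  module _ {U : Subset} (U? : Decidable U) (U-resp : U Respects≈) where

    -- A failed inclusion carries no witness by itself; one is found by testing the finite list
    -- `roots` with `U?`.
    outside : ¬ ℛ ⊆ U → ∃[ z ] z ∈ ℛ × z ∉ U
    outside ℛ⊈U with Any.any? (Dec.¬? ∘ U?) roots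
    ... | yes out with find out
    ...   | z , z∈ , z∉U = z , roots⇒ℛ (lose z∈ refl) , z∉U
    outside ℛ⊈U | no ¬out = ⊥-elim (ℛ⊈U (λ {z} → ℛ⊆U {z}))
      where
      ℛ⊆U : ℛ ⊆ U
      ℛ⊆U {z} z∈ with find (ℛ⇒roots z∈)
      ... | r , r∈ , z≈r with U? r
      ...   | yes r∈U = U-resp (sym z≈r) r∈U
      ...   | no  r∉U = contradiction (lose r∈ r∉U) ¬out

    -- Farthest means least value of `v`, hence `argmin` over the roots in `U`. The default `x` lies
    -- in `U`, so the result does so in every case.
    farthest : U ⊆ ℛ → ∀ {x} → x ∈ U → ∃[ b ] b ∈ U × (∀ y → y ∈ U → v (x - b) ≤ℤ⁺ v (x - y))
    farthest U⊆ℛ {x} x∈U = argmin dist x rs , argmin-all dist x∈U (all-filter U? roots) , minimal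
      where
      totalOrder : TotalOrder _ _ _
      totalOrder = record { isTotalOrder = AddSupremum.≤⁺-isTotalOrder-≡ ℤ._≤_ ℤ.≤-isTotalOrder }
      open Extrema totalOrder using (argmin; argmin-all; f[argmin]≤f[xs])

      rs : List Carrier
      rs = filter U? roots

      dist : Carrier → ℤ ⁺
      dist y = v (x - y)

      minimal : ∀ y → y ∈ U → dist (argmin dist x rs) ≤ℤ⁺ dist y
      minimal y y∈ with find (ℛ⇒roots (U⊆ℛ y∈))
      ... | r , r∈ , y≈r = ≡.subst (dist (argmin dist x rs) ≤ℤ⁺_)
        (v-cong (+-congˡ (-‿cong (sym y≈r))))
        (All.lookup (f[argmin]≤f[xs] x rs) (∈-filter⁺ U? r∈ (U-resp y≈r y∈)))

  length-⊞ : ∀ p q → length (p ⊞ q) ≡ length p ℕ.⊔ length q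
  length-⊞ []      q       = ≡.refl
  length-⊞ (a ∷ p) []      = ≡.refl
  length-⊞ (a ∷ p) (b ∷ q) = ≡.cong suc (length-⊞ p q)

  length-fromRoots : ∀ rs → length (fromRoots rs) ≡ suc (length rs)
  length-fromRoots []       = ≡.refl
  length-fromRoots (r ∷ rs) = ≡.trans (length-⊞ (map (- r *_) P) (0# ∷ (map (1# *_) P ⊞ (0# ∷ []))))
    (≡.trans (≡.cong₂ (λ k l → k ℕ.⊔ suc l)
      (≡.trans (List.length-map (- r *_) P) (length-fromRoots rs))
      (≡.trans (length-⊞ (map (1# *_) P) (0# ∷ []))
        (≡.trans (≡.cong (ℕ._⊔ 1) (≡.trans (List.length-map (1# *_) P) (length-fromRoots rs)))
          (≡.cong suc (ℕ.⊔-identityʳ (length rs))))))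
      (ℕ.m≤n⇒m⊔n≡n (ℕ.n≤1+n (suc (length rs)))))
    where P = fromRoots rs

  -- Coefficient lists are never shortened, so `fromRoots` has one entry more than there are roots,
  -- and the pointwise `splits` compares lengths.
  length-roots : deg-f ≡ length roots
  length-roots = ℕ.suc-injective (≡.trans
    (≡.sym (≡.trans (List.length-++ lower) (ℕ.+-comm (length lower) 1)))
    (≡.trans (Pointwise.Pointwise-length splits) (length-fromRoots roots)))

  K̄-≟0 : ∀ z → Dec (z K̄.≈ K̄.0#)
  K̄-≟0 z with K̄.v̄ z in eq
  ... | ∞     = yes (Equivalence.to (K̄.v-∞ z) eq)
  ... | [ i ] = no λ z≈0 → contradiction (≡.trans (≡.sym (Equivalence.from (K̄.v-∞ z) z≈0)) eq) λ ()

  linear⇒genus≯0 : ∀ {n} b → 2 ℕ.≤ n → (FF : FunctionField K̄.K̄ n (map K̄.ι (b ∷ 1# ∷ []))) →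
                   ∀ {g} → FunctionField.HasGenus FF g → ¬ 0 ℕ.< g
  linear⇒genus≯0 {suc m} b _ FF =
    RationalCurve.genus≯0 K̄.closed K̄-≟0 FF (K̄.ι b) yⁿ≈b+x
    where
    module F = FunctionField FF
    module ι = Evaluation K̄.embedding
    module κ = Evaluation F.constants

    yⁿ≈b+x : F.y F.^ suc m F.≈ F.κ (K̄.ι b) F.+ F.x
    yⁿ≈b+x = F.trans F.equation (F.+-congˡ (F.trans
      (F.*-congˡ (F.trans (κ.const-at (K̄.ι 1#) F.x) (F.trans (κ.⟦⟧-cong ι.1#-homo) κ.1#-homo)))
      (F.*-identityʳ F.x)))

  -- Degree 0 is divisible by `n`, degree 1 contradicts the positive genus, and in higher degree the
  -- factor `(r - s) ^ 2` of the discriminant separates the first two listed roots.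
  distinct-roots : n ∤ deg-f → ∃[ x ] ∃[ y ] x ∈ ℛ × y ∈ ℛ × x ≉ y
  distinct-roots n∤deg = go roots length-roots disc≉0 (λ z∈ → roots⇒ℛ z∈)
    where
    go : ∀ rs → deg-f ≡ length rs → discriminant rs ≉ 0# → (∀ {z} → Any (z ≈_) rs → z ∈ ℛ) →
         ∃[ x ] ∃[ y ] x ∈ ℛ × y ∈ ℛ × x ≉ y
    go []           deg≡0 _  _ = contradiction (≡.subst (n ∣_) (≡.sym deg≡0) (n ∣0)) n∤deg
    go (r ∷ [])     deg≡1 _  _ = linear lower deg≡1 functionField hasGenus
      where
      -- The coefficient list is abstracted together with its function field, so that matching on
      -- the list refines the equation of the curve.
      linear : ∀ cs → length cs ≡ 1 → (FF : FunctionField K̄.K̄ n (map K̄.ι (monic cs))) →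
               FunctionField.HasGenus FF genus → ∃[ x ] ∃[ y ] x ∈ ℛ × y ∈ ℛ × x ≉ y
      linear (b ∷ []) _ FF hasGenus = contradiction 0<genus (linear⇒genus≯0 b 2≤n FF hasGenus)
    go (r ∷ s ∷ rs) _ disc≉0 ∈ℛ = r , s , ∈ℛ (here refl) , ∈ℛ (there (here refl)) , λ r≈s →
      disc≉0 (begin
        (r - s) * ((r - s) * 1#) * Δ    ≈⟨ *-congʳ (*-congʳ (x≈y⇒x-y≈0 r≈s)) ⟩
        0# * ((r - s) * 1#) * Δ         ≈⟨ *-congʳ (zeroˡ ((r - s) * 1#)) ⟩
        0# * Δ                          ≈⟨ zeroˡ Δ ⟩
        0#                              ∎)
      where
      Δ = foldr (λ s d → (r - s) ^ 2 * d) (discriminant (s ∷ rs)) rs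

-- Clusters as balls around roots.

module ClusterMap {κ ℓ} (𝒞 : SuperellipticCurve κ ℓ) where
  open Curve 𝒞
  open DVRProperties dvr
  open FieldProperties K
  open Moebius 𝒞
  open Roots 𝒞
  open ℚ⁺
  private
    module K̄ = AlgebraicClosure closure
    module K̄′ = FieldProperties K̄.K̄
    module ι = Evaluation K̄.embedding

  v-self : ∀ {x y} → x ≈ y → v (x - y) ≡ ⊤⁺
  v-self {x} {y} x≈y = Equivalence.from (v-∞ (x - y)) (x≈y⇒x-y≈0 x≈y)

  ≤-v-self : ∀ {γ} x → γ ≤ℤ⁺ v (x - x)
  ≤-v-self {γ} x = ≡.subst (γ ≤ℤ⁺_) (≡.sym (v-self refl)) (γ ≤⊤⁺)

  -- The element `-1` of the closure is the image of `- 1#`, whose value is known in `K` and carried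
  -- over by `extends`.
  v̄-neg : ∀ z → K̄.v̄ (K̄.- z) ≡ K̄.v̄ z
  v̄-neg z = ≡.trans (K̄.v-cong (K̄.trans
      (K̄′.solve 1 (λ z → K̄′.:- z K̄′.:= (K̄′.:- K̄′.con 1ℤ) K̄′.:* z) K̄.refl z)
      (K̄.*-congʳ (K̄.sym (K̄.trans (ι.-‿homo 1#) (K̄.-‿cong ι.1#-homo))))))
    (≡.trans (K̄.v-* (ι (- 1#)) z) (≡.trans
      (≡.cong (λ u → add⁺ ℚ._+_ u (K̄.v̄ z)) (≡.trans (K̄.extends (- 1#)) (≡.cong (Maybe.map (_/ 1)) v-neg-1)))
      (0+ (K̄.v̄ z))))
    where
    0+ : ∀ u → add⁺ ℚ._+_ [ 0ℤ / 1 ] u ≡ u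
    0+ ∞     = ≡.refl
    0+ [ p ] = ≡.cong [_] (ℚ.+-identityˡ p)

  v̄-ι : ∀ x y → K̄.v̄ (ι x K̄.- ι y) ≡ Maybe.map (_/ 1) (v (x - y))
  v̄-ι x y = ≡.trans (K̄.v-cong (K̄.sym (K̄.trans (ι.+-homo x (- y)) (K̄.+-congˡ (ι.-‿homo y)))))
    (K̄.extends (x - y))

  -- Every point of an ultrametric disc is a centre. Choosing one in `K` gets rid of the centre `z`
  -- in the closure and turns membership into a condition on `v`.
  D-recentre : ∀ {z d x} → D z d (ι x) → ∀ {y} → D z d (ι y) ⇔ d ≤/1 v (y - x)
  D-recentre {z} {d} {x} x∈ {y} = mk⇔
    (λ y∈ → ≡.subst ([ d ] ≤ℚ⁺_) (≡.trans (K̄.v-cong (K̄′.solve 3 (λ x y z →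
        (y K̄′.:- z) K̄′.:+ (K̄′.:- (x K̄′.:- z)) K̄′.:= y K̄′.:- x) K̄.refl (ι x) (ι y) z)) (v̄-ι y x))
      (K̄.v-+ (ι y K̄.- z) (K̄.- (ι x K̄.- z)) [ d ] y∈
        (≡.subst ([ d ] ≤ℚ⁺_) (≡.sym (v̄-neg (ι x K̄.- z))) x∈)))
    (λ y∈ → ≡.subst ([ d ] ≤ℚ⁺_) (K̄.v-cong (K̄′.solve 3 (λ x y z →
        (y K̄′.:- x) K̄′.:+ (x K̄′.:- z) K̄′.:= y K̄′.:- z) K̄.refl (ι x) (ι y) z))
      (K̄.v-+ (ι y K̄.- ι x) (ι x K̄.- z) [ d ]
        (≡.subst ([ d ] ≤ℚ⁺_) (≡.sym (v̄-ι y x)) y∈) x∈))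

  module _ {U : Subset} (U-cluster : IsCluster U) where
    private
      d : ℚ
      d = proj₁ (proj₂ (proj₂ U-cluster))

      U≐ : U ≐ ((ι ⊢ D (proj₁ (proj₂ U-cluster)) d) ∩ ℛ)
      U≐ = proj₂ (proj₂ (proj₂ U-cluster))

    cluster⊆ℛ : U ⊆ ℛ
    cluster⊆ℛ z∈ = proj₂ (proj₁ U≐ z∈)

    cluster-ball : ∀ {x} → x ∈ U → ∀ y → y ∈ U ⇔ (y ∈ ℛ × d ≤/1 v (y - x))
    cluster-ball x∈U y = mk⇔
      (λ y∈U → cluster⊆ℛ y∈U , Equivalence.to recentre (proj₁ (proj₁ U≐ y∈U)))
      (λ { (y∈ℛ , d≤) → proj₂ U≐ (Equivalence.from recentre d≤ , y∈ℛ) })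
      where recentre = D-recentre (proj₁ (proj₁ U≐ x∈U))

    -- Recentred at `x`, the cluster contains `y`; the radius bound that `y` meets is met by the
    -- closer root `z`.
    cluster-closer : ∀ {x y z} → x ∈ U → y ∈ U → z ∈ ℛ → v (x - y) ≤ℤ⁺ v (x - z) → z ∈ U
    cluster-closer {x} {y} {z} x∈ y∈ z∈ xy≤xz = Equivalence.from (cluster-ball x∈ z) (z∈ ,
      ≤/1-trans (proj₂ (Equivalence.to (cluster-ball x∈ y) y∈))
        (≡.subst₂ _≤ℤ⁺_ (v-swap x y) (v-swap x z) xy≤xz))

    cluster-resp : U Respects≈
    cluster-resp {z} {w} z≈w z∈ = cluster-closer z∈ z∈ (ℛ-resp z≈w (cluster⊆ℛ z∈))
      (≡.subst (v (z - z) ≤ℤ⁺_) (≡.sym (v-self z≈w)) (_ ≤⊤⁺))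

    -- Nonemptiness provides a centre in `K`, after which membership compares the radius with a
    -- value of `v`.
    cluster? : Decidable U
    cluster? y = Dec.map′
      (Equivalence.from (cluster-ball x∈U y)) (Equivalence.to (cluster-ball x∈U y))
      (ℛ? y Dec.×-dec (d ≤/1? v (y - x)))
      where
      x = proj₁ (proj₁ U-cluster)
      x∈U = proj₂ (proj₁ U-cluster)

  -- Both are recentred at the common point `x`, where comparing the radii decides the inclusion.
  clusters-nested : ∀ {U V} → IsCluster U → IsCluster V → ∀ {x} → x ∈ U → x ∈ V → U ⊆ V ⊎ V ⊆ U
  clusters-nested U-cl V-cl {x} x∈U x∈V
    with ℚ.≤-total (proj₁ (proj₂ (proj₂ U-cl))) (proj₁ (proj₂ (proj₂ V-cl)))
  ... | inj₁ d≤e = inj₂ λ {y} y∈V → Equivalence.from (cluster-ball U-cl x∈U y)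
    (cluster⊆ℛ V-cl y∈V , ≤-≤/1-trans (v (y - x)) d≤e (proj₂ (Equivalence.to (cluster-ball V-cl x∈V y) y∈V)))
  ... | inj₂ e≤d = inj₁ λ {y} y∈U → Equivalence.from (cluster-ball V-cl x∈V y)
    (cluster⊆ℛ U-cl y∈U , ≤-≤/1-trans (v (y - x)) e≤d (proj₂ (Equivalence.to (cluster-ball U-cl x∈U y) y∈U)))

  -- `Φ₀ t o` is by definition `Ball (centre t o) (radius t o)`.
  Ball : Carrier → ℤ → Subset
  Ball x μ = (ι ⊢ D (ι x) (μ / 1)) ∩ ℛ

  module _ (x : Carrier) (μ : ℤ) where

    ∈Ball : ∀ {z} → z ∈ ℛ → [ μ ] ≤ℤ⁺ v (z - x) → z ∈ Ball x μ
    ∈Ball {z} z∈ μ≤ = ≡.subst ([ μ / 1 ] ≤ℚ⁺_) (≡.sym (v̄-ι z x)) ([]≤⇒/1≤ μ≤) , z∈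

    Ball-≤ : ∀ {z} → z ∈ Ball x μ → [ μ ] ≤ℤ⁺ v (z - x)
    Ball-≤ {z} (z∈D , _) = /1≤⇒[]≤ (v (z - x)) (≡.subst ([ μ / 1 ] ≤ℚ⁺_) (v̄-ι z x) z∈D)

    centre∈Ball : x ∈ ℛ → x ∈ Ball x μ
    centre∈Ball x∈ = ∈Ball x∈ (≤-v-self x)

    Ball-isCluster : x ∈ ℛ → IsCluster (Ball x μ)
    Ball-isCluster x∈ = (x , centre∈Ball x∈) , ι x , μ / 1 , ≐-refl

  [μ]≤-reflexive : ∀ {x μ} → v x ≡ [ μ ] → [ μ ] ≤ℤ⁺ v x
  [μ]≤-reflexive e = ℤ⁺.≤-reflexive (≡.sym e)

  -- Ordered triples and their balls.

  record OrderedForm (t : Triple) (x : Carrier) (μ : ℤ) : Set (κ ⊔ ℓ) where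
    field
      y     : Carrier
      x∈ℛ   : x ∈ ℛ
      y∈ℛ   : y ∈ ℛ
      x≉y   : x ≉ y
      xy≡μ  : v (x - y) ≡ [ μ ]
      φ≃    : φ t ≃ affine x y

  orderedForm : ∀ t (o : Ordered t) → OrderedForm t (centre t o) (radius t o)
  orderedForm t o@(e , l) with ordered-normal-form a b c a≉b b≉c a≉c e l
    where open Triple t
  ... | x , y , a≡x , b≡y , x≉y , φ≃ = form (ordered-finite t o)
    where
    open Triple t
    -- `centre` and `radius` are projections of `ordered-finite t o`, which is stuck for a variable
    -- `t`. Quantifying over its result lets the two descriptions of `a` be unified.
    form : (fin : ∃[ x ] ∃[ μ ] a ≡ [ x ] × v⟨ a - b ⟩ ≡ [ [ μ ] ]) →
           OrderedForm t (proj₁ fin) (proj₁ (proj₂ fin))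
    form (x′ , μ , a≡x′ , ab≡μ) with []-injective (≡.trans (≡.sym a≡x) a≡x′)
    ... | ≡.refl = record
      { y = y ; x∈ℛ = ≡.subst S a≡x a∈S ; y∈ℛ = ≡.subst S b≡y b∈S ; x≉y = x≉y
      ; xy≡μ = ℤ±.lift-injective (≡.trans (≡.cong₂ v⟨_-_⟩ (≡.sym a≡x) (≡.sym b≡y)) ab≡μ)
      ; φ≃ = φ≃ }

  module _ {t₁ t₂ x₁ x₂ μ₁ μ₂} (F₁ : OrderedForm t₁ x₁ μ₁) (F₂ : OrderedForm t₂ x₂ μ₂) where
    private
      module F₁ = OrderedForm F₁
      module F₂ = OrderedForm F₂

      A₁ A₂ : Mat
      A₁ = affine x₁ F₁.y
      A₂ = affine x₂ F₂.y

    ∼⇒≈disc : t₁ ∼ t₂ → (x₁ , F₁.y) ≈disc (x₂ , F₂.y)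
    ∼⇒≈disc t₁∼t₂ = affine≃⇒≈disc {x₁} {F₁.y} {x₂} {F₂.y} (≃-trans {A₁} {φ t₁} {A₂} (≃-sym {φ t₁} {A₁} F₁.φ≃)
      (≃-trans {φ t₁} {φ t₂} {A₂} t₁∼t₂ F₂.φ≃))

    ≈disc⇒∼ : (x₁ , F₁.y) ≈disc (x₂ , F₂.y) → t₁ ∼ t₂
    ≈disc⇒∼ discs = ≃-trans {φ t₁} {A₁} {φ t₂} F₁.φ≃
      (≃-trans {A₁} {A₂} {φ t₂} (≈disc⇒affine≃ {x₁} {F₁.y} {x₂} {F₂.y} F₁.x≉y F₂.x≉y discs) (≃-sym {φ t₂} {A₂} F₂.φ≃))

    ∼⇒Ball⊆ : t₁ ∼ t₂ → Ball x₁ μ₁ ⊆ Ball x₂ μ₂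
    ∼⇒Ball⊆ t₁∼t₂ {z} z∈ = ∈Ball x₂ μ₂ (proj₂ z∈) (≡.subst (_≤ℤ⁺ v (z - x₂)) μ₁≡μ₂
      (ultrametric z x₁ x₂ (Ball-≤ x₁ μ₁ z∈)
        (≡.subst (_≤ℤ⁺ v (x₁ - x₂)) F₁.xy≡μ (proj₂ discs))))
      where
      discs : (x₁ , F₁.y) ≈disc (x₂ , F₂.y)
      discs = ∼⇒≈disc t₁∼t₂

      μ₁≡μ₂ : [ μ₁ ] ≡ [ μ₂ ]
      μ₁≡μ₂ = ≡.trans (≡.sym F₁.xy≡μ) (≡.trans (proj₁ discs) F₂.xy≡μ)

    y₂∈Ball : F₂.y ∈ Ball x₂ μ₂
    y₂∈Ball = ∈Ball x₂ μ₂ F₂.y∈ℛ ([μ]≤-reflexive (≡.trans (v-swap F₂.y x₂) F₂.xy≡μ))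

    -- The radius `μ₂` is attained between the roots `x₂` and `F₂.y`, both in the first ball. This
    -- is how root sets, and not only whole discs, detect the radius.
    Ball⊇⇒radius≤ : Ball x₂ μ₂ ⊆ Ball x₁ μ₁ → v (x₁ - F₁.y) ≤ℤ⁺ v (x₂ - F₂.y)
    Ball⊇⇒radius≤ ⊇ = ≡.subst (_≤ℤ⁺ v (x₂ - F₂.y)) (≡.sym F₁.xy≡μ) (ultrametric x₂ x₁ F₂.y
      (Ball-≤ x₁ μ₁ (⊇ (centre∈Ball x₂ μ₂ F₂.x∈ℛ)))
      (≡.subst ([ μ₁ ] ≤ℤ⁺_) (v-swap F₂.y x₁) (Ball-≤ x₁ μ₁ (⊇ y₂∈Ball))))

  module _ {t₁ t₂ x₁ x₂ μ₁ μ₂} (F₁ : OrderedForm t₁ x₁ μ₁) (F₂ : OrderedForm t₂ x₂ μ₂) where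

    ∼⇒Ball≐ : t₁ ∼ t₂ → Ball x₁ μ₁ ≐ Ball x₂ μ₂
    ∼⇒Ball≐ t₁∼t₂ = ∼⇒Ball⊆ F₁ F₂ t₁∼t₂ , ∼⇒Ball⊆ F₂ F₁ (∼-sym {t₁} {t₂} t₁∼t₂)

    Ball≐⇒∼ : Ball x₁ μ₁ ≐ Ball x₂ μ₂ → t₁ ∼ t₂
    Ball≐⇒∼ (⊆ , ⊇) = ≈disc⇒∼ F₁ F₂ (
      ℤ⁺.≤-antisym (Ball⊇⇒radius≤ F₁ F₂ ⊇) (Ball⊇⇒radius≤ F₂ F₁ ⊆) ,
      ≡.subst₂ _≤ℤ⁺_ (≡.sym (OrderedForm.xy≡μ F₁)) (v-swap x₂ x₁)
        (Ball-≤ x₁ μ₁ (⊇ (centre∈Ball x₂ μ₂ (OrderedForm.x∈ℛ F₂)))))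

  -- The map Φ and its injectivity.

  Φ-cluster : ∀ t → Ordered t → ProperCluster
  Φ-cluster t o = record
    { subset    = Φ₀ t o
    ; isCluster = Ball-isCluster (centre t o) (radius t o) x∈ℛ
    ; isProper  = centre t o , y , centre∈Ball (centre t o) (radius t o) x∈ℛ , y₂∈Ball F F , x≉y
    }
    where
    F = orderedForm t o
    open OrderedForm F

  rep : Triple → Triple
  rep t = proj₁ (ordered-representative t)

  rep-∼ : ∀ t → rep t ∼ t
  rep-∼ t = proj₁ (proj₂ (ordered-representative t))

  rep-ordered : ∀ t → Ordered (rep t)
  rep-ordered t = proj₂ (proj₂ (ordered-representative t))

  Φ : Func T/∼ Clusters
  Φ = record
    { to   = λ t → Φ-cluster (rep t) (rep-ordered t)
    ; cong = λ {t₁} {t₂} t₁∼t₂ → ∼⇒Ball≐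
        (orderedForm (rep t₁) (rep-ordered t₁)) (orderedForm (rep t₂) (rep-ordered t₂))
        (∼-trans {rep t₁} {t₁} {rep t₂} (rep-∼ t₁)
          (∼-trans {t₁} {t₂} {rep t₂} t₁∼t₂ (∼-sym {rep t₂} {t₂} (rep-∼ t₂))))
    }

  open Func Φ using (to)

  Φ≐Φ₀ : ∀ t (o : Ordered t) → subset (to t) ≐ Φ₀ t o
  Φ≐Φ₀ t o = ∼⇒Ball≐ (orderedForm (rep t) (rep-ordered t)) (orderedForm t o) (rep-∼ t)

  Φ-injective : Injective _∼_ (Setoid._≈_ Clusters) to
  Φ-injective {t₁} {t₂} Φ≐ = ∼-trans {t₁} {rep t₁} {t₂} (∼-sym {rep t₁} {t₁} (rep-∼ t₁))
    (∼-trans {rep t₁} {rep t₂} {t₂}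
      (Ball≐⇒∼ (orderedForm (rep t₁) (rep-ordered t₁)) (orderedForm (rep t₂) (rep-ordered t₂)) Φ≐)
      (rep-∼ t₂))

  -- The image of Φ.

  Φ₀≐Ball : ∀ t (o : Ordered t) {x y μ} → Triple.a t ≡ [ x ] → Triple.b t ≡ [ y ] →
            v (x - y) ≡ [ μ ] → Φ₀ t o ≐ Ball x μ
  Φ₀≐Ball t o a≡x b≡y xy≡μ = ball (ordered-finite t o) a≡x b≡y xy≡μ
    where
    open Triple t
    ball : ∀ (fin : ∃[ x ] ∃[ μ ] a ≡ [ x ] × v⟨ a - b ⟩ ≡ [ [ μ ] ]) {x y μ} →
           a ≡ [ x ] → b ≡ [ y ] → v (x - y) ≡ [ μ ] →
           Ball (proj₁ fin) (proj₁ (proj₂ fin)) ≐ Ball x μ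
    ball (x′ , μ′ , a≡x′ , ab≡μ′) {x} {y} {μ} a≡x b≡y xy≡μ
      with []-injective (≡.trans (≡.sym a≡x) a≡x′)
         | []-injective (ℤ±.lift-injective {[ μ′ ]} {[ μ ]} (≡.trans (≡.sym ab≡μ′)
             (≡.trans (≡.cong₂ v⟨_-_⟩ a≡x b≡y) (≡.cong ℤ±.lift xy≡μ))))
    ... | ≡.refl | ≡.refl = ≐-refl

  -- The radius presenting a cluster is an arbitrary rational that no pair of roots need attain. It
  -- is replaced by an integer attained between `x` and `b`, which can serve as the first two
  -- entries of an ordered triple.
  record Extremal (U : Subset) (x : Carrier) : Set (κ ⊔ ℓ) where
    field
      b       : Carrier
      b∈U     : b ∈ U
      μ       : ℤ
      xb≡μ    : v (x - b) ≡ [ μ ]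
      minimal : ∀ z → z ∈ U → [ μ ] ≤ℤ⁺ v (x - z)

    x≉b : x ≉ b
    x≉b = finite⇒≉0 xb≡μ ∘ x≈y⇒x-y≈0

  extremal : ∀ {U} → Decidable U → U Respects≈ → U ⊆ ℛ → ∀ {x y} → x ∈ U → y ∈ U → x ≉ y →
             Extremal U x
  extremal {U} U? U-resp U⊆ℛ {x} {y} x∈ y∈ x≉y = record
    { b = b ; b∈U = proj₁ (proj₂ far) ; μ = proj₁ finite ; xb≡μ = proj₂ finite
    ; minimal = λ z z∈ → ≡.subst (_≤ℤ⁺ v (x - z)) (proj₂ finite) (nearest z z∈) }
    where
    far : ∃[ b ] b ∈ U × (∀ y → y ∈ U → v (x - b) ≤ℤ⁺ v (x - y))
    far = farthest U? U-resp U⊆ℛ x∈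
    b = proj₁ far
    nearest = proj₂ (proj₂ far)

    -- Were the least value `v (x - b)` infinite, `v (x - y)` would be too, although `x` and `y`
    -- differ.
    finite : ∃[ μ ] v (x - b) ≡ [ μ ]
    finite = v-finite λ xb≈0 → x≉y (x-y≈0⇒x≈y (Equivalence.to (v-∞ (x - y))
      (ℤ⁺.≤-antisym (_ ≤⊤⁺) (≡.subst (_≤ℤ⁺ v (x - y)) (Equivalence.from (v-∞ (x - b)) xb≈0) (nearest y y∈)))))

  ordered⇒image : ∀ t → Ordered t → ∀ {x y μ} → Triple.a t ≡ [ x ] → Triple.b t ≡ [ y ] →
                  v (x - y) ≡ [ μ ] → ∀ {U : Subset} → Ball x μ ≐ U → ∃[ t ] subset (to t) ≐ U
  ordered⇒image t o {x} {y} {μ} a≡x b≡y xy≡μ {U} Ball≐U =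
    t , (λ {z} z∈ → proj₁ Ball≐U (proj₁ Φ₀≐ (proj₁ (Φ≐Φ₀ t o) {z} z∈))) ,
        (λ {z} z∈ → proj₂ (Φ≐Φ₀ t o) (proj₂ Φ₀≐ (proj₂ Ball≐U {z} z∈)))
    where
    Φ₀≐ : Φ₀ t o ≐ Ball x μ
    Φ₀≐ = Φ₀≐Ball t o {x} {y} {μ} a≡x b≡y xy≡μ

  extremal⇒image : ∀ {U} → IsCluster U → ∀ {x} → x ∈ U → Extremal U x → ∀ {c} → c ∈ ℛ → c ∉ U →
                   ∃[ t ] subset (to t) ≐ U
  extremal⇒image {U} cl {x} x∈U E {c} c∈ℛ c∉U =
    ordered⇒image t ordered {x} {b} {μ} ≡.refl ≡.refl xb≡μ {U} (Ball⊆U , U⊆Ball)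
    where
    open Extremal E

    Ball⊆U : Ball x μ ⊆ U
    Ball⊆U {z} z∈ = cluster-closer cl {x} {b} {z} x∈U b∈U (proj₂ z∈)
      (≡.subst₂ _≤ℤ⁺_ (≡.sym xb≡μ) (v-swap z x) (Ball-≤ x μ z∈))

    U⊆Ball : U ⊆ Ball x μ
    U⊆Ball {z} z∈ = ∈Ball x μ (cluster⊆ℛ cl z∈) (≡.subst ([ μ ] ≤ℤ⁺_) (v-swap x z) (minimal z z∈))

    -- Otherwise `c` would be at least as close to `z` as `w` is, and `cluster-closer` would put it
    -- in `U`.
    farther : ∀ {z w} → z ∈ U → w ∈ U → v (z - c) ≤ℤ⁺ v (z - w)
    farther {z} {w} z∈ w∈ = [ (λ ≤ → ≤) ,
      (λ ≥ → contradiction (cluster-closer cl {z} {w} {c} z∈ w∈ c∈ℛ ≥) c∉U) ]′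
      (ℤ⁺.≤-total (v (z - c)) (v (z - w)))

    bc≤xb : v (b - c) ≤ℤ⁺ v (x - b)
    bc≤xb = ≡.subst (v (b - c) ≤ℤ⁺_) (v-swap b x) (farther b∈U x∈U)

    ≉c : ∀ {z} → z ∈ U → z ≉ c
    ≉c {z} z∈ z≈c = c∉U (cluster-resp cl {z} {c} z≈c z∈)

    t : Triple
    t = record
      { a = [ x ] ; b = [ b ] ; c = [ c ]
      ; a∈S = cluster⊆ℛ cl x∈U ; b∈S = cluster⊆ℛ cl b∈U ; c∈S = c∈ℛ
      ; a≉b = λ { [ e ] → x≉b e } ; b≉c = λ { [ e ] → ≉c b∈U e } ; a≉c = λ { [ e ] → ≉c x∈U e } }

    ordered : Ordered t
    ordered = closest⇒ordered t (ℤ±.lift-≤ {v (b - c)} {v (x - b)} bc≤xb)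
      (ℤ±.lift-≤ {v (x - c)} {v (x - b)} (farther {x} {b} x∈U b∈U))

  proper⊂ℛ∈Im : ∀ s → ¬ subset s ≐ ℛ → ∃[ t ] subset (to t) ≐ subset s
  proper⊂ℛ∈Im s s≉ℛ = image isProper out
    where
    open ProperCluster s using (isCluster; isProper)
    U : Subset
    U = subset s

    out : ∃[ c ] c ∈ ℛ × c ∉ U
    out = outside (cluster? isCluster) (cluster-resp isCluster)
      (λ ℛ⊆U → s≉ℛ ((λ {z} → cluster⊆ℛ isCluster {z}) , (λ {z} → ℛ⊆U {z})))

    image : IsProper U → ∃[ c ] c ∈ ℛ × c ∉ U → ∃[ t ] subset (to t) ≐ U
    image (x , y , x∈ , y∈ , x≉y) (c , c∈ℛ , c∉U) = extremal⇒image isCluster x∈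
      (extremal (cluster? isCluster) (cluster-resp isCluster) (cluster⊆ℛ isCluster) x∈ y∈ x≉y)
      c∈ℛ c∉U

  ℛ-extremal : ∀ {x y} → x ∈ ℛ → y ∈ ℛ → x ≉ y → Extremal ℛ x
  ℛ-extremal = extremal ℛ? ℛ-resp (λ z∈ → z∈)

  ∞∈S⇒ℛ∈Im : ∞ ∈ S → ∀ {x} → x ∈ ℛ → Extremal ℛ x → ∃[ t ] subset (to t) ≐ ℛ
  ∞∈S⇒ℛ∈Im ∞∈S {x} x∈ E = ordered⇒image t ordered {x} {b} {μ} ≡.refl ≡.refl xb≡μ {ℛ} (proj₂ , ℛ⊆Ball)
    where
    open Extremal E

    t : Triple
    t = record
      { a = [ x ] ; b = [ b ] ; c = ∞ ; a∈S = x∈ ; b∈S = b∈U ; c∈S = ∞∈S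
      ; a≉b = λ { [ e ] → x≉b e } ; b≉c = λ () ; a≉c = λ () }

    ordered : Ordered t
    -- Both differences with `∞` are `⊥±`, so every pair of distinct roots is in order.
    ordered = ≡.refl , ℤ±.⊥≤ v⟨ [ x ] - [ b ] ⟩

    ℛ⊆Ball : ℛ ⊆ Ball x μ
    ℛ⊆Ball {z} z∈ = ∈Ball x μ z∈ (≡.subst ([ μ ] ≤ℤ⁺_) (v-swap x z) (minimal z z∈))

  equidistant⇒ℛ∈Im : EquidistantTriple → ∃[ t ] subset (to t) ≐ ℛ
  equidistant⇒ℛ∈Im (μ , a , b , c , (_ , diam) , a∈ , b∈ , c∈ , a≉b , b≉c , a≉c , ab , bc , ac) =
    ordered⇒image t ordered {a} {b} {μ} ≡.refl ≡.refl ab {ℛ} (proj₂ , ℛ⊆Ball)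
    where
    t : Triple
    t = record
      { a = [ a ] ; b = [ b ] ; c = [ c ] ; a∈S = a∈ ; b∈S = b∈ ; c∈S = c∈
      ; a≉b = λ { [ e ] → a≉b e } ; b≉c = λ { [ e ] → b≉c e } ; a≉c = λ { [ e ] → a≉c e } }

    ordered : Ordered t
    ordered = ≡.cong ℤ±.lift (≡.trans ac (≡.sym bc)) ,
      ℤ±.lift-≤ {v (b - c)} {v (a - b)} (ℤ⁺.≤-reflexive (≡.trans bc (≡.sym ab)))

    ℛ⊆Ball : ℛ ⊆ Ball a μ
    ℛ⊆Ball {z} z∈ = ∈Ball a μ z∈ (diam z a z∈ a∈)

  ℛ∈Im : ∞ ∈ S ⊎ EquidistantTriple → ∃[ t ] subset (to t) ≐ ℛ
  ℛ∈Im (inj₂ equidistant) = equidistant⇒ℛ∈Im equidistant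
  ℛ∈Im (inj₁ ∞∈S)         = image (distinct-roots (Level.lower ∞∈S))
    where
    image : ∃[ x ] ∃[ y ] x ∈ ℛ × y ∈ ℛ × x ≉ y → ∃[ t ] subset (to t) ≐ ℛ
    image (x , y , x∈ , y∈ , x≉y) = ∞∈S⇒ℛ∈Im ∞∈S x∈ (ℛ-extremal x∈ y∈ x≉y)

  -- Children of the maximal cluster.

  suc≰⇒≤ : ∀ {μ} u → ¬ [ ℤ.suc μ ] ≤ℤ⁺ u → u ≤ℤ⁺ [ μ ]
  suc≰⇒≤     ∞     suc≰ = contradiction (_ ≤⊤⁺) suc≰
  suc≰⇒≤ {μ} [ j ] suc≰ with j ℤ.≤? μ
  ... | yes j≤μ = [ j≤μ ]
  ... | no  j≰μ = contradiction [ ℤ.i<j⇒suc[i]≤j (ℤ.≰⇒> j≰μ) ] suc≰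

  suc≰ : ∀ {μ u} → u ≡ [ μ ] → ¬ [ ℤ.suc μ ] ≤ℤ⁺ u
  suc≰ ≡.refl [ p ] = ℤ.<-irrefl ≡.refl (ℤ.suc[i]≤j⇒i<j p)

  module _ {μ : ℤ} (diam : IsDiameter ℛ μ) where

    -- Finite values on `K` are integers, so a value beyond `μ` is at least `suc μ`: these are the
    -- classes of roots closer together than the diameter.
    Residue : Carrier → Subset
    Residue a = Ball a (ℤ.suc μ)

    -- The two roots that attain the diameter cannot both be this close to `a`.
    Residue⊂ℛ : ∀ a → ¬ ℛ ⊆ Residue a
    Residue⊂ℛ a ℛ⊆ = attained (proj₁ diam)
      where
      attained : ¬ (∃[ z ] ∃[ t ] z ∈ ℛ × t ∈ ℛ × v (z - t) ≡ [ μ ])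
      attained (z , t , z∈ , t∈ , zt) = suc≰ zt (ultrametric z a t
        (Ball-≤ a (ℤ.suc μ) (ℛ⊆ z∈))
        (≡.subst ([ ℤ.suc μ ] ≤ℤ⁺_) (v-swap t a) (Ball-≤ a (ℤ.suc μ) (ℛ⊆ t∈))))

    -- A larger cluster has a member `w` with `v (w - a)` at most `μ`. Every root is at least as
    -- close to `a` as `w` is, so `cluster-closer` makes that cluster all of `ℛ`.
    Residue-isChild : ∀ {a} → a ∈ ℛ → IsChildOf (Residue a) ℛ
    Residue-isChild {a} a∈ = Ball-isCluster a (ℤ.suc μ) a∈ , (proj₂ , λ ℛ⊆ → Residue⊂ℛ a (λ {z} → ℛ⊆ {z})) , maximal
      where
      maximal : ∀ W → IsCluster W → Residue a ⊆ W → W ⊂ ℛ → W ⊆ Residue a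
      maximal W cl ⊆W (_ , ℛ⊈W) {w} w∈ with [ ℤ.suc μ ] ℤ⁺.≤? v (w - a)
      ... | yes p = ∈Ball a (ℤ.suc μ) (cluster⊆ℛ cl w∈) p
      ... | no ¬p = ⊥-elim (ℛ⊈W λ {z} z∈ → cluster-closer cl (⊆W (centre∈Ball a (ℤ.suc μ) a∈)) w∈ z∈
        (ℤ⁺.≤-trans (≡.subst (_≤ℤ⁺ [ μ ]) (v-swap w a) (suc≰⇒≤ (v (w - a)) ¬p)) (proj₂ diam a z a∈ z∈)))

    Residue-distinct : ∀ {a b} → a ∈ ℛ → v (a - b) ≡ [ μ ] → ¬ Residue a ≐ Residue b
    Residue-distinct {a} {b} a∈ ab (⊆ , _) =
      suc≰ ab (Ball-≤ b (ℤ.suc μ) (⊆ (centre∈Ball a (ℤ.suc μ) a∈)))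

  -- Clusters with a common point are nested, and maximality of the smaller one makes them equal.
  children-disjoint : ∀ {U V} → IsChildOf U ℛ → IsChildOf V ℛ → ¬ U ≐ V → ∀ {x} → x ∈ U → x ∉ V
  children-disjoint {U} {V} (U-cl , U⊂ , U-max) (V-cl , V⊂ , V-max) U≉V x∈U x∈V =
    disjoint (clusters-nested U-cl V-cl x∈U x∈V)
    where
    disjoint : ¬ (U ⊆ V ⊎ V ⊆ U)
    disjoint (inj₁ U⊆V) = U≉V ((λ {z} → U⊆V {z}) , λ {z} → U-max V V-cl U⊆V V⊂ {z})
    disjoint (inj₂ V⊆U) = U≉V ((λ {z} → V-max U U-cl V⊆U U⊂ {z}) , λ {z} → V⊆U {z})

  -- If `a` and `b` were closer than the diameter, `b` would lie in the residue class of `a`. That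
  -- class is comparable with `U`, and by maximality of `U` contained in it, which puts `b` in both
  -- children.
  children-distance : ∀ {U V μ} → IsDiameter ℛ μ → IsChildOf U ℛ → IsChildOf V ℛ → ¬ U ≐ V →
                      ∀ {a b} → a ∈ U → b ∈ V → v (a - b) ≡ [ μ ]
  children-distance {U} {V} {μ} diam U-child@(U-cl , U⊂ , U-max) V-child@(V-cl , _) U≉V {a} {b} a∈U b∈V =
    ℤ⁺.≤-antisym (suc≰⇒≤ (v (a - b)) too-close) (proj₂ diam a b a∈ b∈)
    where
    a∈ : a ∈ ℛ
    a∈ = cluster⊆ℛ U-cl a∈U

    b∈ : b ∈ ℛ
    b∈ = cluster⊆ℛ V-cl b∈V

    b∉U : b ∉ U
    b∉U b∈U = children-disjoint U-child V-child U≉V b∈U b∈V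

    W : Subset
    W = Residue diam a

    W-cl : IsCluster W
    W-cl = Ball-isCluster a (ℤ.suc μ) a∈

    too-close : ¬ [ ℤ.suc μ ] ≤ℤ⁺ v (a - b)
    too-close p = b∉U (W⊆U (clusters-nested U-cl W-cl a∈U (centre∈Ball a (ℤ.suc μ) a∈))
        (∈Ball a (ℤ.suc μ) b∈ (≡.subst ([ ℤ.suc μ ] ≤ℤ⁺_) (v-swap a b) p)))
      where
      W⊆U : U ⊆ W ⊎ W ⊆ U → ∀ {z} → z ∈ W → z ∈ U
      W⊆U (inj₁ U⊆W) = U-max W W-cl U⊆W (proj₂ , λ ℛ⊆ → Residue⊂ℛ diam a (λ {z} → ℛ⊆ {z}))
      W⊆U (inj₂ W⊆U) = W⊆U

  equidistant⇒children : EquidistantTriple → MoreThanTwoChildren ℛ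
  equidistant⇒children (μ , a , b , c , diam , a∈ , b∈ , c∈ , _ , _ , _ , ab , bc , ac) =
    Residue diam a , Residue diam b , Residue diam c ,
    Residue-isChild diam a∈ , Residue-isChild diam b∈ , Residue-isChild diam c∈ ,
    Residue-distinct diam a∈ ab , Residue-distinct diam b∈ bc , Residue-distinct diam a∈ ac

  children⇒equidistant : MoreThanTwoChildren ℛ → EquidistantTriple
  children⇒equidistant (U₁ , U₂ , U₃ ,
      ch₁@(cl₁@((a , a∈U₁) , _) , _) , ch₂@(cl₂@((b , b∈U₂) , _) , _) , ch₃@(cl₃@((c , c∈U₃) , _) , _) ,
      U₁≉U₂ , U₂≉U₃ , U₁≉U₃) =
    equidistant (ℛ-extremal a∈ b∈ a≉b)
    where
    a∈ : a ∈ ℛ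
    a∈ = cluster⊆ℛ cl₁ a∈U₁

    b∈ : b ∈ ℛ
    b∈ = cluster⊆ℛ cl₂ b∈U₂

    a≉b : a ≉ b
    a≉b a≈b = children-disjoint ch₁ ch₂ U₁≉U₂ {b} (cluster-resp cl₁ {a} {b} a≈b a∈U₁) b∈U₂

    equidistant : Extremal ℛ a → EquidistantTriple
    equidistant E = μ , a , b , c , diam , a∈ , b∈ , cluster⊆ℛ cl₃ c∈U₃ ,
      distinct ab , distinct bc , distinct ac , ab , bc , ac
      where
      open Extremal E using (μ; minimal; b∈U; xb≡μ) renaming (b to e)

      -- The least value as seen from the single point `a` is the diameter, because any two roots
      -- can be compared through `a`.
      diam : IsDiameter ℛ μ
      diam = (a , e , a∈ , b∈U , xb≡μ) , λ z t z∈ t∈ → ultrametric z a t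
        (≡.subst ([ μ ] ≤ℤ⁺_) (v-swap a z) (minimal z z∈)) (minimal t t∈)

      ab : v (a - b) ≡ [ μ ]
      ab = children-distance diam ch₁ ch₂ U₁≉U₂ {a} {b} a∈U₁ b∈U₂

      bc : v (b - c) ≡ [ μ ]
      bc = children-distance diam ch₂ ch₃ U₂≉U₃ {b} {c} b∈U₂ c∈U₃

      ac : v (a - c) ≡ [ μ ]
      ac = children-distance diam ch₁ ch₃ U₁≉U₃ {a} {c} a∈U₁ c∈U₃

      distinct : ∀ {x y} → v (x - y) ≡ [ μ ] → x ≉ y
      distinct xy≡μ = finite⇒≉0 xy≡μ ∘ x≈y⇒x-y≈0

theorem2p6 : ∀ {c ℓ} (𝒞 : SuperellipticCurve c ℓ) → let open Curve 𝒞 in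
    (∀ t → ∃[ t′ ] t′ ∼ t × Ordered t′) ×
    (∃[ Φ ] let open Func {From = T/∼} {To = Clusters} Φ in
    (∀ t (o : Ordered t) → subset (to t) ≐ Φ₀ t o) ×
    Injective _∼_ (Setoid._≈_ Clusters) to ×
    (∀ s → ¬ subset s ≐ ℛ → ∃[ t ] subset (to t) ≐ subset s) ×
    (∞ ∈ S ⊎ EquidistantTriple → ∃[ t ] subset (to t) ≐ ℛ)) ×
    (EquidistantTriple ⇔ MoreThanTwoChildren ℛ)
theorem2p6 𝒞 =
  ordered-representative ,
  (Φ , Φ≐Φ₀ , (λ {t₁} {t₂} → Φ-injective {t₁} {t₂}) , proper⊂ℛ∈Im , ℛ∈Im) ,
  mk⇔ equidistant⇒children children⇒equidistant
  where
  open Moebius 𝒞 using (ordered-representative)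
  open ClusterMap 𝒞
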